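{- Let $q$ be a power of $3$, let $L$ be a generic line of $PG(3,q)$, let $\mathcal{P}$ be the set of the $q+1$ points of $L$, and let $r=\jmath(f_L)$. (1) If $f_L\in\mathcal{F}_i$ with $i\in\{1,2,4\}$, then $|\mathcal{P}\cap\mathcal{C}|=|\mathcal{P}\cap\mathcal{AX}|=0$, $|\mathcal{P}\cap\mathcal{T}|=i$, $|\mathcal{P}\cap\mathcal{RC}|=\frac{\#\mathcal{E}_r(\mathbb{F}_q)-i}{2}$, and $|\mathcal{P}\cap\mathcal{IC}|=q+1-\frac{\#\mathcal{E}_r(\mathbb{F}_q)+i}{2}$. (2) If $f_L\in\mathcal{F}_2'\cup\mathcal{F}_4'$, then $|\mathcal{P}\cap\mathcal{C}|=|\mathcal{P}\cap\mathcal{AX}|=|\mathcal{P}\cap\mathcal{T}|=0$, $|\mathcal{P}\cap\mathcal{RC}|=\frac{\#\mathcal{E}_r(\mathbb{F}_q)}{2}$, and $|\mathcal{P}\cap\mathcal{IC}|=q+1-\frac{\#\mathcal{E}_r(\mathbb{F}_q)}{2}$.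
   Context: Points of $PG(3,q)$ are $(y_0:y_1:y_2:y_3)$; $\nu(s,t)=(s^3:s^2t:st^2:t^3)$ and the twisted cubic $C$ (also denoted $\mathcal{C}$ as a point set) is $\{\nu(s,t):(s:t)\in PG(1,q)\}$, $C(K)$ the analogous set over $K\supseteq\mathbb{F}_q$. The osculating plane at $\nu(s,t)$ is $t^3y_0-s^3y_3=0$; the axis is the line $y_0=y_3=0$ and $\mathcal{AX}$ is its set of $q+1$ points. The tangent line of $C$ at $\nu(s,t)$ is the line through $\nu(s,t)$ and $(0:s:-t:0)$. $\mathcal{T}$ is the set of points of $PG(3,q)$ lying on a tangent line at a point of $C$ but not in $\mathcal{C}\cup\mathcal{AX}$; $\mathcal{RC}$ is the set of points not in $\mathcal{C}$ lying on a real chord (line joining two distinct points of $C$); $\mathcal{IC}$ is the set of points of $PG(3,q)$ lying on an imaginary chord (line joining two points $P\ne P^q$ of $C(\mathbb{F}_{q^2})$ that are conjugate under Frobenius). A line is generic if it does not meet $C(\overline{\mathbb{F}_q})$ and is not contained in any osculating plane. For the line $L$ through distinct points $x,y$, $p_{ij}=x_iy_j-x_jy_i$ and $f_L=p_{23}X^4+p_{13}X^3Y+p_{03}X^2Y^2+p_{02}XY^3+p_{01}Y^4$. For $f=\sum z_iX^{4-i}Y^i$: $\Delta(f)=(z_0z_4-z_1z_3)^3+(z_0z_4-z_1z_3)^2z_2^2-z_2^3(z_0z_3^2+z_4z_1^2-z_0z_2z_4)$, $\jmath(f)=z_2^6/\Delta(f)$. Types: $\mathcal{F}_4$ (four linear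 factors over $\mathbb{F}_q$), $\mathcal{F}_2$ (two linear, one irreducible quadratic), $\mathcal{F}_1$ (one linear, one irreducible cubic), $\mathcal{F}_4'$ (two irreducible quadratics), $\mathcal{F}_2'$ (irreducible). $\mathcal{E}_r$: $x^2=y^3+y^2-r^{ -1}$, $\#\mathcal{E}_r(\mathbb{F}_q)$ counts projective $\mathbb{F}_q$-points including the point at infinity. -}

module Defs where

open import Level using (0ℓ)
open import Data.Nat as ℕ using (ℕ; zero; suc)
open import Data.Product using (Σ; ∃; ∃₂; _×_; _,_)
open import Data.Sum using (_⊎_)
open import Data.Empty using (⊥)
open import Data.List using (List; length)
open import Data.List.Membership.Propositional using (_∈_)
open import Data.List.Relation.Unary.Unique.Propositional using (Unique)
open import Relation.Binary.PropositionalEquality using (_≡_; _≢_)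
open import Relation.Nullary using (¬_)
open import Algebra.Structures using (IsCommutativeRing)

record Field : Set₁ where
  infixl 6 _+_ _-_
  infixl 7 _*_
  infix  8 -_
  infix  9 _⁻¹
  field
    Carrier : Set
    0# 1#   : Carrier
    _+_ _*_ : Carrier → Carrier → Carrier
    -_      : Carrier → Carrier
    _⁻¹     : Carrier → Carrier
    isCommutativeRing : IsCommutativeRing _≡_ _+_ _*_ -_ 0# 1#
    0≢1      : 0# ≢ 1#
    ⁻¹-inverse : ∀ x → x ≢ 0# → x * x ⁻¹ ≡ 1#
    0⁻¹≡0    : 0# ⁻¹ ≡ 0#

  _-_ : Carrier → Carrier → Carrier
  x - y = x + (- y)

  pow : Carrier → ℕ → Carrier
  pow x zero    = 1#
  pow x (suc n) = x * pow x n

HasCount : {A : Set} → (A → Set) → ℕ → Set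
HasCount {A} P n =
  Σ (List A) λ xs → Unique xs × (∀ a → (a ∈ xs → P a) × (P a → a ∈ xs)) × length xs ≡ n

IsFinite : Field → ℕ → Set
IsFinite F q = HasCount {Field.Carrier F} (λ _ → Data.Unit.⊤) q
  where import Data.Unit

record RingHom (F K : Field) : Set where
  private
    module F = Field F
    module K = Field K
  field
    ⟦_⟧   : F.Carrier → K.Carrier
    map-0 : ⟦ F.0# ⟧ ≡ K.0#
    map-1 : ⟦ F.1# ⟧ ≡ K.1#
    map-+ : ∀ a b → ⟦ a F.+ b ⟧ ≡ ⟦ a ⟧ K.+ ⟦ b ⟧
    map-* : ∀ a b → ⟦ a F.* b ⟧ ≡ ⟦ a ⟧ K.* ⟦ b ⟧

-- Projective geometry over a field F.  Vectors of F^4 represent points of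
-- PG(3,F); a point of PG(3,q) is represented by its unique normalized
-- representative (first nonzero coordinate equal to 1).

module Geom (F : Field) where
  open Field F

  V4 : Set
  V4 = Carrier × Carrier × Carrier × Carrier

  0v : V4
  0v = 0# , 0# , 0# , 0#

  infixl 6 _⊕_
  infixr 7 _•_
  _•_ : Carrier → V4 → V4
  c • (a , b , d , e) = c * a , c * b , c * d , c * e

  _⊕_ : V4 → V4 → V4
  (a , b , c , d) ⊕ (a' , b' , c' , d') = a + a' , b + b' , c + c' , d + d'

  Nonzero : V4 → Set
  Nonzero v = ¬ (v ≡ 0v)

  -- same projective point (for nonzero w)
  Proportional : V4 → V4 → Set
  Proportional v w = ∃ λ c → c ≢ 0# × v ≡ c • w

  Normalized : V4 → Set
  Normalized (a , b , c , d) =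
    (a ≡ 1#) ⊎ (a ≡ 0# × b ≡ 1#) ⊎ (a ≡ 0# × b ≡ 0# × c ≡ 1#)
      ⊎ (a ≡ 0# × b ≡ 0# × c ≡ 0# × d ≡ 1#)

  NonzeroPair : Carrier → Carrier → Set
  NonzeroPair s t = ¬ (s ≡ 0# × t ≡ 0#)

  ν : Carrier → Carrier → V4
  ν s t = s * s * s , s * s * t , s * t * t , t * t * t

  InSpan : V4 → V4 → V4 → Set
  InSpan x y v = ∃₂ λ a b → v ≡ a • x ⊕ b • y

  InC : V4 → Set
  InC v = ∃₂ λ s t → NonzeroPair s t × Proportional v (ν s t)

  InAX : V4 → Set
  InAX (a , b , c , d) = a ≡ 0# × d ≡ 0#

  -- direction (0 : s : -t : 0) of the tangent at ν(s,t)
  tdir : Carrier → Carrier → V4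
  tdir s t = 0# , s , - t , 0#

  OnTangent : V4 → Set
  OnTangent v = ∃₂ λ s t → NonzeroPair s t × InSpan (ν s t) (tdir s t) v

  InT : V4 → Set
  InT v = OnTangent v × ¬ InC v × ¬ InAX v

  InRC : V4 → Set
  InRC v = ¬ InC v ×
    (∃₂ λ s₁ t₁ → ∃₂ λ s₂ t₂ → (s₁ * t₂ - s₂ * t₁ ≢ 0#) × InSpan (ν s₁ t₁) (ν s₂ t₂) v)

  -- osculating plane at ν(s,t) : t^3 y0 - s^3 y3 = 0
  InOsc : Carrier → Carrier → V4 → Set
  InOsc s t (a , b , c , d) = t * t * t * a - s * s * s * d ≡ 0#

  Lin Quad Cub Quart : Set
  Lin   = Carrier × Carrier
  Quad  = Carrier × Carrier × Carrier
  Cub   = Carrier × Carrier × Carrier × Carrier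
  Quart = Carrier × Carrier × Carrier × Carrier × Carrier

  _·ll_ : Lin → Lin → Quad
  (a , b) ·ll (c , d) = a * c , a * d + b * c , b * d

  _·lq_ : Lin → Quad → Cub
  (a , b) ·lq (c₀ , c₁ , c₂) = a * c₀ , a * c₁ + b * c₀ , a * c₂ + b * c₁ , b * c₂

  _·lc_ : Lin → Cub → Quart
  (a , b) ·lc (c₀ , c₁ , c₂ , c₃) =
    a * c₀ , a * c₁ + b * c₀ , a * c₂ + b * c₁ , a * c₃ + b * c₂ , b * c₃

  _·qq_ : Quad → Quad → Quart
  (a₀ , a₁ , a₂) ·qq (b₀ , b₁ , b₂) =
    a₀ * b₀ , a₀ * b₁ + a₁ * b₀ , a₀ * b₂ + a₁ * b₁ + a₂ * b₀ , a₁ * b₂ + a₂ * b₁ , a₂ * b₂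

  IrredQuad : Quad → Set
  IrredQuad g = ¬ (∃₂ λ l₁ l₂ → g ≡ l₁ ·ll l₂)

  IrredCub : Cub → Set
  IrredCub g = ¬ (∃₂ λ l h → g ≡ l ·lq h)

  IrredQuart : Quart → Set
  IrredQuart f = ¬ (∃₂ λ l h → f ≡ l ·lc h) × ¬ (∃₂ λ g h → f ≡ g ·qq h)

  𝓕₄ 𝓕₂ 𝓕₁ 𝓕₄' 𝓕₂' : Quart → Set
  𝓕₄  f = ∃₂ λ l₁ l₂ → ∃₂ λ l₃ l₄ → f ≡ (l₁ ·ll l₂) ·qq (l₃ ·ll l₄)
  𝓕₂  f = ∃₂ λ l₁ l₂ → ∃ λ g → IrredQuad g × f ≡ (l₁ ·ll l₂) ·qq g
  𝓕₁  f = ∃₂ λ l g → IrredCub g × f ≡ l ·lc g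
  𝓕₄' f = ∃₂ λ g h → IrredQuad g × IrredQuad h × f ≡ g ·qq h
  𝓕₂' f = IrredQuart f

  TypeF : ℕ → Quart → Set
  TypeF 1 f = 𝓕₁ f
  TypeF 2 f = 𝓕₂ f
  TypeF 4 f = 𝓕₄ f
  TypeF _ f = ⊥

  -- f_L = p23 X^4 + p13 X^3Y + p03 X^2Y^2 + p02 XY^3 + p01 Y^4
  fL : V4 → V4 → Quart
  fL (x₀ , x₁ , x₂ , x₃) (y₀ , y₁ , y₂ , y₃) =
    x₂ * y₃ - x₃ * y₂ , x₁ * y₃ - x₃ * y₁ , x₀ * y₃ - x₃ * y₀ ,
    x₀ * y₂ - x₂ * y₀ , x₀ * y₁ - x₁ * y₀

  Δ : Quart → Carrier
  Δ (z₀ , z₁ , z₂ , z₃ , z₄) =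
    pow (z₀ * z₄ - z₁ * z₃) 3 + pow (z₀ * z₄ - z₁ * z₃) 2 * pow z₂ 2
      - pow z₂ 3 * (z₀ * pow z₃ 2 + z₄ * pow z₁ 2 - z₀ * z₂ * z₄)

  jinv : Quart → Carrier
  jinv f@(z₀ , z₁ , z₂ , z₃ , z₄) = pow z₂ 6 * (Δ f) ⁻¹

  AffE : Carrier → Carrier × Carrier → Set
  AffE r (x , y) = pow x 2 ≡ pow y 3 + pow y 2 - r ⁻¹

  InSomeOsc : V4 → V4 → Set
  InSomeOsc x y = ∃₂ λ s t → NonzeroPair s t × InOsc s t x × InOsc s t y

  CountOnLine : V4 → V4 → (V4 → Set) → ℕ → Set
  CountOnLine x y S n = HasCount (λ v → Normalized v × InSpan x y v × S v) n

mapV : {F K : Field} → RingHom F K → Geom.V4 F → Geom.V4 K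
mapV ι (a , b , c , d) = ⟦ a ⟧ , ⟦ b ⟧ , ⟦ c ⟧ , ⟦ d ⟧
  where open RingHom ι

MeetsC : (F K : Field) → RingHom F K → Geom.V4 F → Geom.V4 F → Set
MeetsC F K ι x y =
  ∃₂ λ s t → NonzeroPair s t × InSpan (mapV ι x) (mapV ι y) (ν s t)
  where open Geom K

-- generic: meets C(K) for no extension field K of F (equivalently
-- C(F̄)), and lies in no osculating plane
Generic : (F : Field) → Geom.V4 F → Geom.V4 F → Set₁
Generic F x y = ((K : Field) (ι : RingHom F K) → ¬ MeetsC F K ι x y) × ¬ InSomeOsc x y
  where open Geom F

-- ℐ𝒞 : points (over F) lying on the chord through P = ν(s,t) and P^q,
-- P ≠ P^q, with s,t in K = F_{q^2}
InIC : (F K : Field) → RingHom F K → ℕ → Geom.V4 F → Set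
InIC F K ι q v =
  ∃₂ λ s t → (s * pow t q - pow s q * t ≢ 0#)
    × InSpan (ν s t) (ν (pow s q) (pow t q)) (mapV ι v)
  where open Field K
        open Geom K

-- the conclusions for a given i (i = 0 in part (2)), with #ℰ_r(F_q) = 1 + e
Concl : (F K : Field) → RingHom F K → ℕ → Geom.V4 F → Geom.V4 F → ℕ → ℕ → Set
Concl F K ι q x y e i =
  CountOnLine x y InC 0 × CountOnLine x y InAX 0 × CountOnLine x y InT i
  × (∃ λ n → CountOnLine x y InRC n × 2 ℕ.* n ℕ.+ i ≡ suc e)
  × (∃ λ m → CountOnLine x y (InIC F K ι q) m × 2 ℕ.* m ℕ.+ (suc e ℕ.+ i) ≡ 2 ℕ.* (q ℕ.+ 1))
  where open Geom F

{-# OPTIONS --safe #-}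

-- A point y off C lies on exactly one tangent, real chord or imaginary chord, according to whether the
-- discriminant D(y) = y₀²y₃² + y₁³y₃ + y₀y₂³ is zero, a nonzero square or a nonsquare. A generic line has
-- p₀₃ ≠ 0; after scaling f = f_L to have X²Y²-coefficient 1, D restricted to the line is f with its
-- coefficients cubed, so up to Frobenius the points of T, RC and IC correspond to the values of f on PG(1,q)
-- that are zero, nonzero squares and nonsquares. A double root of f would be a point of C on the line, hence
-- f is separable. It remains to see that w² = f has as many points as ℰ_r. If f takes a square value
-- (possibly 0) somewhere, an explicit substitution moving that point to infinity gives the Weierstrass
-- equation. If f took only nonsquare values, then w² = cf with c a value of f would have 2(q + 1) points,
-- whereas the same substitution bounds their number by 2q + 1.
module Submission where

open import Defs
open import Level using (0ℓ)
open import Algebra.Bundles using (CommutativeRing; RawRing)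
import Algebra.Properties.CommutativeSemigroup
import Algebra.Properties.Ring
import Algebra.Solver.Ring
open import Algebra.Solver.Ring.AlmostCommutativeRing
  using (fromCommutativeRing; AlmostCommutativeRing; _-Raw-AlmostCommutative⟶_)
open import Data.Empty using (⊥; ⊥-elim)
open import Data.List using (List; []; _∷_; _++_; map; length; filter; foldr)
open import Data.List.Membership.Propositional using (_∈_; lose; find)
open import Data.List.Membership.Propositional.Properties
  using (∈-map⁺; ∈-map⁻; ∈-++⁺ˡ; ∈-++⁺ʳ; ∈-++⁻; ∈-filter⁺; ∈-filter⁻)
open import Data.List.Membership.Propositional.Properties.WithK using (unique∧set⇒bag)
open import Data.List.Properties using (map-∘; map-cong; length-map; length-++)
open import Data.List.Relation.Binary.BagAndSetEquality using (∼bag⇒↭)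
open import Data.List.Relation.Binary.Permutation.Propositional using (_↭_; ↭⇒↭ₛ)
open import Data.List.Relation.Binary.Permutation.Propositional.Properties
  using (↭-length) renaming (map⁺ to ↭-map⁺)
import Data.List.Relation.Binary.Permutation.Setoid.Properties as Permutationₛ
open import Data.List.Relation.Unary.All as All using (All; []; _∷_)
import Data.List.Relation.Unary.All.Properties as Allₚ
open import Data.List.Relation.Unary.AllPairs as AllPairs using (AllPairs; []; _∷_)
import Data.List.Relation.Unary.AllPairs.Properties as AllPairsₚ
open import Data.List.Relation.Unary.Any using (Any; here; there)
open import Data.List.Relation.Unary.Unique.Propositional using (Unique)
import Data.List.Relation.Unary.Unique.Propositional.Properties as Uniqueₚ
open import Data.Maybe using (Maybe; just; nothing)
open import Data.Maybe.Properties using (just-injective)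
open import Data.Nat as ℕ using (ℕ; zero; suc)
open import Data.Nat.ListAction using (sum)
open import Data.Nat.ListAction.Properties using (sum-↭)
import Data.Nat.Properties as ℕₚ
open import Data.Nat.Solver using (module +-*-Solver)
open import Data.Product using (∃; ∃₂; _×_; _,_; proj₁; proj₂)
open import Data.Sum using (_⊎_; inj₁; inj₂; [_,_]′)
open import Data.Unit using (⊤; tt)
open import Data.Vec using (Vec; []; _∷_; replicate)
open import Function using (_∘_; mk⇔)
open import Relation.Binary.Definitions using (DecidableEquality)
open import Relation.Binary.PropositionalEquality
open import Relation.Nullary using (¬_; Dec; yes; no; ¬?)
open import Relation.Nullary.Decidable using (decidable-stable)
open import Relation.Unary using (Decidable)


-- Two features of characteristic 3 carry the argument. Cubing is a bijection of F_q, so every plane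
-- through the axis is osculating; this is why p₀₃ = 0 contradicts genericity, and why every point
-- of the line can be given a parameter that is a cube. Moreover the coefficient of X²Y² is
-- unchanged by Y ↦ Y + kX and by exchanging X and Y, so the normalisation z₂ = 1 survives moving a
-- point to infinity; Δ is invariant under both moves, and the constant of the Weierstrass equation
-- is always Δ(z) = 1/r. The delicate case is that of only nonsquare values, where w² = f offers no
-- rational point to start from. Counting alone excludes it. There the substitution is applied to
-- z₄f and breaks down only if z₄f is the square of a quadratic form; the roots of that form would
-- lie in the quadratic extension and not in F_q, so genericity is used over both fields.

data Z₃ : Set where
  𝟎 𝟏 𝟐 : Z₃

-- Polynomial identities in characteristic 3

module Z₃-Arithmetic where

  infixl 6 _+₃_
  infixl 7 _*₃_

  _+₃_ _*₃_ : Z₃ → Z₃ → Z₃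
  𝟎 +₃ b = b
  𝟏 +₃ 𝟎 = 𝟏
  𝟏 +₃ 𝟏 = 𝟐
  𝟏 +₃ 𝟐 = 𝟎
  𝟐 +₃ 𝟎 = 𝟐
  𝟐 +₃ 𝟏 = 𝟎
  𝟐 +₃ 𝟐 = 𝟏
  𝟎 *₃ b = 𝟎
  𝟏 *₃ b = b
  𝟐 *₃ 𝟎 = 𝟎
  𝟐 *₃ 𝟏 = 𝟐
  𝟐 *₃ 𝟐 = 𝟏

  -₃_ : Z₃ → Z₃
  -₃ 𝟎 = 𝟎
  -₃ 𝟏 = 𝟐
  -₃ 𝟐 = 𝟏

  rawRing : RawRing 0ℓ 0ℓ
  rawRing = record
    { Carrier = Z₃ ; _≈_ = _≡_ ; _+_ = _+₃_ ; _*_ = _*₃_ ; -_ = -₃_ ; 0# = 𝟎 ; 1# = 𝟏 }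

CharThree : Field → Set
CharThree F = 1# + (1# + 1#) ≡ 0#
  where open Field F

module FieldRing (F : Field) where
  open Field F

  commutativeRing : CommutativeRing 0ℓ 0ℓ
  commutativeRing = record { isCommutativeRing = isCommutativeRing }

  open CommutativeRing commutativeRing public
    using (+-comm; +-assoc; +-identityˡ; +-identityʳ; -‿inverseˡ; -‿inverseʳ;
           *-comm; *-assoc; *-identityˡ; *-identityʳ; distribˡ; distribʳ; zeroˡ; zeroʳ)

-- With coefficients in Z/3 the normaliser drops multiples of 3 by itself, so identities valid only
-- in characteristic 3, such as additivity of cubing, are proved by `refl`.
module RingSolver₃ (F : Field) (3≡0 : CharThree F) where
  open Field F
  open FieldRing F
  open Algebra.Properties.Ring (CommutativeRing.ring commutativeRing)
    using (-‿distribˡ-*; -‿involutive; -0#≈0#)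

  private
    R : AlmostCommutativeRing 0ℓ 0ℓ
    R = fromCommutativeRing commutativeRing

    open Z₃-Arithmetic

    ⟦_⟧₃ : Z₃ → Carrier
    ⟦ 𝟎 ⟧₃ = 0#
    ⟦ 𝟏 ⟧₃ = 1#
    ⟦ 𝟐 ⟧₃ = - 1#

    1+1≡-1 : 1# + 1# ≡ - 1#
    1+1≡-1 = begin
      1# + 1#                 ≡⟨ sym (+-identityˡ _) ⟩
      0# + (1# + 1#)          ≡⟨ cong (_+ (1# + 1#)) (sym (-‿inverseˡ 1#)) ⟩
      - 1# + 1# + (1# + 1#)   ≡⟨ +-assoc _ _ _ ⟩
      - 1# + (1# + (1# + 1#)) ≡⟨ cong (- 1# +_) 3≡0 ⟩
      - 1# + 0#               ≡⟨ +-identityʳ _ ⟩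
      - 1#                    ∎
      where open ≡-Reasoning

    +-homo : ∀ a b → ⟦ a +₃ b ⟧₃ ≡ ⟦ a ⟧₃ + ⟦ b ⟧₃
    +-homo 𝟎 b = sym (+-identityˡ _)
    +-homo 𝟏 𝟎 = sym (+-identityʳ _)
    +-homo 𝟏 𝟏 = sym 1+1≡-1
    +-homo 𝟏 𝟐 = sym (-‿inverseʳ _)
    +-homo 𝟐 𝟎 = sym (+-identityʳ _)
    +-homo 𝟐 𝟏 = sym (-‿inverseˡ _)
    +-homo 𝟐 𝟐 = begin
      1#                  ≡⟨ sym (+-identityʳ _) ⟩
      1# + 0#             ≡⟨ cong (1# +_) (sym (-‿inverseʳ _)) ⟩
      1# + (1# + - 1#)    ≡⟨ sym (+-assoc _ _ _) ⟩
      1# + 1# + - 1#      ≡⟨ cong (_+ - 1#) 1+1≡-1 ⟩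
      - 1# + - 1#         ∎
      where open ≡-Reasoning

    *-homo : ∀ a b → ⟦ a *₃ b ⟧₃ ≡ ⟦ a ⟧₃ * ⟦ b ⟧₃
    *-homo 𝟎 b = sym (zeroˡ _)
    *-homo 𝟏 b = sym (*-identityˡ _)
    *-homo 𝟐 𝟎 = sym (zeroʳ _)
    *-homo 𝟐 𝟏 = sym (*-identityʳ _)
    *-homo 𝟐 𝟐 = sym (trans (sym (-‿distribˡ-* 1# (- 1#)))
                   (trans (cong -_ (*-identityˡ _)) (-‿involutive 1#)))

    -‿homo : ∀ a → ⟦ -₃ a ⟧₃ ≡ - ⟦ a ⟧₃
    -‿homo 𝟎 = sym -0#≈0#
    -‿homo 𝟏 = refl
    -‿homo 𝟐 = sym (-‿involutive 1#)

    morphism : rawRing -Raw-AlmostCommutative⟶ R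
    morphism = record
      { ⟦_⟧ = ⟦_⟧₃ ; +-homo = +-homo ; *-homo = *-homo ; -‿homo = -‿homo
      ; 0-homo = refl ; 1-homo = refl }

    _≟₃_ : (a b : Z₃) → Maybe (⟦ a ⟧₃ ≡ ⟦ b ⟧₃)
    𝟎 ≟₃ 𝟎 = just refl
    𝟏 ≟₃ 𝟏 = just refl
    𝟐 ≟₃ 𝟐 = just refl
    _ ≟₃ _ = nothing

  open Algebra.Solver.Ring rawRing R morphism _≟₃_ public
    using (solve; _:=_; _:+_; _:*_; :-_; _:-_; con; Polynomial)

-- Counting in finite sets

private
  module ℕ+ = Algebra.Properties.CommutativeSemigroup ℕₚ.+-commutativeSemigroup

  variable
    X Y : Set

unique-↭ : {xs ys : List X} → Unique xs → Unique ys →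
           (∀ {a} → a ∈ xs → a ∈ ys) → (∀ {a} → a ∈ ys → a ∈ xs) → xs ↭ ys
unique-↭ u v f g = ∼bag⇒↭ (unique∧set⇒bag u v (mk⇔ f g))

HasCount-unique : {P : X → Set} {m n : ℕ} → HasCount P m → HasCount P n → m ≡ n
HasCount-unique (xs , u , c , refl) (ys , v , d , refl) =
  ↭-length (unique-↭ u v (λ {a} → proj₂ (d a) ∘ proj₁ (c a)) (λ {a} → proj₂ (c a) ∘ proj₁ (d a)))

HasCount-map : {P : X → Set} {Q : Y → Set} (φ : X → Y) → (∀ {a b} → φ a ≡ φ b → a ≡ b) →
               (∀ {a} → P a → Q (φ a)) → (∀ {b} → Q b → ∃ λ a → P a × b ≡ φ a) →
               ∀ {n} → HasCount P n → HasCount Q n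
HasCount-map {Q = Q} φ inj P⇒Q Q⇒P (xs , u , c , l) =
  map φ xs , Uniqueₚ.map⁺ inj u , (λ b → to , from) , trans (length-map φ xs) l
  where
  to : ∀ {b} → b ∈ map φ xs → Q b
  to m with ∈-map⁻ φ m
  ... | a , a∈ , refl = P⇒Q (proj₁ (c a) a∈)
  from : ∀ {b} → Q b → b ∈ map φ xs
  from q with Q⇒P q
  ... | a , p , refl = ∈-map⁺ φ (proj₂ (c a) p)

HasCount-cong : {P Q : X → Set} → (∀ {a} → P a → Q a) → (∀ {a} → Q a → P a) →
                ∀ {n} → HasCount P n → HasCount Q n
HasCount-cong f g = HasCount-map (λ a → a) (λ e → e) f (λ q → _ , g q , refl)

HasCount-none : {P : X → Set} → (∀ a → ¬ P a) → HasCount P 0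
HasCount-none ¬P = [] , [] , (λ a → (λ ()) , λ p → ⊥-elim (¬P a p)) , refl

-- A `Field` carries no decision procedure for equality; in a list without repetitions it suffices
-- to compare positions.
≟-fromUnique : (xs : List X) → Unique xs → ∀ {a b} → a ∈ xs → b ∈ xs → Dec (a ≡ b)
≟-fromUnique (x ∷ xs) (x∉ ∷ u) (here refl) (here refl) = yes refl
≟-fromUnique (x ∷ xs) (x∉ ∷ u) (here refl) (there q)   = no (All.lookup x∉ q)
≟-fromUnique (x ∷ xs) (x∉ ∷ u) (there p)   (here refl) = no (All.lookup x∉ p ∘ sym)
≟-fromUnique (x ∷ xs) (x∉ ∷ u) (there p)   (there q)   = ≟-fromUnique xs u p q

sum-map-+ : (f g : X → ℕ) (xs : List X) →
            sum (map (λ a → f a ℕ.+ g a) xs) ≡ sum (map f xs) ℕ.+ sum (map g xs)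
sum-map-+ f g []       = refl
sum-map-+ f g (x ∷ xs) = trans (cong (f x ℕ.+ g x ℕ.+_) (sum-map-+ f g xs)) (ℕ+.interchange (f x) (g x) _ _)

sum-map-const : (c : ℕ) (xs : List X) → sum (map (λ _ → c) xs) ≡ length xs ℕ.* c
sum-map-const c []       = refl
sum-map-const c (x ∷ xs) = cong (c ℕ.+_) (sum-map-const c xs)

sum-map-mono : {f g : X → ℕ} → (∀ a → f a ℕ.≤ g a) → ∀ xs → sum (map f xs) ℕ.≤ sum (map g xs)
sum-map-mono f≤g []       = ℕ.z≤n
sum-map-mono f≤g (x ∷ xs) = ℕₚ.+-mono-≤ (f≤g x) (sum-map-mono f≤g xs)

-- A tight inequality between sums is tight in every term. This extracts information about one
-- element from a total count, as in `nonsquare*nonsquare`.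
sum-map-rigid : {f g : X → ℕ} → (∀ a → f a ℕ.≤ g a) → ∀ {xs} → sum (map f xs) ≡ sum (map g xs) →
                ∀ {a} → a ∈ xs → f a ≡ g a
sum-map-rigid {f = f} {g} f≤g {x ∷ xs} e = λ
  { (here refl) → fx≡gx
  ; (there a∈)  → sum-map-rigid f≤g (ℕₚ.+-cancelˡ-≡ (g x) _ _ (trans (cong (ℕ._+ _) (sym fx≡gx)) e)) a∈ }
  where
  fx≡gx : f x ≡ g x
  fx≡gx = ℕₚ.≤-antisym (f≤g x) (ℕₚ.+-cancelʳ-≤ (sum (map g xs)) _ _ (begin
    g x ℕ.+ sum (map g xs) ≡⟨ sym e ⟩
    f x ℕ.+ sum (map f xs) ≤⟨ ℕₚ.+-monoʳ-≤ (f x) (sum-map-mono f≤g xs) ⟩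
    f x ℕ.+ sum (map g xs) ∎))
    where open ℕₚ.≤-Reasoning

Finite : Set → ℕ → Set
Finite X n = HasCount {X} (λ _ → ⊤) n

finite-≟ : ∀ {n} → Finite X n → DecidableEquality X
finite-≟ (xs , u , c , _) a b = ≟-fromUnique xs u (proj₂ (c a) tt) (proj₂ (c b) tt)

module Enumeration {X : Set} {n : ℕ} (fin : Finite X n) where

  elements : List X
  elements = proj₁ fin

  elements-unique : Unique elements
  elements-unique = proj₁ (proj₂ fin)

  ∈-elements : ∀ a → a ∈ elements
  ∈-elements a = proj₂ (proj₁ (proj₂ (proj₂ fin)) a) tt

  length-elements : length elements ≡ n
  length-elements = proj₂ (proj₂ (proj₂ fin))

  infix 4 _≟_
  _≟_ : DecidableEquality X
  _≟_ = finite-≟ fin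

  search : {P : X → Set} → Decidable P → Dec (∃ P)
  search {P} P? with go elements
    where
    go : ∀ xs → Dec (∃ λ a → a ∈ xs × P a)
    go [] = no λ { (_ , () , _) }
    go (x ∷ xs) with P? x | go xs
    ... | yes p | _                 = yes (x , here refl , p)
    ... | no ¬p | yes (a , a∈ , pa) = yes (a , there a∈ , pa)
    ... | no ¬p | no ¬q = no λ { (_ , here refl , p) → ¬p p ; (a , there a∈ , pa) → ¬q (a , a∈ , pa) }
  ... | yes (a , _ , p) = yes (a , p)
  ... | no ¬p           = no λ (a , p) → ¬p (a , ∈-elements a , p)

  HasCount-filter : {P : X → Set} (P? : Decidable P) → HasCount P (length (filter P? elements))
  HasCount-filter P? = filter P? elements , Uniqueₚ.filter⁺ P? elements-unique ,
    (λ a → (λ a∈ → proj₂ (∈-filter⁻ P? {xs = elements} a∈)) , ∈-filter⁺ P? (∈-elements a)) , refl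

  permute : (π : X → X) → (∀ {a b} → π a ≡ π b → a ≡ b) → (∀ b → ∃ λ a → b ≡ π a) →
            map π elements ↭ elements
  permute π inj surj = unique-↭ (Uniqueₚ.map⁺ inj elements-unique) elements-unique
    (λ {a} _ → ∈-elements a)
    (λ {b} _ → let (a , e) = surj b in subst (_∈ map π elements) (sym e) (∈-map⁺ π (∈-elements a)))

  ∑ : (X → ℕ) → ℕ
  ∑ f = sum (map f elements)

  ∑-cong : {f g : X → ℕ} → (∀ a → f a ≡ g a) → ∑ f ≡ ∑ g
  ∑-cong f≗g = cong sum (map-cong f≗g elements)

  ∑-reindex : (π : X → X) → (∀ {a b} → π a ≡ π b → a ≡ b) → (∀ b → ∃ λ a → b ≡ π a) →
              (f : X → ℕ) → ∑ (f ∘ π) ≡ ∑ f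
  ∑-reindex π inj surj f =
    trans (cong sum (map-∘ elements)) (sum-↭ (↭-map⁺ f (permute π inj surj)))

  -- The equality of the two sums with the term at c removed, written additively to stay in ℕ. It
  -- serves wherever a bijection or a fibre count is exceptional at one point.
  ∑-differAt : (c : X) {f g : X → ℕ} → (∀ a → a ≢ c → f a ≡ g a) → ∑ f ℕ.+ g c ≡ ∑ g ℕ.+ f c
  ∑-differAt c {f} {g} f≡g = go elements elements-unique (∈-elements c)
    where
    off : ∀ xs → (∀ {a} → a ∈ xs → a ≢ c) → sum (map f xs) ≡ sum (map g xs)
    off [] _ = refl
    off (x ∷ xs) ne = cong₂ ℕ._+_ (f≡g x (ne (here refl))) (off xs (ne ∘ there))
    go : ∀ xs → Unique xs → c ∈ xs → sum (map f xs) ℕ.+ g c ≡ sum (map g xs) ℕ.+ f c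
    go (x ∷ xs) (x∉ ∷ u) (here refl) rewrite off xs (λ a∈ → All.lookup x∉ a∈ ∘ sym) = begin
      f x ℕ.+ s ℕ.+ g x   ≡⟨ ℕₚ.+-comm (f x ℕ.+ s) (g x) ⟩
      g x ℕ.+ (f x ℕ.+ s) ≡⟨ cong (g x ℕ.+_) (ℕₚ.+-comm (f x) s) ⟩
      g x ℕ.+ (s ℕ.+ f x) ≡⟨ sym (ℕₚ.+-assoc (g x) s (f x)) ⟩
      g x ℕ.+ s ℕ.+ f x   ∎
      where
      open ≡-Reasoning
      s : ℕ
      s = sum (map g xs)
    go (x ∷ xs) (x∉ ∷ u) (there c∈) = begin
      f x ℕ.+ sum (map f xs) ℕ.+ g c   ≡⟨ ℕₚ.+-assoc (f x) _ _ ⟩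
      f x ℕ.+ (sum (map f xs) ℕ.+ g c) ≡⟨ cong₂ ℕ._+_ (f≡g x (All.lookup x∉ c∈)) (go xs u c∈) ⟩
      g x ℕ.+ (sum (map g xs) ℕ.+ f c) ≡⟨ sym (ℕₚ.+-assoc (g x) _ _) ⟩
      g x ℕ.+ sum (map g xs) ℕ.+ f c   ∎
      where open ≡-Reasoning

  -- One half of a double count: fibring the same set of pairs in two ways and applying
  -- `HasCount-unique` equates two sums.
  HasCount-fibres : {R : Y → X → Set} {φ : X → ℕ} → (∀ a → HasCount (λ b → R b a) (φ a)) →
                    HasCount (λ (b , a) → R b a) (∑ φ)
  HasCount-fibres {Y = Y} {R} {φ} h with go elements elements-unique
    where
    go : ∀ xs → Unique xs → HasCount (λ (b , a) → a ∈ xs × R b a) (sum (map φ xs))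
    go [] _ = HasCount-none λ _ ()
    go (x ∷ xs) (x∉ ∷ u) with h x | go xs u
    ... | ys , uy , cy , ly | zs , uz , cz , lz =
      map (_, x) ys ++ zs ,
      Uniqueₚ.++⁺ (Uniqueₚ.map⁺ (cong proj₁) uy) uz disj ,
      (λ p → to , from) ,
      trans (length-++ (map (_, x) ys)) (cong₂ ℕ._+_ (trans (length-map _ ys) ly) lz)
      where
      disj : ∀ {p} → p ∈ map (_, x) ys × p ∈ zs → ⊥
      disj (p∈ , q∈) with ∈-map⁻ _ p∈
      ... | _ , _ , refl = All.lookup x∉ (proj₁ (proj₁ (cz _) q∈)) refl
      to : ∀ {p} → p ∈ map (_, x) ys ++ zs → proj₂ p ∈ x ∷ xs × R (proj₁ p) (proj₂ p)
      to p∈ with ∈-++⁻ (map (_, x) ys) p∈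
      ... | inj₂ q = there (proj₁ (proj₁ (cz _) q)) , proj₂ (proj₁ (cz _) q)
      ... | inj₁ q with ∈-map⁻ _ q
      ... | b , b∈ , refl = here refl , proj₁ (cy b) b∈
      from : ∀ {p} → proj₂ p ∈ x ∷ xs × R (proj₁ p) (proj₂ p) → p ∈ map (_, x) ys ++ zs
      from (here refl , r) = ∈-++⁺ˡ (∈-map⁺ _ (proj₂ (cy _) r))
      from (there m , r)   = ∈-++⁺ʳ (map (_, x) ys) (proj₂ (cz _) (m , r))
  ... | c = HasCount-cong proj₂ (λ {p} r → ∈-elements (proj₂ p) , r) c

-- Fields, monic polynomials and their roots

module FieldProps (F : Field) where
  open Field F
  open FieldRing F public
  open Algebra.Properties.Ring (CommutativeRing.ring commutativeRing) public
    using (-‿distribˡ-*; -‿involutive; -0#≈0#)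

  inverseˡ : ∀ {x} → x ≢ 0# → x ⁻¹ * x ≡ 1#
  inverseˡ x≢0 = trans (*-comm _ _) (⁻¹-inverse _ x≢0)

  *-cancelˡ : ∀ {x y z} → x ≢ 0# → x * y ≡ x * z → y ≡ z
  *-cancelˡ {x} {y} {z} x≢0 e = begin
    y              ≡⟨ sym (undo y) ⟩
    x ⁻¹ * (x * y) ≡⟨ cong (x ⁻¹ *_) e ⟩
    x ⁻¹ * (x * z) ≡⟨ undo z ⟩
    z              ∎
    where
    open ≡-Reasoning
    undo : ∀ u → x ⁻¹ * (x * u) ≡ u
    undo u = trans (sym (*-assoc _ _ _)) (trans (cong (_* u) (inverseˡ x≢0)) (*-identityˡ u))

  *≡0⇒≡0 : ∀ {x y} → x ≢ 0# → x * y ≡ 0# → y ≡ 0#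
  *≡0⇒≡0 x≢0 e = *-cancelˡ x≢0 (trans e (sym (zeroʳ _)))

  *-nonzero : ∀ {x y} → x ≢ 0# → y ≢ 0# → x * y ≢ 0#
  *-nonzero x≢0 y≢0 = y≢0 ∘ *≡0⇒≡0 x≢0

  ⁻¹-nonzero : ∀ {x} → x ≢ 0# → x ⁻¹ ≢ 0#
  ⁻¹-nonzero {x} x≢0 e = 0≢1 (trans (sym (zeroʳ x)) (trans (cong (x *_) (sym e)) (⁻¹-inverse x x≢0)))

  ⁻¹-unique : ∀ {x y} → x ≢ 0# → x * y ≡ 1# → y ≡ x ⁻¹
  ⁻¹-unique x≢0 e = *-cancelˡ x≢0 (trans e (sym (⁻¹-inverse _ x≢0)))

  -‿nonzero : ∀ {x} → x ≢ 0# → - x ≢ 0#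
  -‿nonzero {x} x≢0 e = x≢0 (trans (sym (-‿involutive x)) (trans (cong -_ e) -0#≈0#))

  x-y≡0⇒x≡y : ∀ {x y} → x - y ≡ 0# → x ≡ y
  x-y≡0⇒x≡y {x} {y} e = begin
    x             ≡⟨ sym (+-identityʳ x) ⟩
    x + 0#        ≡⟨ cong (x +_) (sym (-‿inverseˡ y)) ⟩
    x + (- y + y) ≡⟨ sym (+-assoc _ _ _) ⟩
    x - y + y     ≡⟨ cong (_+ y) e ⟩
    0# + y        ≡⟨ +-identityˡ y ⟩
    y             ∎
    where open ≡-Reasoning

  x≡y⇒x-y≡0 : ∀ {x y} → x ≡ y → x - y ≡ 0#
  x≡y⇒x-y≡0 refl = -‿inverseʳ _

  pow-nonzero : ∀ {x} → x ≢ 0# → ∀ n → pow x n ≢ 0#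
  pow-nonzero x≢0 zero    = 0≢1 ∘ sym
  pow-nonzero x≢0 (suc n) = *-nonzero x≢0 (pow-nonzero x≢0 n)

  pow-+ : ∀ x m n → pow x (m ℕ.+ n) ≡ pow x m * pow x n
  pow-+ x zero    n = sym (*-identityˡ _)
  pow-+ x (suc m) n = trans (cong (x *_) (pow-+ x m n)) (sym (*-assoc _ _ _))

  interchange : ∀ a b c d → (a * b) * (c * d) ≡ (a * c) * (b * d)
  interchange = Algebra.Properties.CommutativeSemigroup.interchange *-commutativeSemigroup
    where
    open CommutativeRing commutativeRing using (*-commutativeSemigroup)

  pow-distrib-* : ∀ x y n → pow (x * y) n ≡ pow x n * pow y n
  pow-distrib-* x y zero    = sym (*-identityˡ _)
  pow-distrib-* x y (suc n) = trans (cong (x * y *_) (pow-distrib-* x y n)) (interchange x y _ _)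

  pow-* : ∀ x m n → pow x (m ℕ.* n) ≡ pow (pow x n) m
  pow-* x zero    n = refl
  pow-* x (suc m) n = trans (pow-+ x n (m ℕ.* n)) (cong (pow x n *_) (pow-* x m n))

  -- The vector a₀ , … , aₙ₋₁ stands for the monic polynomial a₀ + a₁ x + … + aₙ₋₁ xⁿ⁻¹ + xⁿ.
  evalMonic : ∀ {n} → Vec Carrier n → Carrier → Carrier
  evalMonic []       x = 1#
  evalMonic (a ∷ as) x = a + x * evalMonic as x

  addScaled : ∀ {n} → Carrier → Vec Carrier (suc n) → Vec Carrier n → Vec Carrier (suc n)
  addScaled r (a ∷ [])     []       = a + r ∷ []
  addScaled r (a ∷ b ∷ as) (c ∷ cs) = a + r * c ∷ addScaled r (b ∷ as) cs

  -- Synthetic division by x - r. If p = a + x b, then p(x) - p(r) = (x - r) b(x) + r (b(x) - b(r)),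
  -- so the quotient of p is b plus r times the quotient of b.
  quotient : ∀ {n} → Carrier → Vec Carrier (suc n) → Vec Carrier n
  quotient r (a ∷ [])     = []
  quotient r (a ∷ b ∷ as) = addScaled r (b ∷ as) (quotient r (b ∷ as))

module Char₃ (F : Field) (3≡0 : CharThree F) where
  open Field F
  open FieldProps F public
  open RingSolver₃ F 3≡0 public

  evalMonic-addScaled : ∀ {n} r (as : Vec Carrier (suc n)) (cs : Vec Carrier n) x →
    evalMonic (addScaled r as cs) x ≡ evalMonic as x + r * evalMonic cs x
  evalMonic-addScaled r (a ∷ []) [] x =
    solve 3 (λ a r x → a :+ r :+ x :* con 𝟏 := a :+ x :* con 𝟏 :+ r :* con 𝟏) refl a r x
  evalMonic-addScaled r (a ∷ b ∷ as) (c ∷ cs) x =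
    trans (cong (λ u → a + r * c + x * u) (evalMonic-addScaled r (b ∷ as) cs x))
      (solve 6 (λ a r c x u v → a :+ r :* c :+ x :* (u :+ r :* v) := a :+ x :* u :+ r :* (c :+ x :* v))
        refl a r c x _ _)

  evalMonic-quotient : ∀ {n} r (as : Vec Carrier (suc n)) x →
    evalMonic as x - evalMonic as r ≡ (x - r) * evalMonic (quotient r as) x
  evalMonic-quotient r (a ∷ []) x =
    solve 3 (λ a r x → a :+ x :* con 𝟏 :- (a :+ r :* con 𝟏) := (x :- r) :* con 𝟏) refl a r x
  evalMonic-quotient r (a ∷ bs@(_ ∷ _)) x = begin
    a + x * evalMonic bs x - (a + r * evalMonic bs r)
      ≡⟨ solve 5 (λ a r x u v → a :+ x :* u :- (a :+ r :* v) := (x :- r) :* u :+ r :* (u :- v))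
           refl a r x (evalMonic bs x) (evalMonic bs r) ⟩
    (x - r) * evalMonic bs x + r * (evalMonic bs x - evalMonic bs r)
      ≡⟨ cong (λ u → (x - r) * evalMonic bs x + r * u) (evalMonic-quotient r bs x) ⟩
    (x - r) * evalMonic bs x + r * ((x - r) * evalMonic (quotient r bs) x)
      ≡⟨ solve 4 (λ d r u v → d :* u :+ r :* (d :* v) := d :* (u :+ r :* v)) refl (x - r) r _ _ ⟩
    (x - r) * (evalMonic bs x + r * evalMonic (quotient r bs) x)
      ≡⟨ cong ((x - r) *_) (sym (evalMonic-addScaled r bs (quotient r bs) x)) ⟩
    (x - r) * evalMonic (addScaled r bs (quotient r bs)) x ∎
    where open ≡-Reasoning

  rootBound : ∀ {n} (as : Vec Carrier n) {xs} → Unique xs → All (λ x → evalMonic as x ≡ 0#) xs →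
              length xs ℕ.≤ n
  rootBound as       {[]}    _         _         = ℕ.z≤n
  rootBound []       {r ∷ _} _         (1≡0 ∷ _) = ⊥-elim (0≢1 (sym 1≡0))
  rootBound (a ∷ as) {r ∷ _} (r∉ ∷ u) (r0 ∷ rs) =
    ℕ.s≤s (rootBound (quotient r (a ∷ as)) u (All.zipWith root (r∉ , rs)))
    where
    root : ∀ {x} → r ≢ x × evalMonic (a ∷ as) x ≡ 0# → evalMonic (quotient r (a ∷ as)) x ≡ 0#
    root {x} (r≢x , x0) = *≡0⇒≡0 (λ e → r≢x (sym (x-y≡0⇒x≡y e)))
      (trans (sym (evalMonic-quotient r (a ∷ as) x)) (x≡y⇒x-y≡0 (trans x0 (sym r0))))

  frobenius-+ : ∀ h x y → pow (x + y) (3 ℕ.^ h) ≡ pow x (3 ℕ.^ h) + pow y (3 ℕ.^ h)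
  frobenius-+ zero    x y = solve 2 (λ x y → (x :+ y) :* con 𝟏 := x :* con 𝟏 :+ y :* con 𝟏) refl x y
  frobenius-+ (suc h) x y = begin
    pow (x + y) (3 ℕ.^ suc h)   ≡⟨ pow-* (x + y) 3 (3 ℕ.^ h) ⟩
    pow (pow (x + y) (3 ℕ.^ h)) 3 ≡⟨ cong (λ u → pow u 3) (frobenius-+ h x y) ⟩
    pow (pow x (3 ℕ.^ h) + pow y (3 ℕ.^ h)) 3
      ≡⟨ solve 2 (λ x y → (x :+ y) :* ((x :+ y) :* ((x :+ y) :* con 𝟏)) :=
                          x :* (x :* (x :* con 𝟏)) :+ y :* (y :* (y :* con 𝟏))) refl _ _ ⟩
    pow (pow x (3 ℕ.^ h)) 3 + pow (pow y (3 ℕ.^ h)) 3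
      ≡⟨ sym (cong₂ _+_ (pow-* x 3 (3 ℕ.^ h)) (pow-* y 3 (3 ℕ.^ h))) ⟩
    pow x (3 ℕ.^ suc h) + pow y (3 ℕ.^ suc h) ∎
    where open ≡-Reasoning

  frobenius-neg : ∀ h x → pow (- x) (3 ℕ.^ h) ≡ - pow x (3 ℕ.^ h)
  frobenius-neg zero    x = solve 1 (λ x → :- x :* con 𝟏 := :- (x :* con 𝟏)) refl x
  frobenius-neg (suc h) x = begin
    pow (- x) (3 ℕ.^ suc h)     ≡⟨ pow-* (- x) 3 (3 ℕ.^ h) ⟩
    pow (pow (- x) (3 ℕ.^ h)) 3 ≡⟨ cong (λ u → pow u 3) (frobenius-neg h x) ⟩
    pow (- pow x (3 ℕ.^ h)) 3
      ≡⟨ solve 1 (λ x → :- x :* (:- x :* (:- x :* con 𝟏)) := :- (x :* (x :* (x :* con 𝟏)))) refl _ ⟩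
    - pow (pow x (3 ℕ.^ h)) 3   ≡⟨ sym (cong -_ (pow-* x 3 (3 ℕ.^ h))) ⟩
    - pow x (3 ℕ.^ suc h)       ∎
    where open ≡-Reasoning

  x≡-x⇒x≡0 : ∀ {x} → x ≡ - x → x ≡ 0#
  x≡-x⇒x≡0 {x} e = begin
    x         ≡⟨ solve 1 (λ x → x := :- (x :+ x)) refl x ⟩
    - (x + x) ≡⟨ cong (λ u → - (x + u)) e ⟩
    - (x - x) ≡⟨ solve 1 (λ x → :- (x :- x) := con 𝟎) refl x ⟩
    0#        ∎
    where open ≡-Reasoning

-- Finite fields: characteristic, Fermat's theorem, cube roots

module FiniteField (F : Field) {q : ℕ} (fin : IsFinite F q) where
  open Field F
  open FieldProps F
  open Enumeration fin public

  fromℕ : ℕ → Carrier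
  fromℕ zero    = 0#
  fromℕ (suc n) = 1# + fromℕ n

  fromℕ-+ : ∀ m n → fromℕ (m ℕ.+ n) ≡ fromℕ m + fromℕ n
  fromℕ-+ zero    n = sym (+-identityˡ _)
  fromℕ-+ (suc m) n = trans (cong (1# +_) (fromℕ-+ m n)) (sym (+-assoc _ _ _))

  fromℕ-* : ∀ m n → fromℕ (m ℕ.* n) ≡ fromℕ m * fromℕ n
  fromℕ-* zero    n = sym (zeroˡ _)
  fromℕ-* (suc m) n = begin
    fromℕ (n ℕ.+ m ℕ.* n)             ≡⟨ fromℕ-+ n (m ℕ.* n) ⟩
    fromℕ n + fromℕ (m ℕ.* n)         ≡⟨ cong₂ _+_ (sym (*-identityˡ _)) (fromℕ-* m n) ⟩
    1# * fromℕ n + fromℕ m * fromℕ n  ≡⟨ sym (distribʳ _ _ _) ⟩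
    (1# + fromℕ m) * fromℕ n          ∎
    where open ≡-Reasoning

  fromℕ-^ : ∀ m h → fromℕ (m ℕ.^ h) ≡ pow (fromℕ m) h
  fromℕ-^ m zero    = +-identityʳ 1#
  fromℕ-^ m (suc h) = trans (fromℕ-* m (m ℕ.^ h)) (cong (fromℕ m *_) (fromℕ-^ m h))

  private
    module +-CM = CommutativeRing commutativeRing using (+-isCommutativeMonoid; *-isCommutativeMonoid)

    sumF prodF : List Carrier → Carrier
    sumF  = foldr _+_ 0#
    prodF = foldr _*_ 1#

    sumF-↭ : ∀ {xs ys} → xs ↭ ys → sumF xs ≡ sumF ys
    sumF-↭ p = Permutationₛ.foldr-commMonoid (setoid Carrier) +-CM.+-isCommutativeMonoid (↭⇒↭ₛ p)

    prodF-↭ : ∀ {xs ys} → xs ↭ ys → prodF xs ≡ prodF ys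
    prodF-↭ p = Permutationₛ.foldr-commMonoid (setoid Carrier) +-CM.*-isCommutativeMonoid (↭⇒↭ₛ p)

    sumF-1+ : ∀ xs → sumF (map (1# +_) xs) ≡ fromℕ (length xs) + sumF xs
    sumF-1+ []       = sym (+-identityˡ _)
    sumF-1+ (x ∷ xs) = trans (cong (1# + x +_) (sumF-1+ xs))
      (Algebra.Properties.CommutativeSemigroup.interchange +-commutativeSemigroup 1# x _ _)
      where
      open CommutativeRing commutativeRing using (+-commutativeSemigroup)

    prodF-scale : ∀ a xs → prodF (map (a *_) xs) ≡ pow a (length xs) * prodF xs
    prodF-scale a []       = sym (*-identityˡ _)
    prodF-scale a (x ∷ xs) = trans (cong (a * x *_) (prodF-scale a xs)) (interchange a x _ _)

    prodF-nonzero : ∀ {xs} → All (_≢ 0#) xs → prodF xs ≢ 0#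
    prodF-nonzero []       = 0≢1 ∘ sym
    prodF-nonzero (x ∷ xs) = *-nonzero x (prodF-nonzero xs)

  +-cancelˡ : ∀ a {b c} → a + b ≡ a + c → b ≡ c
  +-cancelˡ a {b} {c} e = trans (sym (undo b)) (trans (cong (- a +_) e) (undo c))
    where
    undo : ∀ u → - a + (a + u) ≡ u
    undo u = trans (sym (+-assoc _ _ _)) (trans (cong (_+ u) (-‿inverseˡ a)) (+-identityˡ u))

  +-surjective : ∀ a b → ∃ λ c → b ≡ a + c
  +-surjective a b = - a + b ,
    sym (trans (sym (+-assoc _ _ _)) (trans (cong (_+ b) (-‿inverseʳ a)) (+-identityˡ b)))

  *-surjective : ∀ {a} → a ≢ 0# → ∀ b → ∃ λ c → b ≡ a * c
  *-surjective {a} a≢0 b = a ⁻¹ * b ,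
    sym (trans (sym (*-assoc _ _ _)) (trans (cong (_* b) (⁻¹-inverse a a≢0)) (*-identityˡ b)))

  -- Adding 1 permutes the field, so the sum s of all elements satisfies q·1 + s = s.
  fromℕ-size : fromℕ q ≡ 0#
  fromℕ-size = begin
    fromℕ q                                      ≡⟨ cong fromℕ (sym length-elements) ⟩
    fromℕ (length elements)                      ≡⟨ sym (+-identityʳ _) ⟩
    fromℕ (length elements) + 0#                 ≡⟨ cong (fromℕ (length elements) +_) (sym (-‿inverseʳ s)) ⟩
    fromℕ (length elements) + (s - s)            ≡⟨ sym (+-assoc _ _ _) ⟩
    fromℕ (length elements) + s - s              ≡⟨ cong (_- s) (sym (sumF-1+ elements)) ⟩
    sumF (map (1# +_) elements) - s
      ≡⟨ cong (_- s) (sumF-↭ (permute (1# +_) (+-cancelˡ 1#) (+-surjective 1#))) ⟩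
    s - s                                        ≡⟨ -‿inverseʳ s ⟩
    0#                                           ∎
    where
    open ≡-Reasoning
    s : Carrier
    s = sumF elements

  charThree : ∀ h → q ≡ 3 ℕ.^ h → CharThree F
  charThree h q≡3^h with fromℕ 3 ≟ 0#
  ... | yes e = trans (cong (λ u → 1# + (1# + u)) (sym (+-identityʳ 1#))) e
  ... | no ne = ⊥-elim (pow-nonzero ne h (trans (sym (fromℕ-^ 3 h)) (trans (cong fromℕ (sym q≡3^h)) fromℕ-size)))

  size>1 : 1 ℕ.< q
  size>1 = subst (1 ℕ.<_) length-elements (go elements (∈-elements 0#) (∈-elements 1#))
    where
    go : ∀ xs → 0# ∈ xs → 1# ∈ xs → 1 ℕ.< length xs
    go (_ ∷ _ ∷ _) _           _           = ℕ.s≤s (ℕ.s≤s ℕ.z≤n)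
    go (_ ∷ [])    (here refl) (here 1≡0) = ⊥-elim (0≢1 (sym 1≡0))

  private
    ≢0? : (x : Carrier) → Dec (x ≢ 0#)
    ≢0? x = ¬? (x ≟ 0#)

    units : List Carrier
    units = filter ≢0? elements

    units-unique : Unique units
    units-unique = Uniqueₚ.filter⁺ ≢0? elements-unique

    ∈-units : ∀ {x} → x ≢ 0# → x ∈ units
    ∈-units x≢0 = ∈-filter⁺ ≢0? (∈-elements _) x≢0

    units-nonzero : ∀ {x} → x ∈ units → x ≢ 0#
    units-nonzero x∈ = proj₂ (∈-filter⁻ ≢0? {xs = elements} x∈)

    units-↭ : elements ↭ 0# ∷ units
    units-↭ = unique-↭ elements-unique (All.tabulate (λ x∈ e → units-nonzero x∈ (sym e)) ∷ units-unique)
      (λ {x} _ → from x) (λ {x} _ → ∈-elements x)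
      where
      from : ∀ x → x ∈ 0# ∷ units
      from x with x ≟ 0#
      ... | yes refl = here refl
      ... | no x≢0   = there (∈-units x≢0)

    scale-units : ∀ {a} → a ≢ 0# → map (a *_) units ↭ units
    scale-units {a} a≢0 = unique-↭ (Uniqueₚ.map⁺ (*-cancelˡ a≢0) units-unique) units-unique to from
      where
      to : ∀ {x} → x ∈ map (a *_) units → x ∈ units
      to x∈ with ∈-map⁻ (a *_) x∈
      ... | u , u∈ , refl = ∈-units (*-nonzero a≢0 (units-nonzero u∈))
      from : ∀ {x} → x ∈ units → x ∈ map (a *_) units
      from {x} x∈ with *-surjective a≢0 x
      ... | c , refl = ∈-map⁺ (a *_) (∈-units λ { refl → units-nonzero x∈ (zeroʳ a) })

  -- Multiplication by x ≠ 0 permutes the units and hence fixes their product, which can be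
  -- cancelled; 0 accounts for the one further factor x.
  fermat : ∀ x → pow x q ≡ x
  fermat x with x ≟ 0#
  ... | yes refl = trans (cong (pow 0#) (trans (sym length-elements) (↭-length units-↭))) (zeroˡ _)
  ... | no x≢0   = trans (cong (pow x) (trans (sym length-elements) (↭-length units-↭)))
    (trans (cong (x *_) unit) (*-identityʳ x))
    where
    unit : pow x (length units) ≡ 1#
    unit = *-cancelˡ (prodF-nonzero (All.tabulate units-nonzero)) (begin
      prodF units * pow x (length units) ≡⟨ *-comm _ _ ⟩
      pow x (length units) * prodF units ≡⟨ sym (prodF-scale x units) ⟩
      prodF (map (x *_) units)           ≡⟨ prodF-↭ (scale-units x≢0) ⟩
      prodF units                        ≡⟨ sym (*-identityʳ _) ⟩
      prodF units * 1#                   ∎)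
      where open ≡-Reasoning

  -- The root is x to the power q/3, whose cube is x^q = x. The case q = 1 is void since 0 ≠ 1.
  cubeRoot : ∀ h → q ≡ 3 ℕ.^ h → ∀ x → ∃ λ s → s * s * s ≡ x
  cubeRoot zero    q≡1 x = ⊥-elim (ℕₚ.<-irrefl (sym q≡1) size>1)
  cubeRoot (suc h) e   x = s , (begin
    s * s * s         ≡⟨ trans (*-assoc _ _ _) (cong (λ u → s * (s * u)) (sym (*-identityʳ s))) ⟩
    pow s 3           ≡⟨ sym (pow-* x 3 (3 ℕ.^ h)) ⟩
    pow x (3 ℕ.^ suc h) ≡⟨ cong (pow x) (sym e) ⟩
    pow x q           ≡⟨ fermat x ⟩
    x                 ∎)
    where
    open ≡-Reasoning
    s : Carrier
    s = pow x (3 ℕ.^ h)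

-- Squares and nonsquares

-- ρ a is the number of square roots of a, that is 1 + χ(a) for the quadratic character χ.
module SquareRoots (F : Field) {q : ℕ} (fin : IsFinite F q) (3≡0 : CharThree F) where
  open Field F
  open Char₃ F 3≡0
  open FiniteField F fin

  Square : Carrier → Set
  Square a = ∃ λ s → s * s ≡ a

  square? : ∀ a → Dec (Square a)
  square? a = search (λ s → s * s ≟ a)

  square-0 : Square 0#
  square-0 = 0# , zeroˡ 0#

  ρ : Carrier → ℕ
  ρ a with a ≟ 0# | square? a
  ... | yes _ | _     = 1
  ... | no _  | yes _ = 2
  ... | no _  | no _  = 0

  ρ-zero : ∀ {a} → a ≡ 0# → ρ a ≡ 1
  ρ-zero {a} e with a ≟ 0# | square? a
  ... | yes _ | _ = refl
  ... | no ne | _ = ⊥-elim (ne e)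

  ρ-square : ∀ {a} → a ≢ 0# → Square a → ρ a ≡ 2
  ρ-square {a} ne s with a ≟ 0# | square? a
  ... | yes e | _     = ⊥-elim (ne e)
  ... | no _  | yes _ = refl
  ... | no _  | no ¬s = ⊥-elim (¬s s)

  ρ-nonsquare : ∀ {a} → ¬ Square a → ρ a ≡ 0
  ρ-nonsquare {a} ¬s with a ≟ 0# | square? a
  ... | yes refl | _     = ⊥-elim (¬s square-0)
  ... | no _     | yes s = ⊥-elim (¬s s)
  ... | no _     | no _  = refl

  data ρ-View (a : Carrier) : Set where
    zero      : a ≡ 0# → ρ-View a
    square    : a ≢ 0# → Square a → ρ-View a
    nonsquare : a ≢ 0# → ¬ Square a → ρ-View a

  ρ-view : ∀ a → ρ-View a
  ρ-view a with a ≟ 0# | square? a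
  ... | yes e | _     = zero e
  ... | no ne | yes s = square ne s
  ... | no ne | no ¬s = nonsquare ne ¬s

  ρ≡0⇒nonsquare : ∀ {a} → ρ a ≡ 0 → ¬ Square a
  ρ≡0⇒nonsquare {a} e s with ρ-view a
  ... | zero r         = ℕₚ.0≢1+n (trans (sym e) (ρ-zero r))
  ... | square ne _    = ℕₚ.0≢1+n (trans (sym e) (ρ-square ne s))
  ... | nonsquare _ ¬s = ¬s s

  ρ≡1⇒zero : ∀ {a} → ρ a ≡ 1 → a ≡ 0#
  ρ≡1⇒zero {a} e with ρ-view a
  ... | zero r         = r
  ... | square ne s    = ⊥-elim (ℕₚ.0≢1+n (ℕₚ.suc-injective (trans (sym e) (ρ-square ne s))))
  ... | nonsquare _ ¬s = ⊥-elim (ℕₚ.0≢1+n (trans (sym (ρ-nonsquare ¬s)) e))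

  ρ≡2⇒square : ∀ {a} → ρ a ≡ 2 → a ≢ 0# × Square a
  ρ≡2⇒square {a} e with ρ-view a
  ... | zero r         = ⊥-elim (ℕₚ.0≢1+n (ℕₚ.suc-injective (trans (sym (ρ-zero r)) e)))
  ... | square ne s    = ne , s
  ... | nonsquare _ ¬s = ⊥-elim (ℕₚ.0≢1+n (trans (sym (ρ-nonsquare ¬s)) e))

  ρ≤2 : ∀ a → ρ a ℕ.≤ 2
  ρ≤2 a with ρ-view a
  ... | zero e         = subst (ℕ._≤ 2) (sym (ρ-zero e)) (ℕ.s≤s ℕ.z≤n)
  ... | square ne s    = ℕₚ.≤-reflexive (ρ-square ne s)
  ... | nonsquare _ ¬s = subst (ℕ._≤ 2) (sym (ρ-nonsquare ¬s)) ℕ.z≤n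

  ρ-cong : ∀ {a b} → (a ≡ 0# → b ≡ 0#) → (b ≡ 0# → a ≡ 0#) → (Square a → Square b) → (Square b → Square a) →
           ρ a ≡ ρ b
  ρ-cong {a} {b} f g s t with ρ-view a
  ... | zero e         = trans (ρ-zero e) (sym (ρ-zero (f e)))
  ... | square ne sq   = trans (ρ-square ne sq) (sym (ρ-square (ne ∘ g) (s sq)))
  ... | nonsquare _ ¬s = trans (ρ-nonsquare ¬s) (sym (ρ-nonsquare (¬s ∘ t)))

  square-scale : ∀ {w} a → Square a → Square (w * w * a)
  square-scale {w} a (s , refl) = w * s , interchange w s w s

  square-unscale : ∀ {w} → w ≢ 0# → ∀ {a} → Square (w * w * a) → Square a
  square-unscale {w} w≢0 {a} (s , e) = w ⁻¹ * s , *-cancelˡ (*-nonzero w≢0 w≢0) (begin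
    w * w * (w ⁻¹ * s * (w ⁻¹ * s)) ≡⟨ solve 3 (λ w v s → w :* w :* (v :* s :* (v :* s)) := (w :* v) :* (w :* v) :* (s :* s)) refl w (w ⁻¹) s ⟩
    (w * w ⁻¹) * (w * w ⁻¹) * (s * s) ≡⟨ cong (λ u → u * u * (s * s)) (⁻¹-inverse w w≢0) ⟩
    1# * 1# * (s * s)               ≡⟨ solve 1 (λ s → con 𝟏 :* con 𝟏 :* s := s) refl (s * s) ⟩
    s * s                           ≡⟨ e ⟩
    w * w * a                       ∎)
    where open ≡-Reasoning

  ρ-scale : ∀ {w} → w ≢ 0# → ∀ a → ρ (w * w * a) ≡ ρ a
  ρ-scale {w} w≢0 a = ρ-cong (*≡0⇒≡0 (*-nonzero w≢0 w≢0)) (λ { refl → zeroʳ _ })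
    (square-unscale w≢0) (square-scale a)

  ρ-counts : ∀ a → HasCount (λ s → s * s ≡ a) (ρ a)
  ρ-counts a with ρ-view a
  ... | zero refl = subst (HasCount _) (sym (ρ-zero refl))
    (0# ∷ [] , [] ∷ [] , (λ s → (λ { (here refl) → zeroˡ 0# }) , λ e → here (root e)) , refl)
    where
    root : ∀ {s} → s * s ≡ 0# → s ≡ 0#
    root {s} e with s ≟ 0#
    ... | yes s≡0 = s≡0
    ... | no s≢0  = *≡0⇒≡0 s≢0 e
  ... | nonsquare _ ¬s = subst (HasCount _) (sym (ρ-nonsquare ¬s)) (HasCount-none λ s e → ¬s (s , e))
  ... | square ne (w , refl) = subst (HasCount _) (sym (ρ-square ne (w , refl)))
    ( w ∷ - w ∷ [] , (w≢-w ∷ []) ∷ [] ∷ []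
    , (λ s → (λ { (here refl) → refl ; (there (here refl)) → solve 1 (λ w → :- w :* :- w := w :* w) refl w }) , roots s) , refl)
    where
    w≢-w : w ≢ - w
    w≢-w e = ne (trans (cong (_* w) (x≡-x⇒x≡0 e)) (zeroˡ w))
    roots : ∀ s → s * s ≡ w * w → s ∈ w ∷ - w ∷ []
    roots s e with s ≟ w
    ... | yes s≡w = here s≡w
    ... | no s≢w  = there (here (x-y≡0⇒x≡y (*≡0⇒≡0 (s≢w ∘ x-y≡0⇒x≡y)
      (trans (solve 2 (λ s w → (s :- w) :* (s :- :- w) := s :* s :- w :* w) refl s w) (x≡y⇒x-y≡0 e)))))

  -- The pairs (s, a) with s² = a are counted once by a and once by s.
  ∑ρ≡size : ∑ ρ ≡ q
  ∑ρ≡size = HasCount-unique (HasCount-fibres ρ-counts)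
    (HasCount-map (λ s → s , s * s) (cong proj₁) (λ _ → refl) (λ { {s , _} refl → s , tt , refl }) fin)

  -- For a fixed nonsquare a, ρ x + ρ (a x) ≤ 2, because a x is a nonsquare whenever x is a nonzero
  -- square. Each of the two terms sums to q over the field, so the bound is attained at every x. At
  -- x = b the first term is 0, so the second cannot be.
  nonsquare*nonsquare : ∀ {a b} → ¬ Square a → ¬ Square b → Square (a * b)
  nonsquare*nonsquare {a} {b} ¬sa ¬sb with ρ-view (a * b)
  ... | zero e        = subst Square (sym e) square-0
  ... | square _ s    = s
  ... | nonsquare _ ¬s = ⊥-elim (0≢2 (trans (sym (cong₂ ℕ._+_ (ρ-nonsquare ¬sb) (ρ-nonsquare ¬s))) (two b)))
    where
    0≢2 : 0 ≢ 2
    0≢2 ()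
    a≢0 : a ≢ 0#
    a≢0 refl = ¬sa square-0
    bound : ∀ x → ρ x ℕ.+ ρ (a * x) ℕ.≤ 2
    bound x with ρ-view x
    ... | zero refl = ℕₚ.≤-reflexive (cong₂ ℕ._+_ (ρ-zero refl) (ρ-zero (zeroʳ a)))
    ... | nonsquare _ ¬s = subst (λ n → n ℕ.+ ρ (a * x) ℕ.≤ 2) (sym (ρ-nonsquare ¬s)) (ρ≤2 (a * x))
    ... | square x≢0 (w , refl) = ℕₚ.≤-reflexive (cong₂ ℕ._+_ (ρ-square x≢0 (w , refl))
      (ρ-nonsquare λ s → ¬sa (square-unscale w≢0 (subst Square (*-comm a (w * w)) s))))
      where
      w≢0 : w ≢ 0#
      w≢0 refl = x≢0 (zeroˡ 0#)
    two : ∀ x → ρ x ℕ.+ ρ (a * x) ≡ 2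
    two x = sum-map-rigid bound (begin
      ∑ (λ x → ρ x ℕ.+ ρ (a * x))  ≡⟨ sum-map-+ ρ (λ x → ρ (a * x)) elements ⟩
      ∑ ρ ℕ.+ ∑ (λ x → ρ (a * x))  ≡⟨ cong (∑ ρ ℕ.+_) (∑-reindex (a *_) (*-cancelˡ a≢0) (*-surjective a≢0) ρ) ⟩
      ∑ ρ ℕ.+ ∑ ρ                  ≡⟨ cong₂ ℕ._+_ (trans ∑ρ≡size (sym length-elements)) (trans ∑ρ≡size (sym length-elements)) ⟩
      n ℕ.+ n                      ≡⟨ cong (n ℕ.+_) (sym (ℕₚ.+-identityʳ n)) ⟩
      2 ℕ.* n                      ≡⟨ ℕₚ.*-comm 2 n ⟩
      n ℕ.* 2                      ≡⟨ sym (sum-map-const 2 elements) ⟩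
      ∑ (λ _ → 2)                  ∎) (∈-elements x)
      where
      open ≡-Reasoning
      n : ℕ
      n = length elements

-- Binary quartics and the curve w² = f

module Quartic (F : Field) where
  open Field F
  open Geom F

  eval : Quart → Carrier → Carrier
  eval (z₀ , z₁ , z₂ , z₃ , z₄) v = z₀ + v * (z₁ + v * (z₂ + v * (z₃ + v * z₄)))

  -- Forms are evaluated on the projective line Maybe Carrier: just v is (1 : v) and nothing is (0 : 1).
  value : Quart → Maybe Carrier → Carrier
  value (_ , _ , _ , _ , z₄) nothing = z₄
  value z (just v)                   = eval z v

  -- In characteristic 3 the two expressions are ∂f/∂X and ∂f/∂Y at (s , t).
  NoDoubleRoot : Quart → Set
  NoDoubleRoot (z₀ , z₁ , z₂ , z₃ , z₄) = ∀ s t → NonzeroPair s t →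
    z₀ * (s * s * s) - z₂ * (s * t * t) + z₃ * (t * t * t) ≡ 0# →
    z₁ * (s * s * s) - z₂ * (s * s * t) + z₄ * (t * t * t) ≡ 0# → ⊥

module QuarticCount (F : Field) {q : ℕ} (fin : IsFinite F q) (3≡0 : CharThree F) where
  open Field F
  open Geom F
  open Quartic F
  open Char₃ F 3≡0
  open FiniteField F fin
  open SquareRoots F fin 3≡0

  -- The number of points of w² = f over PG(1,q). The degree of f is even, so the square class of a
  -- value does not depend on the representative of the point.
  points : Quart → ℕ
  points z@(_ , _ , _ , _ , z₄) = ρ z₄ ℕ.+ ∑ (λ v → ρ (eval z v))

  -- The affine points of x² = y³ + y² - δ; for δ = 1/r one less than the number of points of ℰ_r.
  curvePoints : Carrier → ℕ
  curvePoints δ = ∑ (λ y → ρ (pow y 3 + pow y 2 - δ))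

  affine-injective : ∀ a {b} → b ≢ 0# → ∀ {x y} → a + b * x ≡ a + b * y → x ≡ y
  affine-injective a b≢0 = *-cancelˡ b≢0 ∘ +-cancelˡ a

  affine-surjective : ∀ a {b} → b ≢ 0# → ∀ y → ∃ λ x → y ≡ a + b * x
  affine-surjective a {b} b≢0 y with +-surjective a y
  ... | c , refl with *-surjective b≢0 c
  ... | x , refl = x , refl

  ∑-affine : ∀ a {b} → b ≢ 0# → (f : Carrier → ℕ) → ∑ (λ x → f (a + b * x)) ≡ ∑ f
  ∑-affine a {b} b≢0 = ∑-reindex (λ x → a + b * x) (affine-injective a b≢0) (affine-surjective a b≢0)

  -- Since 4 = 1 and 2 = -1, the discriminant is B² - AC and s = B - Av completes the square.
  quadraticRoots : ∀ A B C → A ≢ 0# → HasCount (λ v → A * (v * v) + B * v + C ≡ 0#) (ρ (B * B - A * C))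
  quadraticRoots A B C A≢0 =
    HasCount-map (λ s → A ⁻¹ * (B - s)) inj to from (ρ-counts (B * B - A * C))
    where
    open ≡-Reasoning
    inj : ∀ {s s'} → A ⁻¹ * (B - s) ≡ A ⁻¹ * (B - s') → s ≡ s'
    inj {s} {s'} e = trans (flip s) (trans (cong (λ u → B - u) (*-cancelˡ (⁻¹-nonzero A≢0) e)) (sym (flip s')))
      where
      flip : ∀ s → s ≡ B - (B - s)
      flip s = solve 2 (λ B s → s := B :- (B :- s)) refl B s
    completed : ∀ v s → A * v ≡ B - s → A * (A * (v * v) + B * v + C) ≡ s * s - (B * B - A * C)
    completed v s e = begin
      A * (A * (v * v) + B * v + C)
        ≡⟨ solve 4 (λ A B C v → A :* (A :* (v :* v) :+ B :* v :+ C) := (A :* v) :* (A :* v) :+ B :* (A :* v) :+ A :* C) refl A B C v ⟩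
      (A * v) * (A * v) + B * (A * v) + A * C
        ≡⟨ cong (λ u → u * u + B * u + A * C) e ⟩
      (B - s) * (B - s) + B * (B - s) + A * C
        ≡⟨ solve 4 (λ A B C s → (B :- s) :* (B :- s) :+ B :* (B :- s) :+ A :* C := s :* s :- (B :* B :- A :* C)) refl A B C s ⟩
      s * s - (B * B - A * C) ∎
    A*A⁻¹ : ∀ x → A * (A ⁻¹ * x) ≡ x
    A*A⁻¹ x = trans (sym (*-assoc _ _ _)) (trans (cong (_* x) (⁻¹-inverse A A≢0)) (*-identityˡ x))
    to : ∀ {s} → s * s ≡ B * B - A * C →
         A * (A ⁻¹ * (B - s) * (A ⁻¹ * (B - s))) + B * (A ⁻¹ * (B - s)) + C ≡ 0#
    to {s} e = *≡0⇒≡0 A≢0 (trans (completed _ s (A*A⁻¹ _)) (x≡y⇒x-y≡0 e))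
    from : ∀ {v} → A * (v * v) + B * v + C ≡ 0# → ∃ λ s → s * s ≡ B * B - A * C × v ≡ A ⁻¹ * (B - s)
    from {v} e = B - A * v
      , x-y≡0⇒x≡y (trans (sym (completed v (B - A * v) flip)) (trans (cong (A *_) e) (zeroʳ A)))
      , *-cancelˡ A≢0 (trans flip (sym (A*A⁻¹ _)))
      where
      flip : A * v ≡ B - (B - A * v)
      flip = solve 2 (λ B u → u := B :- (B :- u)) refl B (A * v)

  -- For leading coefficient 0 one of the roots counted by ρ of the discriminant lies at v = ∞. This
  -- is the source of the `+ 1` in `conicCount`.
  linearRoots : ∀ B C → ¬ (B ≡ 0# × C ≡ 0#) →
    ∃ λ n → HasCount (λ v → 0# * (v * v) + B * v + C ≡ 0#) n × n ℕ.+ 1 ≡ ρ (B * B - 0# * C)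
  linearRoots B C nd with B ≟ 0#
  ... | yes refl = 0 , HasCount-none (λ v e → nd (refl , trans (sym (reduce v)) e))
    , sym (ρ-zero (solve 1 (λ C → con 𝟎 :* con 𝟎 :- con 𝟎 :* C := con 𝟎) refl C))
    where
    reduce : ∀ v → 0# * (v * v) + 0# * v + C ≡ C
    reduce v = solve 2 (λ v C → con 𝟎 :* (v :* v) :+ con 𝟎 :* v :+ C := C) refl v C
  ... | no B≢0 = 1
    , (root ∷ [] , [] ∷ []
      , (λ v → (λ { (here refl) → trans (reduce root) (trans (cong (_+ C) root-eq) (-‿inverseˡ C)) })
             , λ e → here (*-cancelˡ B≢0 (trans (x-y≡0⇒x≡y (trans (shift v) (trans (sym (reduce v)) e))) (sym root-eq))))
      , refl)
    , sym (ρ-square (λ e → *-nonzero B≢0 B≢0 (trans (sym disc) e)) (B , sym disc))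
    where
    root : Carrier
    root = B ⁻¹ * - C
    root-eq : B * root ≡ - C
    root-eq = trans (sym (*-assoc _ _ _)) (trans (cong (_* - C) (⁻¹-inverse B B≢0)) (*-identityˡ _))
    reduce : ∀ v → 0# * (v * v) + B * v + C ≡ B * v + C
    reduce v = solve 3 (λ v B C → con 𝟎 :* (v :* v) :+ B :* v :+ C := B :* v :+ C) refl v B C
    shift : ∀ v → B * v - - C ≡ B * v + C
    shift v = cong (B * v +_) (-‿involutive C)
    disc : B * B - 0# * C ≡ B * B
    disc = solve 2 (λ B C → B :* B :- con 𝟎 :* C := B :* B) refl B C

  -- The substitution w = w₀v² + mv + t turns w² = f(v) into the quadratic A(t)v² + B(t)v + C(t) = 0
  -- in v, which trades the quartic f for the cubic B² - AC.
  module Conic (w₀ m z₀ z₁ z₂ : Carrier) (w₀≢0 : w₀ ≢ 0#) where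

    A B C disc : Carrier → Carrier
    A t = m * m - w₀ * t - z₂
    B t = - (m * t) - z₁
    C t = t * t - z₀
    disc t = B t * B t - A t * C t

    -- The coefficients w₀² and -(w₀m) = 2w₀m are those of (w₀v² + mv + t)², so the substitution
    -- cancels the terms in v⁴ and v³.
    quartic : Quart
    quartic = z₀ , z₁ , z₂ , - (w₀ * m) , w₀ * w₀

    Degenerate : Carrier → Set
    Degenerate t = A t ≡ 0# × B t ≡ 0# × C t ≡ 0#

    private
      t₀ : Carrier
      t₀ = w₀ ⁻¹ * (m * m - z₂)

      w₀t₀ : w₀ * t₀ ≡ m * m - z₂
      w₀t₀ = trans (sym (*-assoc _ _ _)) (trans (cong (_* (m * m - z₂)) (⁻¹-inverse w₀ w₀≢0)) (*-identityˡ _))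

      A-as-multiple : ∀ t → A t ≡ w₀ * (t₀ - t)
      A-as-multiple t = begin
        m * m - w₀ * t - z₂   ≡⟨ solve 3 (λ a b c → a :- b :- c := (a :- c) :- b) refl (m * m) (w₀ * t) z₂ ⟩
        (m * m - z₂) - w₀ * t ≡⟨ cong (_- w₀ * t) (sym w₀t₀) ⟩
        w₀ * t₀ - w₀ * t      ≡⟨ solve 3 (λ w a b → w :* a :- w :* b := w :* (a :- b)) refl w₀ t₀ t ⟩
        w₀ * (t₀ - t)         ∎
        where open ≡-Reasoning

      A-root : A t₀ ≡ 0#
      A-root = trans (A-as-multiple t₀) (trans (cong (w₀ *_) (-‿inverseʳ t₀)) (zeroʳ w₀))

      A-nonzero : ∀ {t} → t ≢ t₀ → A t ≢ 0#
      A-nonzero {t} t≢t₀ e = t≢t₀ (sym (x-y≡0⇒x≡y (*≡0⇒≡0 w₀≢0 (trans (sym (A-as-multiple t)) e))))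

      substitution : ∀ w v → w * w - eval quartic v ≡
        A (w - w₀ * (v * v) - m * v) * (v * v) + B (w - w₀ * (v * v) - m * v) * v + C (w - w₀ * (v * v) - m * v)
      substitution w v = solve 7 (λ w₀ m z₀ z₁ z₂ w v →
        let t = w :- w₀ :* (v :* v) :- m :* v in
        w :* w :- (z₀ :+ v :* (z₁ :+ v :* (z₂ :+ v :* (:- (w₀ :* m) :+ v :* (w₀ :* w₀))))) :=
        (m :* m :- w₀ :* t :- z₂) :* (v :* v) :+ (:- (m :* t) :- z₁) :* v :+ (t :* t :- z₀))
        refl w₀ m z₀ z₁ z₂ w v

    -- The pairs (w, v) on the quartic curve correspond bijectively to the pairs (v, t) on the
    -- quadratic. Counted by t, these contribute ρ (disc t), except that at the only zero t₀ of A
    -- one root is at infinity. Nondegeneracy keeps the equation at t₀ from holding for all v.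
    conicCount : (∀ t → ¬ Degenerate t) → ∑ (λ v → ρ (eval quartic v)) ℕ.+ 1 ≡ ∑ (λ t → ρ (disc t))
    conicCount nd with linearRoots (B t₀) (C t₀) (λ (b , c) → nd t₀ (A-root , b , c))
    ... | n , count-t₀ , n+1≡ = ℕₚ.+-cancelʳ-≡ n _ _ (begin
      ∑ (λ v → ρ (eval quartic v)) ℕ.+ 1 ℕ.+ n ≡⟨ cong (λ u → u ℕ.+ 1 ℕ.+ n) sums ⟩
      ∑ φ ℕ.+ 1 ℕ.+ n                          ≡⟨ ℕₚ.+-assoc (∑ φ) 1 n ⟩
      ∑ φ ℕ.+ (1 ℕ.+ n)                        ≡⟨ cong (∑ φ ℕ.+_) (trans (ℕₚ.+-comm 1 n) n+1≡disc) ⟩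
      ∑ φ ℕ.+ ρ (disc t₀)                      ≡⟨ ∑-differAt t₀ φ-off ⟩
      ∑ (λ t → ρ (disc t)) ℕ.+ φ t₀            ≡⟨ cong (∑ (λ t → ρ (disc t)) ℕ.+_) φ-at ⟩
      ∑ (λ t → ρ (disc t)) ℕ.+ n               ∎)
      where
      open ≡-Reasoning
      Eqn : Carrier → Carrier → Set
      Eqn v t = A t * (v * v) + B t * v + C t ≡ 0#
      n+1≡disc : n ℕ.+ 1 ≡ ρ (disc t₀)
      n+1≡disc = trans n+1≡ (cong (λ a → ρ (B t₀ * B t₀ - a * C t₀)) (sym A-root))
      φ : Carrier → ℕ
      φ t with t ≟ t₀
      ... | yes _ = n
      ... | no _  = ρ (disc t)
      φ-at : φ t₀ ≡ n
      φ-at with t₀ ≟ t₀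
      ... | yes _ = refl
      ... | no ne = ⊥-elim (ne refl)
      φ-off : ∀ t → t ≢ t₀ → φ t ≡ ρ (disc t)
      φ-off t ne with t ≟ t₀
      ... | yes e = ⊥-elim (ne e)
      ... | no _  = refl
      fibre : ∀ t → HasCount (λ v → Eqn v t) (φ t)
      fibre t with t ≟ t₀
      ... | yes refl = subst (λ a → HasCount (λ v → a * (v * v) + B t₀ * v + C t₀ ≡ 0#) n) (sym A-root) count-t₀
      ... | no t≢t₀  = quadraticRoots (A t) (B t) (C t) (A-nonzero t≢t₀)
      swap : Carrier × Carrier → Carrier × Carrier
      swap (w , v) = v , w - w₀ * (v * v) - m * v
      swap-injective : ∀ {p p'} → swap p ≡ swap p' → p ≡ p'
      swap-injective {w , v} {w' , v'} e with cong proj₁ e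
      ... | refl = cong (_, v) (trans (undo w) (trans (cong (λ (_ , t) → t + (w₀ * (v * v) + m * v)) e) (sym (undo w'))))
        where
        undo : ∀ w → w ≡ w - w₀ * (v * v) - m * v + (w₀ * (v * v) + m * v)
        undo w = solve 3 (λ w a b → w := w :- a :- b :+ (a :+ b)) refl w (w₀ * (v * v)) (m * v)
      sums : ∑ (λ v → ρ (eval quartic v)) ≡ ∑ φ
      sums = HasCount-unique
        (HasCount-map swap swap-injective
          (λ {(w , v)} e → trans (sym (substitution w v)) (x≡y⇒x-y≡0 e))
          (λ {(v , t)} e → (t + (w₀ * (v * v) + m * v) , v)
            , x-y≡0⇒x≡y (trans (substitution _ v) (subst (Eqn v) (redo v t) e)) , cong (v ,_) (redo v t))
          (HasCount-fibres {R = λ w v → w * w ≡ eval quartic v} (λ v → ρ-counts (eval quartic v))))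
        (HasCount-fibres fibre)
        where
        redo : ∀ v t → t ≡ t + (w₀ * (v * v) + m * v) - w₀ * (v * v) - m * v
        redo v t = solve 3 (λ t a b → t := t :+ (a :+ b) :- a :- b) refl t (w₀ * (v * v)) (m * v)

  -- These reflected terms repeat the unfolding of `pow`, down to the last factor 1, so that solved
  -- equations match the goals definitionally.
  :pow² :pow³ : ∀ {n} → Polynomial n → Polynomial n
  :pow² x = x :* (x :* con 𝟏)
  :pow³ x = x :* (x :* (x :* con 𝟏))

  :Δ : ∀ {n} (z₀ z₁ z₃ z₄ : Polynomial n) → Polynomial n
  :Δ z₀ z₁ z₃ z₄ = :pow³ (z₀ :* z₄ :- z₁ :* z₃) :+ :pow² (z₀ :* z₄ :- z₁ :* z₃) :* :pow² (con 𝟏)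
    :- :pow³ (con 𝟏) :* (z₀ :* :pow² z₃ :+ z₄ :* :pow² z₁ :- z₀ :* con 𝟏 :* z₄)

  :eval : ∀ {n} (z₀ z₁ z₂ z₃ z₄ v : Polynomial n) → Polynomial n
  :eval z₀ z₁ z₂ z₃ z₄ v = z₀ :+ v :* (z₁ :+ v :* (z₂ :+ v :* (z₃ :+ v :* z₄)))

  -- Multiplying by the square z₃² makes f monic in z₃v, and the shift by -z₁z₃ removes the linear
  -- term. The root at (0 : 1) matches the point at infinity of the cubic.
  points-rootAt∞ : ∀ z₀ z₁ z₃ → z₃ ≢ 0# →
    points (z₀ , z₁ , 1# , z₃ , 0#) ≡ suc (curvePoints (Δ (z₀ , z₁ , 1# , z₃ , 0#)))
  points-rootAt∞ z₀ z₁ z₃ z₃≢0 = cong₂ ℕ._+_ (ρ-zero refl)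
    (trans (∑-cong (λ v → trans (sym (ρ-scale z₃≢0 _)) (cong ρ (weierstrass v))))
      (∑-affine (- (z₁ * z₃)) z₃≢0 _))
    where
    weierstrass : ∀ v → z₃ * z₃ * eval (z₀ , z₁ , 1# , z₃ , 0#) v ≡
      pow (- (z₁ * z₃) + z₃ * v) 3 + pow (- (z₁ * z₃) + z₃ * v) 2 - Δ (z₀ , z₁ , 1# , z₃ , 0#)
    weierstrass v = solve 4 (λ z₀ z₁ z₃ v → z₃ :* z₃ :* :eval z₀ z₁ (con 𝟏) z₃ (con 𝟎) v :=
      :pow³ (:- (z₁ :* z₃) :+ z₃ :* v) :+ :pow² (:- (z₁ :* z₃) :+ z₃ :* v) :- :Δ z₀ z₁ z₃ (con 𝟎))
      refl z₀ z₁ z₃ v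

  -- There are two points over (0 : 1); one is absorbed by the `+ 1` of `conicCount`, the other
  -- matches the point at infinity of the cubic.
  points-squareAt∞ : ∀ z₀ z₁ w₀ m → w₀ ≢ 0# → let z = z₀ , z₁ , 1# , - (w₀ * m) , w₀ * w₀ in
    NoDoubleRoot z → points z ≡ suc (curvePoints (Δ z))
  points-squareAt∞ z₀ z₁ w₀ m w₀≢0 nd = begin
    ρ (w₀ * w₀) ℕ.+ ∑ (λ v → ρ (eval quartic v))   ≡⟨ cong (ℕ._+ ∑ (λ v → ρ (eval quartic v))) (ρ-square (*-nonzero w₀≢0 w₀≢0) (w₀ , refl)) ⟩
    suc (suc (∑ (λ v → ρ (eval quartic v))))       ≡⟨ cong suc (ℕₚ.+-comm 1 _) ⟩
    suc (∑ (λ v → ρ (eval quartic v)) ℕ.+ 1)       ≡⟨ cong suc (conicCount nondegenerate) ⟩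
    suc (∑ (λ t → ρ (disc t)))
      ≡⟨ cong suc (∑-cong (λ t → trans (sym (ρ-scale w₀≢0 (disc t))) (cong ρ (weierstrass t)))) ⟩
    suc (∑ (λ t → ρ (pow (β + w₀ * t) 3 + pow (β + w₀ * t) 2 - Δ quartic)))
      ≡⟨ cong suc (∑-affine β w₀≢0 (λ y → ρ (pow y 3 + pow y 2 - Δ quartic))) ⟩
    suc (curvePoints (Δ quartic))                  ∎
    where
    open ≡-Reasoning
    open Conic w₀ m z₀ z₁ 1# w₀≢0
    -- As z₂ = 1, disc t begins w₀t³ + t². Hence w₀² disc t is monic in w₀t with quadratic
    -- coefficient 1 and linear coefficient -β, and the shift by β removes the linear term.
    β : Carrier
    β = w₀ * (m * z₁ + w₀ * z₀)
    weierstrass : ∀ t → w₀ * w₀ * disc t ≡ pow (β + w₀ * t) 3 + pow (β + w₀ * t) 2 - Δ quartic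
    weierstrass t = solve 5 (λ w₀ m z₀ z₁ t →
      let B = :- (m :* t) :- z₁
          y = w₀ :* (m :* z₁ :+ w₀ :* z₀) :+ w₀ :* t in
      w₀ :* w₀ :* (B :* B :- (m :* m :- w₀ :* t :- con 𝟏) :* (t :* t :- z₀)) :=
      :pow³ y :+ :pow² y :- :Δ z₀ z₁ (:- (w₀ :* m)) (w₀ :* w₀)) refl w₀ m z₀ z₁ t
    -- A degenerate t makes f the square of w₀v² + mv + t, which has the root (m - 1) / w₀.
    nondegenerate : ∀ t → ¬ Degenerate t
    nondegenerate t (A0 , B0 , C0) with x-y≡0⇒x≡y B0 | x-y≡0⇒x≡y C0
    ... | refl | refl = nd w₀ (m - 1#) (w₀≢0 ∘ proj₁)
      (trans (solve 3 (λ w m t → let τ = m :- con 𝟏 in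
          t :* t :* (w :* w :* w) :- con 𝟏 :* (w :* τ :* τ) :+ :- (w :* m) :* (τ :* τ :* τ) :=
          :- (w :* (w :* t :+ m :* m :- con 𝟏)) :* (m :* m :- w :* t :- con 𝟏)) refl w₀ m t)
        (trans (cong (- (w₀ * (w₀ * t + m * m - 1#)) *_) A0) (zeroʳ _)))
      (trans (solve 3 (λ w m t → let τ = m :- con 𝟏 in
          :- (m :* t) :* (w :* w :* w) :- con 𝟏 :* (w :* w :* τ) :+ w :* w :* (τ :* τ :* τ) :=
          m :* w :* w :* (m :* m :- w :* t :- con 𝟏)) refl w₀ m t)
        (trans (cong (m * w₀ * w₀ *_) A0) (zeroʳ _)))

  reverse : Quart → Quart
  reverse (z₀ , z₁ , z₂ , z₃ , z₄) = z₄ , z₃ , z₂ , z₁ , z₀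

  -- The coefficients of f(X, Y + kX): the contributions 3z₃k and 6z₄k² to the middle one vanish, so
  -- z₂ = 1 is preserved.
  translate : Carrier → Quart → Quart
  translate k z@(z₀ , z₁ , z₂ , z₃ , z₄) =
    eval z k , z₁ - z₂ * k + z₄ * (k * k * k) , z₂ , z₃ + z₄ * k , z₄

  -- Translation by k followed by reversal carries (1 : k) to (0 : 1); invariance of Δ under both
  -- means that the target curve does not depend on the point chosen.
  Δ-reverse : ∀ z₀ z₁ z₃ z₄ → Δ (z₄ , z₃ , 1# , z₁ , z₀) ≡ Δ (z₀ , z₁ , 1# , z₃ , z₄)
  Δ-reverse = solve 4 (λ z₀ z₁ z₃ z₄ → :Δ z₄ z₃ z₁ z₀ := :Δ z₀ z₁ z₃ z₄) refl

  Δ-translate : ∀ k z₀ z₁ z₃ z₄ → Δ (translate k (z₀ , z₁ , 1# , z₃ , z₄)) ≡ Δ (z₀ , z₁ , 1# , z₃ , z₄)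
  Δ-translate = solve 5 (λ k z₀ z₁ z₃ z₄ →
    :Δ (:eval z₀ z₁ (con 𝟏) z₃ z₄ k) (z₁ :- con 𝟏 :* k :+ z₄ :* (k :* k :* k)) (z₃ :+ z₄ :* k) z₄ :=
    :Δ z₀ z₁ z₃ z₄) refl

  ⁻¹-involutive : ∀ x → x ⁻¹ ⁻¹ ≡ x
  ⁻¹-involutive x with x ≟ 0#
  ... | yes refl = trans (cong _⁻¹ 0⁻¹≡0) 0⁻¹≡0
  ... | no x≢0   = sym (⁻¹-unique (⁻¹-nonzero x≢0) (inverseˡ x≢0))

  -- With 0⁻¹ = 0, inversion permutes the field, and the values at v and v⁻¹ differ by the square
  -- v⁴. The exception v = 0 is repaired by the terms for (0 : 1).
  points-reverse : ∀ z → points (reverse z) ≡ points z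
  points-reverse z@(z₀ , z₁ , z₂ , z₃ , z₄) = begin
    ρ z₀ ℕ.+ ∑ (λ v → ρ (eval (reverse z) v))              ≡⟨ ℕₚ.+-comm (ρ z₀) _ ⟩
    ∑ (λ v → ρ (eval (reverse z) v)) ℕ.+ ρ z₀
      ≡⟨ cong (λ a → ∑ (λ v → ρ (eval (reverse z) v)) ℕ.+ ρ a) (sym (trans (cong (eval z) 0⁻¹≡0) (eval-0 z))) ⟩
    ∑ (λ v → ρ (eval (reverse z) v)) ℕ.+ ρ (eval z (0# ⁻¹)) ≡⟨ ∑-differAt 0# off ⟩
    ∑ (λ v → ρ (eval z (v ⁻¹))) ℕ.+ ρ (eval (reverse z) 0#)
      ≡⟨ cong₂ (λ s a → s ℕ.+ ρ a) (∑-reindex _⁻¹ ⁻¹-injective (λ b → b ⁻¹ , sym (⁻¹-involutive b)) _) (eval-0 (reverse z)) ⟩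
    ∑ (λ v → ρ (eval z v)) ℕ.+ ρ z₄                        ≡⟨ ℕₚ.+-comm _ (ρ z₄) ⟩
    ρ z₄ ℕ.+ ∑ (λ v → ρ (eval z v))                        ∎
    where
    open ≡-Reasoning
    eval-0 : ∀ z → eval z 0# ≡ proj₁ z
    eval-0 (z₀ , _) = trans (cong (z₀ +_) (zeroˡ _)) (+-identityʳ z₀)
    ⁻¹-injective : ∀ {a b} → a ⁻¹ ≡ b ⁻¹ → a ≡ b
    ⁻¹-injective e = trans (sym (⁻¹-involutive _)) (trans (cong _⁻¹ e) (⁻¹-involutive _))
    homogeneity : ∀ v → v ≢ 0# → eval (reverse z) v ≡ v * v * (v * v) * eval z (v ⁻¹)
    homogeneity v v≢0 = sym (begin
      v * v * (v * v) * eval z (v ⁻¹)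
        -- Inverses are opaque to the solver, so v v⁻¹ is collected into one symbol p, which is then
        -- replaced by 1.
        ≡⟨ solve 7 (λ z₀ z₁ z₂ z₃ z₄ v u → v :* v :* (v :* v) :* :eval z₀ z₁ z₂ z₃ z₄ u :=
             let p = v :* u in :eval (z₄ :* p :* p :* p :* p) (z₃ :* p :* p :* p) (z₂ :* p :* p) (z₁ :* p) z₀ v)
             refl z₀ z₁ z₂ z₃ z₄ v (v ⁻¹) ⟩
      at (v * v ⁻¹)
        ≡⟨ cong at (⁻¹-inverse v v≢0) ⟩
      at 1#
        ≡⟨ solve 6 (λ z₀ z₁ z₂ z₃ z₄ v → let p = con 𝟏 in
             :eval (z₄ :* p :* p :* p :* p) (z₃ :* p :* p :* p) (z₂ :* p :* p) (z₁ :* p) z₀ v :=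
             :eval z₄ z₃ z₂ z₁ z₀ v) refl z₀ z₁ z₂ z₃ z₄ v ⟩
      eval (reverse z) v ∎)
      where
      at : Carrier → Carrier
      at p = eval (z₄ * p * p * p * p , z₃ * p * p * p , z₂ * p * p , z₁ * p , z₀) v
    off : ∀ v → v ≢ 0# → ρ (eval (reverse z) v) ≡ ρ (eval z (v ⁻¹))
    off v v≢0 = trans (cong ρ (homogeneity v v≢0)) (ρ-scale (*-nonzero v≢0 v≢0) _)

  points-translate : ∀ k z → points (translate k z) ≡ points z
  points-translate k z@(z₀ , z₁ , z₂ , z₃ , z₄) = cong (ρ z₄ ℕ.+_) (trans
    (∑-cong (λ v → cong ρ (solve 7 (λ z₀ z₁ z₂ z₃ z₄ k v →
      :eval (:eval z₀ z₁ z₂ z₃ z₄ k) (z₁ :- z₂ :* k :+ z₄ :* (k :* k :* k)) z₂ (z₃ :+ z₄ :* k) z₄ v :=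
      :eval z₀ z₁ z₂ z₃ z₄ (k :+ v)) refl z₀ z₁ z₂ z₃ z₄ k v)))
    (∑-reindex (k +_) (+-cancelˡ k) (+-surjective k) (λ v → ρ (eval z v))))

  noDoubleRoot-reverse : ∀ z → NoDoubleRoot z → NoDoubleRoot (reverse z)
  noDoubleRoot-reverse (z₀ , z₁ , z₂ , z₃ , z₄) nd s t st≢0 e₁ e₂ = nd t s (λ (a , b) → st≢0 (b , a))
    (trans (swap z₀ z₂ z₃ s t) e₂) (trans (swap' z₁ z₂ z₄ s t) e₁)
    where
    swap : ∀ a b c s t → a * (t * t * t) - b * (t * s * s) + c * (s * s * s) ≡
                         c * (s * s * s) - b * (s * s * t) + a * (t * t * t)
    swap = solve 5 (λ a b c s t → a :* (t :* t :* t) :- b :* (t :* s :* s) :+ c :* (s :* s :* s) :=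
                                  c :* (s :* s :* s) :- b :* (s :* s :* t) :+ a :* (t :* t :* t)) refl
    swap' : ∀ a b c s t → a * (t * t * t) - b * (t * t * s) + c * (s * s * s) ≡
                          c * (s * s * s) - b * (s * t * t) + a * (t * t * t)
    swap' = solve 5 (λ a b c s t → a :* (t :* t :* t) :- b :* (t :* t :* s) :+ c :* (s :* s :* s) :=
                                   c :* (s :* s :* s) :- b :* (s :* t :* t) :+ a :* (t :* t :* t)) refl

  -- The chain rule for g(X, Y) = f(X, Y + kX): at (s, t + ks), ∂f/∂X equals ∂g/∂X - k ∂g/∂Y and
  -- ∂f/∂Y equals ∂g/∂Y, the derivatives of g being taken at (s, t).
  noDoubleRoot-translate : ∀ k z → NoDoubleRoot z → NoDoubleRoot (translate k z)
  noDoubleRoot-translate k z@(z₀ , z₁ , z₂ , z₃ , z₄) nd s t st≢0 e₁ e₂ =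
    nd s (t + k * s) nonzero
      (trans (solve 8 (λ z₀ z₁ z₂ z₃ z₄ k s t → let τ = t :+ k :* s in
          z₀ :* (s :* s :* s) :- z₂ :* (s :* τ :* τ) :+ z₃ :* (τ :* τ :* τ) :=
          (:eval z₀ z₁ z₂ z₃ z₄ k :* (s :* s :* s) :- z₂ :* (s :* t :* t) :+ (z₃ :+ z₄ :* k) :* (t :* t :* t))
          :- k :* ((z₁ :- z₂ :* k :+ z₄ :* (k :* k :* k)) :* (s :* s :* s) :- z₂ :* (s :* s :* t) :+ z₄ :* (t :* t :* t)))
          refl z₀ z₁ z₂ z₃ z₄ k s t)
        (trans (cong₂ (λ a b → a - k * b) e₁ e₂) (solve 1 (λ k → con 𝟎 :- k :* con 𝟎 := con 𝟎) refl k)))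
      (trans (solve 6 (λ z₁ z₂ z₄ k s t → let τ = t :+ k :* s in
          z₁ :* (s :* s :* s) :- z₂ :* (s :* s :* τ) :+ z₄ :* (τ :* τ :* τ) :=
          (z₁ :- z₂ :* k :+ z₄ :* (k :* k :* k)) :* (s :* s :* s) :- z₂ :* (s :* s :* t) :+ z₄ :* (t :* t :* t))
          refl z₁ z₂ z₄ k s t) e₂)
    where
    nonzero : NonzeroPair s (t + k * s)
    nonzero (refl , e) = st≢0 (refl , trans (solve 2 (λ k t → t := t :+ k :* con 𝟎) refl k t) e)

  points-∞ : ∀ z₀ z₁ z₃ z₄ → Square z₄ → NoDoubleRoot (z₀ , z₁ , 1# , z₃ , z₄) →
    points (z₀ , z₁ , 1# , z₃ , z₄) ≡ suc (curvePoints (Δ (z₀ , z₁ , 1# , z₃ , z₄)))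
  points-∞ z₀ z₁ z₃ _ (w₀ , refl) nd with w₀ ≟ 0#
  ... | yes refl = subst (λ a → points (z₀ , z₁ , 1# , z₃ , a) ≡ suc (curvePoints (Δ (z₀ , z₁ , 1# , z₃ , a))))
    (sym (zeroˡ 0#)) (points-rootAt∞ z₀ z₁ z₃ z₃≢0)
    where
    z₃≢0 : z₃ ≢ 0#
    z₃≢0 refl = nd 0# 1# (λ (_ , e) → 0≢1 (sym e))
      (solve 1 (λ z → z :* (con 𝟎 :* con 𝟎 :* con 𝟎) :- con 𝟏 :* (con 𝟎 :* con 𝟏 :* con 𝟏) :+ con 𝟎 :* (con 𝟏 :* con 𝟏 :* con 𝟏) := con 𝟎) refl z₀)
      (solve 1 (λ z → z :* (con 𝟎 :* con 𝟎 :* con 𝟎) :- con 𝟏 :* (con 𝟎 :* con 𝟎 :* con 𝟏) :+ con 𝟎 :* con 𝟎 :* (con 𝟏 :* con 𝟏 :* con 𝟏) := con 𝟎) refl z₁)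
  ... | no w₀≢0 with *-surjective (-‿nonzero w₀≢0) z₃
  ... | m , e = subst (λ a → points (z₀ , z₁ , 1# , a , w₀ * w₀) ≡ suc (curvePoints (Δ (z₀ , z₁ , 1# , a , w₀ * w₀))))
    (sym e') (points-squareAt∞ z₀ z₁ w₀ m w₀≢0 (subst (λ a → NoDoubleRoot (z₀ , z₁ , 1# , a , w₀ * w₀)) e' nd))
    where
    e' : z₃ ≡ - (w₀ * m)
    e' = trans e (sym (-‿distribˡ-* w₀ m))

  module _ (z₀ z₁ z₃ z₄ : Carrier) where
    private
      z = z₀ , z₁ , 1# , z₃ , z₄

    -- If f took only nonsquare values, then w² = z₄f would have 2(q + 1) points,
    -- one more than the 2q + 1 that fit on a curve s² = cubic(t).
    notAllNonsquare : (z₄≢0 : z₄ ≢ 0#) → (∀ t → ¬ Conic.Degenerate z₄ (- z₃) (z₄ * z₀) (z₄ * z₁) z₄ z₄≢0 t) →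
      ¬ Square z₄ → (∀ v → ¬ Square (eval z v)) → ⊥
    notAllNonsquare z₄≢0 nd ¬s₄ ¬s = ℕₚ.<-irrefl refl (begin-strict
      length elements ℕ.* 2                          <⟨ ℕₚ.≤-reflexive (ℕₚ.+-comm 1 _) ⟩
      length elements ℕ.* 2 ℕ.+ 1                    ≡⟨ cong (ℕ._+ 1) (sym (sum-map-const 2 elements)) ⟩
      ∑ (λ _ → 2) ℕ.+ 1                              ≡⟨ cong (ℕ._+ 1) (∑-cong (λ v → sym (two v))) ⟩
      ∑ (λ v → ρ (eval quartic v)) ℕ.+ 1             ≡⟨ conicCount nd ⟩
      ∑ (λ t → ρ (disc t))                           ≤⟨ sum-map-mono (λ t → ρ≤2 (disc t)) elements ⟩
      ∑ (λ _ → 2)                                    ≡⟨ sum-map-const 2 elements ⟩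
      length elements ℕ.* 2                          ∎)
      where
      open ℕₚ.≤-Reasoning
      -- The quartic of this instance is z₄f, with leading coefficient z₄². Each of its values is a
      -- product of two nonsquares, hence a nonzero square.
      open Conic z₄ (- z₃) (z₄ * z₀) (z₄ * z₁) z₄ z₄≢0
      two : ∀ v → ρ (eval quartic v) ≡ 2
      two v = trans (cong ρ (solve 5 (λ z₀ z₁ z₃ z₄ v →
          :eval (z₄ :* z₀) (z₄ :* z₁) z₄ (:- (z₄ :* :- z₃)) (z₄ :* z₄) v := z₄ :* :eval z₀ z₁ (con 𝟏) z₃ z₄ v)
          refl z₀ z₁ z₃ z₄ v))
        (ρ-square (*-nonzero z₄≢0 (λ e → ¬s v (subst Square (sym e) square-0))) (nonsquare*nonsquare ¬s₄ (¬s v)))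

    -- The second condition does not follow from the first: for nonsquare z₄ a degenerate t produces
    -- double roots of f that are irrational over `F`.
    pointCount : NoDoubleRoot z →
      ((z₄≢0 : z₄ ≢ 0#) → ¬ Square z₄ → ∀ t → ¬ Conic.Degenerate z₄ (- z₃) (z₄ * z₀) (z₄ * z₁) z₄ z₄≢0 t) →
      points z ≡ suc (curvePoints (Δ z))
    pointCount nd nd' = go (square? z₄) (search (λ v → square? (eval z v)))
      where
      open ≡-Reasoning
      go : Dec (Square z₄) → Dec (∃ λ v → Square (eval z v)) → points z ≡ suc (curvePoints (Δ z))
      go (yes s) _       = points-∞ z₀ z₁ z₃ z₄ s nd
      go (no ¬s) (no ¬t) = ⊥-elim (notAllNonsquare z₄≢0 (nd' z₄≢0 ¬s) ¬s (λ v s → ¬t (v , s)))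
        where
        z₄≢0 : z₄ ≢ 0#
        z₄≢0 refl = ¬s square-0
      go (no _) (yes (k , s)) = begin
        points z                                     ≡⟨ sym (trans (points-reverse (translate k z)) (points-translate k z)) ⟩
        points (reverse (translate k z))             ≡⟨ points-∞ _ _ _ _ s (noDoubleRoot-reverse (translate k z) (noDoubleRoot-translate k z nd)) ⟩
        suc (curvePoints (Δ (reverse (translate k z)))) ≡⟨ cong (suc ∘ curvePoints) (trans (Δ-reverse (eval z k) _ _ z₄) (Δ-translate k z₀ z₁ z₃ z₄)) ⟩
        suc (curvePoints (Δ z))                      ∎

-- The chord or tangent through a point

module Chords (F : Field) (3≡0 : CharThree F) where
  open Field F
  open Geom F
  open Char₃ F 3≡0

  ≡-V4 : ∀ {a b c d a' b' c' d' : Carrier} → a ≡ a' → b ≡ b' → c ≡ c' → d ≡ d' →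
         (a , b , c , d) ≡ (a' , b' , c' , d')
  ≡-V4 refl refl refl refl = refl

  -- The chord or tangent through y has parameters the roots of hA s² + hB s t + hC t²,
  -- and disc y is the discriminant hB² - hA hC of that form.
  hA hB hC disc : V4 → Carrier
  hA (y₀ , y₁ , y₂ , y₃) = y₁ * y₃ - y₂ * y₂
  hB (y₀ , y₁ , y₂ , y₃) = y₁ * y₂ - y₀ * y₃
  hC (y₀ , y₁ , y₂ , y₃) = y₀ * y₂ - y₁ * y₁
  disc (y₀ , y₁ , y₂ , y₃) = y₀ * y₀ * (y₃ * y₃) + y₁ * y₁ * y₁ * y₃ + y₀ * (y₂ * y₂ * y₂)

  disc-• : ∀ k y → disc (k • y) ≡ (k * k) * (k * k) * disc y
  disc-• k (y₀ , y₁ , y₂ , y₃) = solve 5 (λ k y₀ y₁ y₂ y₃ →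
    (k :* y₀) :* (k :* y₀) :* ((k :* y₃) :* (k :* y₃)) :+ (k :* y₁) :* (k :* y₁) :* (k :* y₁) :* (k :* y₃)
      :+ (k :* y₀) :* ((k :* y₂) :* (k :* y₂) :* (k :* y₂)) :=
    (k :* k) :* (k :* k) :* (y₀ :* y₀ :* (y₃ :* y₃) :+ y₁ :* y₁ :* y₁ :* y₃ :+ y₀ :* (y₂ :* y₂ :* y₂)))
    refl k y₀ y₁ y₂ y₃

  disc-hABC : ∀ y → disc y ≡ hB y * hB y - hA y * hC y
  disc-hABC (y₀ , y₁ , y₂ , y₃) = solve 4 (λ y₀ y₁ y₂ y₃ →
    y₀ :* y₀ :* (y₃ :* y₃) :+ y₁ :* y₁ :* y₁ :* y₃ :+ y₀ :* (y₂ :* y₂ :* y₂) :=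
    (y₁ :* y₂ :- y₀ :* y₃) :* (y₁ :* y₂ :- y₀ :* y₃) :- (y₁ :* y₃ :- y₂ :* y₂) :* (y₀ :* y₂ :- y₁ :* y₁))
    refl y₀ y₁ y₂ y₃

  chord : (a s t b s' t' : Carrier) → V4
  chord a s t b s' t' = a • ν s t ⊕ b • ν s' t'

  module _ {a s t b s' t' : Carrier} where
    private
      d = s * t' - s' * t

      :chord : ∀ {n} (a s t b s' t' : Polynomial n) →
               (Polynomial n → Polynomial n → Polynomial n → Polynomial n → Polynomial n) → Polynomial n
      :chord a s t b s' t' k = k (a :* (s :* s :* s) :+ b :* (s' :* s' :* s')) (a :* (s :* s :* t) :+ b :* (s' :* s' :* t'))
                                 (a :* (s :* t :* t) :+ b :* (s' :* t' :* t')) (a :* (t :* t :* t) :+ b :* (t' :* t' :* t'))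

      -- Together with the next two identities: the form attached to a point of a chord is abd²(tX -
      -- sY)(t'X - s'Y), which vanishes exactly at the two ends when a, b and d are nonzero.
      hA-chord : hA (chord a s t b s' t') ≡ a * b * (d * d) * (t * t')
      hA-chord = solve 6 (λ a s t b s' t' → let d = s :* t' :- s' :* t in
        :chord a s t b s' t' (λ y₀ y₁ y₂ y₃ → y₁ :* y₃ :- y₂ :* y₂) := a :* b :* (d :* d) :* (t :* t'))
        refl a s t b s' t'

      hB-chord : hB (chord a s t b s' t') ≡ - (a * b * (d * d) * (s * t' + s' * t))
      hB-chord = solve 6 (λ a s t b s' t' → let d = s :* t' :- s' :* t in
        :chord a s t b s' t' (λ y₀ y₁ y₂ y₃ → y₁ :* y₂ :- y₀ :* y₃) := :- (a :* b :* (d :* d) :* (s :* t' :+ s' :* t)))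
        refl a s t b s' t'

      hC-chord : hC (chord a s t b s' t') ≡ a * b * (d * d) * (s * s')
      hC-chord = solve 6 (λ a s t b s' t' → let d = s :* t' :- s' :* t in
        :chord a s t b s' t' (λ y₀ y₁ y₂ y₃ → y₀ :* y₂ :- y₁ :* y₁) := a :* b :* (d :* d) :* (s :* s'))
        refl a s t b s' t'

    disc-chord : disc (chord a s t b s' t') ≡ (a * b * (d * d * d)) * (a * b * (d * d * d))
    disc-chord = begin
      disc (chord a s t b s' t')
        ≡⟨ disc-hABC (chord a s t b s' t') ⟩
      hB (chord a s t b s' t') * hB (chord a s t b s' t') - hA (chord a s t b s' t') * hC (chord a s t b s' t')
        ≡⟨ cong₂ _-_ (cong (λ x → x * x) hB-chord) (cong₂ _*_ hA-chord hC-chord) ⟩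
      - (g * (s * t' + s' * t)) * - (g * (s * t' + s' * t)) - g * (t * t') * (g * (s * s'))
        ≡⟨ solve 5 (λ g s t s' t' → :- (g :* (s :* t' :+ s' :* t)) :* :- (g :* (s :* t' :+ s' :* t)) :- g :* (t :* t') :* (g :* (s :* s')) :=
             (g :* (s :* t' :- s' :* t)) :* (g :* (s :* t' :- s' :* t))) refl g s t s' t' ⟩
      (g * d) * (g * d)
        ≡⟨ cong (λ x → x * x) (solve 2 (λ e d → e :* (d :* d) :* d := e :* (d :* d :* d)) refl (a * b) d) ⟩
      (a * b * (d * d * d)) * (a * b * (d * d * d)) ∎
      where
      open ≡-Reasoning
      g : Carrier
      g = a * b * (d * d)

    -- The osculating plane at one end of the chord isolates the coefficient of the other end.
    osculating-coefficientˡ : t' * t' * t' * proj₁ (chord a s t b s' t') - s' * s' * s' * proj₂ (proj₂ (proj₂ (chord a s t b s' t')))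
                              ≡ a * (d * d * d)
    osculating-coefficientˡ = solve 6 (λ a s t b s' t' → let d = s :* t' :- s' :* t in
      :chord a s t b s' t' (λ y₀ y₁ y₂ y₃ → t' :* t' :* t' :* y₀ :- s' :* s' :* s' :* y₃) := a :* (d :* d :* d))
      refl a s t b s' t'

    osculating-coefficientʳ : t * t * t * proj₁ (chord a s t b s' t') - s * s * s * proj₂ (proj₂ (proj₂ (chord a s t b s' t')))
                              ≡ - (b * (d * d * d))
    osculating-coefficientʳ = solve 6 (λ a s t b s' t' → let d = s :* t' :- s' :* t in
      :chord a s t b s' t' (λ y₀ y₁ y₂ y₃ → t :* t :* t :* y₀ :- s :* s :* s :* y₃) := :- (b :* (d :* d :* d)))
      refl a s t b s' t'

  disc-tangent : ∀ {y} → OnTangent y → disc y ≡ 0#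
  disc-tangent (s , t , _ , a , b , refl) = solve 4 (λ a s t b →
    let y₀ = a :* (s :* s :* s) :+ b :* con 𝟎
        y₁ = a :* (s :* s :* t) :+ b :* s
        y₂ = a :* (s :* t :* t) :+ b :* :- t
        y₃ = a :* (t :* t :* t) :+ b :* con 𝟎 in
    y₀ :* y₀ :* (y₃ :* y₃) :+ y₁ :* y₁ :* y₁ :* y₃ :+ y₀ :* (y₂ :* y₂ :* y₂) := con 𝟎) refl a s t b

  private
    divide : ∀ {k a b m n y} → k ≢ 0# → k * y - (a * m + b * n) ≡ 0# → y ≡ a * k ⁻¹ * m + b * k ⁻¹ * n
    divide {k} {a} {b} {m} {n} {y} k≢0 e = *-cancelˡ k≢0 (trans (x-y≡0⇒x≡y e) (sym (begin
      k * (a * k ⁻¹ * m + b * k ⁻¹ * n)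
        ≡⟨ solve 6 (λ k i a b m n → k :* (a :* i :* m :+ b :* i :* n) := k :* i :* (a :* m :+ b :* n)) refl k (k ⁻¹) a b m n ⟩
      k * k ⁻¹ * (a * m + b * n) ≡⟨ cong (_* (a * m + b * n)) (⁻¹-inverse k k≢0) ⟩
      1# * (a * m + b * n)       ≡⟨ *-identityˡ _ ⟩
      a * m + b * n              ∎)))
      where open ≡-Reasoning

    multipleOfZero : ∀ {x c e} → x ≡ c * e → e ≡ 0# → x ≡ 0#
    multipleOfZero p refl = trans p (zeroʳ _)

    -- The first two coordinates in `chord-through` agree only modulo ω² = disc y. The pair returned
    -- by f is the difference l and an explicit cofactor c with l = c (ω² - disc y).
    modDisc : ∀ {n} (f : (A B y₀ y₁ y₂ y₃ ω : Polynomial n) → Polynomial n × Polynomial n)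
              (y₀ y₁ y₂ y₃ ω : Polynomial n) → Polynomial n × Polynomial n
    modDisc f y₀ y₁ y₂ y₃ ω with f (y₁ :* y₃ :- y₂ :* y₂) (y₁ :* y₂ :- y₀ :* y₃) y₀ y₁ y₂ y₃ ω
    ... | l , c = l := c :* (ω :* ω :- (y₀ :* y₀ :* (y₃ :* y₃) :+ y₁ :* y₁ :* y₁ :* y₃ :+ y₀ :* (y₂ :* y₂ :* y₂)))

  chord-det : ∀ A B ω → (B - ω) * A - (B + ω) * A ≡ ω * A
  chord-det = solve 3 (λ A B ω → (B :- ω) :* A :- (B :+ ω) :* A := ω :* A) refl

  -- In characteristic 3 the quadratic formula for the form of y gives the roots (hB ∓ ω : hA).
  chord-through : ∀ y ω → ω * ω ≡ disc y → ω ≢ 0# → hA y ≢ 0# →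
    InSpan (ν (hB y - ω) (hA y)) (ν (hB y + ω) (hA y)) y
  chord-through y@(y₀ , y₁ , y₂ , y₃) ω e ω≢0 A≢0 =
    -- Cramer's rule on the last two coordinates, where -2A³ω = A³ω is the denominator; the first
    -- two coordinates are then a consequence of ω² = disc y.
    (A * y₂ - (B + ω) * y₃) * (A * A * A * ω) ⁻¹ , (- (A * y₂ - (B - ω) * y₃)) * (A * A * A * ω) ⁻¹ , ≡-V4
      (divide κ≢0 (multipleOfZero {c = - (ω * (A * y₂ - B * y₃))} (solve 5 (modDisc λ A B y₀ y₁ y₂ y₃ ω →
        A :* A :* A :* ω :* y₀ :- ((A :* y₂ :- (B :+ ω) :* y₃) :* ((B :- ω) :* (B :- ω) :* (B :- ω)) :+ :- (A :* y₂ :- (B :- ω) :* y₃) :* ((B :+ ω) :* (B :+ ω) :* (B :+ ω)))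
        , :- (ω :* (A :* y₂ :- B :* y₃))) refl y₀ y₁ y₂ y₃ ω) e'))
      (divide κ≢0 (multipleOfZero {c = - (A * ω * y₃)} (solve 5 (modDisc λ A B y₀ y₁ y₂ y₃ ω →
        A :* A :* A :* ω :* y₁ :- ((A :* y₂ :- (B :+ ω) :* y₃) :* ((B :- ω) :* (B :- ω) :* A) :+ :- (A :* y₂ :- (B :- ω) :* y₃) :* ((B :+ ω) :* (B :+ ω) :* A))
        , :- (A :* ω :* y₃)) refl y₀ y₁ y₂ y₃ ω) e'))
      (divide κ≢0 (solve 5 (λ A B y₂ y₃ ω →
        A :* A :* A :* ω :* y₂ :- ((A :* y₂ :- (B :+ ω) :* y₃) :* ((B :- ω) :* A :* A) :+ :- (A :* y₂ :- (B :- ω) :* y₃) :* ((B :+ ω) :* A :* A))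
        := con 𝟎) refl A B y₂ y₃ ω))
      (divide κ≢0 (solve 5 (λ A B y₂ y₃ ω →
        A :* A :* A :* ω :* y₃ :- ((A :* y₂ :- (B :+ ω) :* y₃) :* (A :* A :* A) :+ :- (A :* y₂ :- (B :- ω) :* y₃) :* (A :* A :* A))
        := con 𝟎) refl A B y₂ y₃ ω))
    where
    A B : Carrier
    A = hA y
    B = hB y
    κ≢0 : A * A * A * ω ≢ 0#
    κ≢0 = *-nonzero (*-nonzero (*-nonzero A≢0 A≢0) A≢0) ω≢0
    e' : ω * ω - disc y ≡ 0#
    e' = x≡y⇒x-y≡0 e

  -- When hA = 0 the form is t (hB s + hC t), with roots (1 : 0) and (hC : -hB), and disc = hB²
  -- makes them distinct. The last coordinate determines b, then the first determines a.
  chord-through-0 : ∀ y → hA y ≡ 0# → disc y ≢ 0# → hB y ≢ 0# × InSpan (ν 1# 0#) (ν (hC y) (- hB y)) y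
  chord-through-0 y@(y₀ , y₁ , y₂ , y₃) A≡0 D≢0 = B≢0 ,
    y₀ - b * (C * C * C) , b , ≡-V4
      (solve 4 (λ y₀ b C B → y₀ := (y₀ :- b :* (C :* C :* C)) :* (con 𝟏 :* con 𝟏 :* con 𝟏) :+ b :* (C :* C :* C)) refl y₀ b C B)
      (*-cancelˡ B³≢0 (trans
        (x-y≡0⇒x≡y (multipleOfZero {c = B * (C * y₁ - B * y₀)} (solve 4 (λ y₀ y₁ y₂ y₃ →
          let A = y₁ :* y₃ :- y₂ :* y₂
              B = y₁ :* y₂ :- y₀ :* y₃
              C = y₀ :* y₂ :- y₁ :* y₁ in
          B :* B :* B :* y₁ :- y₃ :* (C :* C :* B) := B :* (C :* y₁ :- B :* y₀) :* A) refl y₀ y₁ y₂ y₃) A≡0))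
        (sym (B³* (C * C * B) (solve 4 (λ a b C B → a :* (con 𝟏 :* con 𝟏 :* con 𝟎) :+ b :* (C :* C :* :- B) := :- b :* (C :* C :* B)) refl a b C B)))))
      (*-cancelˡ B³≢0 (trans
        (x-y≡0⇒x≡y (multipleOfZero {c = - (B * B * y₁)} (solve 4 (λ y₀ y₁ y₂ y₃ →
          let A = y₁ :* y₃ :- y₂ :* y₂
              B = y₁ :* y₂ :- y₀ :* y₃
              C = y₀ :* y₂ :- y₁ :* y₁ in
          B :* B :* B :* y₂ :- y₃ :* :- (C :* B :* B) := :- (B :* B :* y₁) :* A) refl y₀ y₁ y₂ y₃) A≡0))
        (sym (B³* (- (C * B * B)) (solve 4 (λ a b C B → a :* (con 𝟏 :* con 𝟎 :* con 𝟎) :+ b :* (C :* :- B :* :- B) := :- b :* :- (C :* B :* B)) refl a b C B)))))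
      (*-cancelˡ B³≢0 (trans (*-comm _ _)
        (sym (B³* (B * B * B) (solve 3 (λ a b B → a :* (con 𝟎 :* con 𝟎 :* con 𝟎) :+ b :* (:- B :* :- B :* :- B) := :- b :* (B :* B :* B)) refl a b B)))))
    where
    A B C a b : Carrier
    A = hA y
    B = hB y
    C = hC y
    b = - (y₃ * (B * B * B) ⁻¹)
    a = y₀ - b * (C * C * C)
    B≢0 : B ≢ 0#
    B≢0 B≡0 = D≢0 (trans (disc-hABC y) (trans (cong₂ (λ B A → B * B - A * C) B≡0 A≡0)
      (solve 1 (λ C → con 𝟎 :* con 𝟎 :- con 𝟎 :* C := con 𝟎) refl C)))
    B³≢0 : B * B * B ≢ 0#
    B³≢0 = *-nonzero (*-nonzero B≢0 B≢0) B≢0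
    B³* : ∀ {x} m → x ≡ - b * m → B * B * B * x ≡ y₃ * m
    B³* {x} m refl = begin
      B * B * B * (- - (y₃ * (B * B * B) ⁻¹) * m)
        ≡⟨ solve 4 (λ k i y m → k :* (:- :- (y :* i) :* m) := k :* i :* (y :* m)) refl (B * B * B) ((B * B * B) ⁻¹) y₃ m ⟩
      B * B * B * (B * B * B) ⁻¹ * (y₃ * m) ≡⟨ cong (_* (y₃ * m)) (⁻¹-inverse _ B³≢0) ⟩
      1# * (y₃ * m) ≡⟨ *-identityˡ _ ⟩
      y₃ * m ∎
      where open ≡-Reasoning

  module _ (_≟_ : DecidableEquality Carrier) (cubeRoot : ∀ x → ∃ λ s → s * s * s ≡ x) where

    cube≡0⇒≡0 : ∀ {x} → x * x * x ≡ 0# → x ≡ 0#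
    cube≡0⇒≡0 {x} e with x ≟ 0#
    ... | yes x≡0 = x≡0
    ... | no x≢0  = ⊥-elim (*-nonzero (*-nonzero x≢0 x≢0) x≢0 e)

    cube-injective : ∀ {x y} → x * x * x ≡ y * y * y → x ≡ y
    cube-injective {x} {y} e = x-y≡0⇒x≡y (cube≡0⇒≡0 (trans
      (solve 2 (λ x y → (x :- y) :* (x :- y) :* (x :- y) := x :* x :* x :- y :* y :* y) refl x y) (x≡y⇒x-y≡0 e)))

    -- The tangent direction has outer coordinates 0, so the point of contact is forced: s³ = y₀ and
    -- t³ = y₃. Then disc y is the cube of R = s²t² + y₁t + sy₂, and R = 0 says that the inner
    -- coordinates of y - ν(s, t) are proportional to (s, -t).
    tangent-through : ∀ y → ¬ InAX y → disc y ≡ 0# → OnTangent y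
    tangent-through (y₀ , y₁ , y₂ , y₃) y∉AX e with cubeRoot y₀ | cubeRoot y₃
    ... | s , refl | t , refl = s , t , st≢0 , 1# , through (s ≟ 0#)
      where
      R : Carrier
      R = s * s * (t * t) + y₁ * t + s * y₂
      R≡0 : R ≡ 0#
      R≡0 = cube≡0⇒≡0 (trans (solve 4 (λ s t y₁ y₂ → let R = s :* s :* (t :* t) :+ y₁ :* t :+ s :* y₂ in
        R :* R :* R := (s :* s :* s) :* (s :* s :* s) :* ((t :* t :* t) :* (t :* t :* t))
          :+ y₁ :* y₁ :* y₁ :* (t :* t :* t) :+ s :* s :* s :* (y₂ :* y₂ :* y₂)) refl s t y₁ y₂) e)
      0³ : 0# * 0# * 0# ≡ 0#
      0³ = zeroʳ _
      st≢0 : NonzeroPair s t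
      st≢0 (refl , refl) = y∉AX (0³ , 0³)
      outer : ∀ b x → x ≡ 1# * x + b * 0#
      outer = solve 2 (λ b x → x := con 𝟏 :* x :+ b :* con 𝟎) refl
      through : Dec (s ≡ 0#) → ∃ λ b → (s * s * s , y₁ , y₂ , t * t * t) ≡ 1# • ν s t ⊕ b • tdir s t
      through (no s≢0) = b , ≡-V4 (outer b _)
        (sym (trans (cong (1# * (s * s * t) +_) (trans (*-comm b s) sb)) (solve 2 (λ u y → con 𝟏 :* u :+ (y :- u) := y) refl _ y₁)))
        (*-cancelˡ s≢0 (begin
          s * y₂ ≡⟨ solve 4 (λ s t y₁ y₂ → s :* y₂ := (s :* s :* (t :* t) :+ y₁ :* t :+ s :* y₂) :- (s :* s :* (t :* t) :+ y₁ :* t)) refl s t y₁ y₂ ⟩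
          R - (s * s * (t * t) + y₁ * t) ≡⟨ cong (_- (s * s * (t * t) + y₁ * t)) R≡0 ⟩
          0# - (s * s * (t * t) + y₁ * t) ≡⟨ solve 3 (λ s t y₁ → con 𝟎 :- (s :* s :* (t :* t) :+ y₁ :* t) := s :* (con 𝟏 :* (s :* t :* t)) :+ (y₁ :- s :* s :* t) :* :- t) refl s t y₁ ⟩
          s * (1# * (s * t * t)) + (y₁ - s * s * t) * - t ≡⟨ cong (λ u → s * (1# * (s * t * t)) + u * - t) (sym sb) ⟩
          s * (1# * (s * t * t)) + s * b * - t ≡⟨ solve 4 (λ s x b t → s :* x :+ s :* b :* :- t := s :* (x :+ b :* :- t)) refl s (1# * (s * t * t)) b t ⟩
          s * (1# * (s * t * t) + b * - t) ∎))
        (outer b _)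
        where
        open ≡-Reasoning
        b : Carrier
        b = s ⁻¹ * (y₁ - s * s * t)
        sb : s * b ≡ y₁ - s * s * t
        sb = trans (sym (*-assoc _ _ _)) (trans (cong (_* (y₁ - s * s * t)) (⁻¹-inverse s s≢0)) (*-identityˡ _))
      through (yes refl) = b , ≡-V4 (outer b _)
        (trans y₁≡0 (solve 2 (λ t b → con 𝟎 := con 𝟏 :* (con 𝟎 :* con 𝟎 :* t) :+ b :* con 𝟎) refl t b))
        (begin
          y₂ ≡⟨ sym (*-identityˡ y₂) ⟩
          1# * y₂ ≡⟨ cong (_* y₂) (sym (⁻¹-inverse t t≢0)) ⟩
          t * t ⁻¹ * y₂ ≡⟨ solve 3 (λ t i y → t :* i :* y := con 𝟏 :* (con 𝟎 :* t :* t) :+ :- (i :* y) :* :- t) refl t (t ⁻¹) y₂ ⟩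
          1# * (0# * t * t) + b * - t ∎)
        (outer b _)
        where
        open ≡-Reasoning
        b : Carrier
        b = - (t ⁻¹ * y₂)
        t≢0 : t ≢ 0#
        t≢0 refl = st≢0 (refl , refl)
        y₁≡0 : y₁ ≡ 0#
        y₁≡0 = *≡0⇒≡0 t≢0 (trans (solve 3 (λ t y₁ y₂ → t :* y₁ := con 𝟎 :* con 𝟎 :* (t :* t) :+ y₁ :* t :+ con 𝟎 :* y₂) refl t y₁ y₂) R≡0)

-- Conjugation in the quadratic extension

module Hom {F K : Field} (ι : RingHom F K) where
  private
    module F = Field F
    module FP = FieldProps F
    module KP = FieldProps K
  open Field K
  open RingHom ι

  map-neg : ∀ a → ⟦ F.- a ⟧ ≡ - ⟦ a ⟧
  map-neg a = KP.x-y≡0⇒x≡y (begin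
    ⟦ F.- a ⟧ - - ⟦ a ⟧ ≡⟨ cong (⟦ F.- a ⟧ +_) (KP.-‿involutive _) ⟩
    ⟦ F.- a ⟧ + ⟦ a ⟧   ≡⟨ sym (map-+ (F.- a) a) ⟩
    ⟦ F.- a F.+ a ⟧     ≡⟨ trans (cong ⟦_⟧ (FP.-‿inverseˡ a)) map-0 ⟩
    0#                  ∎)
    where open ≡-Reasoning

  infixl 6 _⟨+⟩_ _⟨-⟩_
  infixl 7 _⟨*⟩_

  -- These combinators copy the shape of an expression with `refl` at the leaves and produce the
  -- proof that the homomorphism commutes with it.
  _⟨+⟩_ : ∀ {a b a' b'} → ⟦ a ⟧ ≡ a' → ⟦ b ⟧ ≡ b' → ⟦ a F.+ b ⟧ ≡ a' + b'
  refl ⟨+⟩ refl = map-+ _ _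

  _⟨*⟩_ : ∀ {a b a' b'} → ⟦ a ⟧ ≡ a' → ⟦ b ⟧ ≡ b' → ⟦ a F.* b ⟧ ≡ a' * b'
  refl ⟨*⟩ refl = map-* _ _

  _⟨-⟩_ : ∀ {a b a' b'} → ⟦ a ⟧ ≡ a' → ⟦ b ⟧ ≡ b' → ⟦ a F.- b ⟧ ≡ a' - b'
  refl ⟨-⟩ refl = trans (map-+ _ _) (cong (_ +_) (map-neg _))

  map-pow : ∀ a n → ⟦ F.pow a n ⟧ ≡ pow ⟦ a ⟧ n
  map-pow a zero    = map-1
  map-pow a (suc n) = refl ⟨*⟩ map-pow a n

  map-nonzero : ∀ {a} → a ≢ F.0# → ⟦ a ⟧ ≢ 0#
  map-nonzero {a} a≢0 e = 0≢1 (begin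
    0#                  ≡⟨ sym (KP.zeroˡ _) ⟩
    0# * ⟦ a F.⁻¹ ⟧     ≡⟨ cong (_* ⟦ a F.⁻¹ ⟧) (sym e) ⟩
    ⟦ a ⟧ * ⟦ a F.⁻¹ ⟧  ≡⟨ sym (map-* _ _) ⟩
    ⟦ a F.* a F.⁻¹ ⟧    ≡⟨ trans (cong ⟦_⟧ (F.⁻¹-inverse a a≢0)) map-1 ⟩
    1#                  ∎)
    where open ≡-Reasoning

  map-charThree : CharThree F → CharThree K
  map-charThree 3≡0 = trans (sym (map-1 ⟨+⟩ (map-1 ⟨+⟩ map-1))) (trans (cong ⟦_⟧ 3≡0) map-0)

-- Genericity speaks of extensions of `F`; the identity specialises it to `F` itself.
idHom : (F : Field) → RingHom F F
idHom F = record { ⟦_⟧ = λ a → a ; map-0 = refl ; map-1 = refl ; map-+ = λ _ _ → refl ; map-* = λ _ _ → refl }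

module QuadraticExtension (F K : Field) (ι : RingHom F K) {q : ℕ} (h : ℕ) (q≡3^h : q ≡ 3 ℕ.^ h)
  (finF : IsFinite F q) (finK : IsFinite K (q ℕ.* q)) (3≡0 : CharThree F) where

  open Hom ι
  open RingHom ι
  open Field K
  open Char₃ K (map-charThree 3≡0)
  private
    module F  = Field F
    module FC = Char₃ F 3≡0
    module FF = FiniteField F finF
    module FS = SquareRoots F finF 3≡0
    module FG = Geom F
    module FCh = Chords F 3≡0
    module KF = FiniteField K finK
    module KCh = Chords K (map-charThree 3≡0)
  open Geom K
  open Quartic K using (NoDoubleRoot)

  map-injective : ∀ {a b} → ⟦ a ⟧ ≡ ⟦ b ⟧ → a ≡ b
  map-injective {a} {b} e with a FF.≟ b
  ... | yes a≡b = a≡b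
  ... | no a≢b  = ⊥-elim (map-nonzero (a≢b ∘ FC.x-y≡0⇒x≡y) (trans (refl ⟨-⟩ refl) (x≡y⇒x-y≡0 e)))

  φ : Carrier → Carrier
  φ x = pow x q

  φ-+ : ∀ x y → φ (x + y) ≡ φ x + φ y
  φ-+ x y = subst (λ n → pow (x + y) n ≡ pow x n + pow y n) (sym q≡3^h) (frobenius-+ h x y)

  φ-neg : ∀ x → φ (- x) ≡ - φ x
  φ-neg x = subst (λ n → pow (- x) n ≡ - pow x n) (sym q≡3^h) (frobenius-neg h x)

  φ-* : ∀ x y → φ (x * y) ≡ φ x * φ y
  φ-* x y = pow-distrib-* x y q

  φ-involutive : ∀ x → φ (φ x) ≡ x
  φ-involutive x = trans (sym (pow-* x q q)) (KF.fermat x)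

  φ-map : ∀ a → φ ⟦ a ⟧ ≡ ⟦ a ⟧
  φ-map a = trans (sym (map-pow a q)) (cong ⟦_⟧ (FF.fermat a))

  private
    xⁿ : ∀ n x → evalMonic (replicate n 0#) x ≡ pow x n
    xⁿ zero    x = refl
    xⁿ (suc n) x = trans (+-identityˡ _) (cong (x *_) (xⁿ n x))

    fixedPoly : ∀ n → 1 ℕ.< n → ∃ λ (as : Vec Carrier n) → ∀ x → pow x n ≡ x → evalMonic as x ≡ 0#
    fixedPoly (suc (suc n)) _ = 0# ∷ - 1# ∷ replicate n 0# , λ x e → (begin
      0# + x * (- 1# + x * evalMonic (replicate n 0#) x) ≡⟨ cong (λ u → 0# + x * (- 1# + x * u)) (xⁿ n x) ⟩
      0# + x * (- 1# + x * pow x n) ≡⟨ solve 2 (λ x u → con 𝟎 :+ x :* (:- con 𝟏 :+ x :* u) := x :* (x :* u) :- x) refl x (pow x n) ⟩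
      x * (x * pow x n) - x         ≡⟨ x≡y⇒x-y≡0 e ⟩
      0#                            ∎)
      where open ≡-Reasoning
    fixedPoly (suc zero) (ℕ.s≤s ())

  -- The polynomial x^q - x has at most q roots, and the image of `F` already supplies q of them.
  φ-fixed : ∀ x → φ x ≡ x → ∃ λ a → x ≡ ⟦ a ⟧
  φ-fixed x e with FF.search (λ a → x KF.≟ ⟦ a ⟧)
  ... | yes r = r
  ... | no ¬r = ⊥-elim (ℕₚ.<-irrefl refl (ℕₚ.≤-trans
    (ℕₚ.≤-reflexive (cong suc (sym (trans (length-map ⟦_⟧ FF.elements) FF.length-elements))))
    (rootBound (proj₁ (fixedPoly q FF.size>1))
      (All.tabulate (λ {y} y∈ x≡y → let (a , _ , y≡a) = ∈-map⁻ ⟦_⟧ y∈ in ¬r (a , trans x≡y y≡a))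
        ∷ Uniqueₚ.map⁺ map-injective FF.elements-unique)
      (proj₂ (fixedPoly q FF.size>1) x e
        ∷ All.tabulate (λ y∈ → let (a , _ , y≡a) = ∈-map⁻ ⟦_⟧ y∈ in
            proj₂ (fixedPoly q FF.size>1) _ (trans (cong φ y≡a) (trans (φ-map a) (sym y≡a))))))))

  φ-nontrivial : ∃ λ k → φ k ≢ k
  φ-nontrivial with KF.search (λ k → ¬? (φ k KF.≟ k))
  ... | yes r = r
  ... | no ¬r = ⊥-elim (ℕₚ.<⇒≱ q<q² (subst (ℕ._≤ q) KF.length-elements
    (rootBound (proj₁ (fixedPoly q FF.size>1)) KF.elements-unique
      (All.tabulate (λ {k} _ → proj₂ (fixedPoly q FF.size>1) k
        (decidable-stable (φ k KF.≟ k) (λ ne → ¬r (k , ne))))))))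
    where
    q<q² : q ℕ.< q ℕ.* q
    q<q² = ℕₚ.m<m*n q q {{ℕ.>-nonZero (ℕₚ.<-trans (ℕ.s≤s ℕ.z≤n) FF.size>1)}} FF.size>1

  -- With φ k ≠ k, κ = k - φ k is anti-invariant, so κ² lies in F and is a nonsquare there;
  -- every nonsquare of F is κ² up to squares.
  antiInvariantRoot : ∀ d → ¬ FS.Square d → ∃ λ ω → ω * ω ≡ ⟦ d ⟧ × φ ω ≡ - ω
  antiInvariantRoot d ¬sd with φ-nontrivial
  ... | k , φk≢k = lift (φ-fixed (κ * κ) (trans (φ-* κ κ) (trans (cong₂ _*_ φκ φκ) (solve 1 (λ κ → :- κ :* :- κ := κ :* κ) refl κ))))
    where
    κ : Carrier
    κ = k - φ k
    φκ : φ κ ≡ - κ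
    φκ = begin
      φ (k - φ k)       ≡⟨ φ-+ k (- φ k) ⟩
      φ k + φ (- φ k)   ≡⟨ cong (φ k +_) (trans (φ-neg (φ k)) (cong -_ (φ-involutive k))) ⟩
      φ k - k           ≡⟨ solve 2 (λ a b → a :- b := :- (b :- a)) refl (φ k) k ⟩
      - (k - φ k)       ∎
      where open ≡-Reasoning
    κ≢0 : κ ≢ 0#
    κ≢0 e = φk≢k (sym (x-y≡0⇒x≡y e))
    lift : (∃ λ μ → κ * κ ≡ ⟦ μ ⟧) → ∃ λ ω → ω * ω ≡ ⟦ d ⟧ × φ ω ≡ - ω
    lift (μ , κ²) = halve (FS.nonsquare*nonsquare ¬sμ ¬sd)
      where
      -- If μ = w², then κ = ±w is in the image of `F`, so φ κ = κ; but φ κ = -κ and κ ≠ 0.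
      ¬sμ : ¬ FS.Square μ
      ¬sμ (w , e) = φk≢k (sym (x-y≡0⇒x≡y (x≡-x⇒x≡0 (trans (sym fixedκ) φκ))))
        where
        fixedκ : φ κ ≡ κ
        fixedκ with κ KF.≟ ⟦ w ⟧
        ... | yes κ≡w = trans (cong φ κ≡w) (trans (φ-map w) (sym κ≡w))
        ... | no κ≢w  = trans (cong φ κ≡-w) (trans (φ-neg ⟦ w ⟧) (trans (cong -_ (φ-map w)) (sym κ≡-w)))
          where
          κ≡-w : κ ≡ - ⟦ w ⟧
          κ≡-w = x-y≡0⇒x≡y (*≡0⇒≡0 (κ≢w ∘ x-y≡0⇒x≡y)
            (trans (solve 2 (λ κ w → (κ :- w) :* (κ :- :- w) := κ :* κ :- w :* w) refl κ ⟦ w ⟧)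
                   (x≡y⇒x-y≡0 (trans κ² (trans (cong ⟦_⟧ (sym e)) (map-* w w))))))
      halve : FS.Square (μ F.* d) → ∃ λ ω → ω * ω ≡ ⟦ d ⟧ × φ ω ≡ - ω
      halve (m , m²≡μd) = κ ⁻¹ * ⟦ m ⟧
        , *-cancelˡ (*-nonzero κ≢0 κ≢0) (begin
            κ * κ * (κ ⁻¹ * ⟦ m ⟧ * (κ ⁻¹ * ⟦ m ⟧))
              ≡⟨ solve 3 (λ κ i m → κ :* κ :* (i :* m :* (i :* m)) := (κ :* (i :* m)) :* (κ :* (i :* m))) refl κ (κ ⁻¹) ⟦ m ⟧ ⟩
            (κ * ω) * (κ * ω)  ≡⟨ cong (λ u → u * u) κω ⟩
            ⟦ m ⟧ * ⟦ m ⟧      ≡⟨ trans (sym (map-* m m)) (trans (cong ⟦_⟧ m²≡μd) (map-* μ d)) ⟩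
            ⟦ μ ⟧ * ⟦ d ⟧      ≡⟨ cong (_* ⟦ d ⟧) (sym κ²) ⟩
            κ * κ * ⟦ d ⟧      ∎)
        , *-cancelˡ (-‿nonzero κ≢0) (begin
            - κ * φ ω          ≡⟨ cong (_* φ ω) (sym φκ) ⟩
            φ κ * φ ω          ≡⟨ sym (φ-* κ ω) ⟩
            φ (κ * ω)          ≡⟨ cong φ κω ⟩
            φ ⟦ m ⟧            ≡⟨ φ-map m ⟩
            ⟦ m ⟧              ≡⟨ sym κω ⟩
            κ * ω              ≡⟨ solve 2 (λ κ ω → κ :* ω := :- κ :* :- ω) refl κ ω ⟩
            - κ * - ω          ∎)
        where
        open ≡-Reasoning
        ω : Carrier
        ω = κ ⁻¹ * ⟦ m ⟧
        κω : κ * ω ≡ ⟦ m ⟧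
        κω = trans (sym (*-assoc _ _ _)) (trans (cong (_* ⟦ m ⟧) (⁻¹-inverse κ κ≢0)) (*-identityˡ _))

  map-disc : ∀ v → KCh.disc (mapV ι v) ≡ ⟦ FCh.disc v ⟧
  map-disc _ = sym (refl ⟨*⟩ refl ⟨*⟩ (refl ⟨*⟩ refl) ⟨+⟩ refl ⟨*⟩ refl ⟨*⟩ refl ⟨*⟩ refl ⟨+⟩ refl ⟨*⟩ (refl ⟨*⟩ refl ⟨*⟩ refl))

  map-hA : ∀ v → KCh.hA (mapV ι v) ≡ ⟦ FCh.hA v ⟧
  map-hA _ = sym (refl ⟨*⟩ refl ⟨-⟩ refl ⟨*⟩ refl)

  map-hB : ∀ v → KCh.hB (mapV ι v) ≡ ⟦ FCh.hB v ⟧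
  map-hB _ = sym (refl ⟨*⟩ refl ⟨-⟩ refl ⟨*⟩ refl)

  -- Applying φ to the osculating-plane equation at one end gives the one at the other end, so the
  -- coefficients satisfy φ a = b. The square root w = abd³ of the discriminant then satisfies φ w =
  -- -w. A square root in `F` would make w fixed, hence zero, and then a, b and v vanish.
  inIC⇒nonsquare : ∀ v → FG.Nonzero v → InIC F K ι q v → ¬ FS.Square (FCh.disc v)
  inIC⇒nonsquare v@(v₀ , v₁ , v₂ , v₃) v≢0 (s , t , d≢0 , a , b , e) (x , x²) = v≢0 v≡0
    where
    open ≡-Reasoning
    d w : Carrier
    d = s * φ t - φ s * t
    w = a * b * (d * d * d)
    d³≢0 : d * d * d ≢ 0#
    d³≢0 = *-nonzero (*-nonzero d≢0 d≢0) d≢0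
    φ-d : φ d ≡ - d
    φ-d = begin
      φ (s * φ t - φ s * t) ≡⟨ trans (φ-+ _ _) (cong₂ _+_ (φ-* s (φ t)) (trans (φ-neg _) (cong -_ (φ-* (φ s) t)))) ⟩
      φ s * φ (φ t) - φ (φ s) * φ t ≡⟨ cong₂ (λ u v → φ s * u - v * φ t) (φ-involutive t) (φ-involutive s) ⟩
      φ s * t - s * φ t             ≡⟨ solve 2 (λ a b → a :- b := :- (b :- a)) refl (φ s * t) (s * φ t) ⟩
      - d                           ∎
    φ-cube : ∀ x → φ (x * x * x) ≡ φ x * φ x * φ x
    φ-cube x = trans (φ-* (x * x) x) (cong (_* φ x) (φ-* x x))
    φ-d³ : φ (d * d * d) ≡ - (d * d * d)
    φ-d³ = trans (φ-cube d) (trans (cong (λ u → u * u * u) φ-d) (solve 1 (λ d → :- d :* :- d :* :- d := :- (d :* d :* d)) refl d))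
    v₀≡ : ⟦ v₀ ⟧ ≡ proj₁ (a • ν s t ⊕ b • ν (φ s) (φ t))
    v₀≡ = cong proj₁ e
    v₃≡ : ⟦ v₃ ⟧ ≡ proj₂ (proj₂ (proj₂ (a • ν s t ⊕ b • ν (φ s) (φ t))))
    v₃≡ = cong (proj₂ ∘ proj₂ ∘ proj₂) e
    left : φ t * φ t * φ t * ⟦ v₀ ⟧ - φ s * φ s * φ s * ⟦ v₃ ⟧ ≡ a * (d * d * d)
    left = trans (cong₂ (λ x y → φ t * φ t * φ t * x - φ s * φ s * φ s * y) v₀≡ v₃≡) KCh.osculating-coefficientˡ
    right : t * t * t * ⟦ v₀ ⟧ - s * s * s * ⟦ v₃ ⟧ ≡ - (b * (d * d * d))
    right = trans (cong₂ (λ x y → t * t * t * x - s * s * s * y) v₀≡ v₃≡) KCh.osculating-coefficientʳ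
    conjugate : ∀ x v → φ (φ x * φ x * φ x * ⟦ v ⟧) ≡ x * x * x * ⟦ v ⟧
    conjugate x v = trans (φ-* _ _) (cong₂ _*_ (trans (φ-cube (φ x)) (cong (λ u → u * u * u) (φ-involutive x))) (φ-map v))
    φa≡b : φ a ≡ b
    φa≡b = sym (*-cancelˡ (-‿nonzero d³≢0) (begin
      - (d * d * d) * b           ≡⟨ solve 2 (λ d b → :- d :* b := :- (b :* d)) refl (d * d * d) b ⟩
      - (b * (d * d * d))         ≡⟨ sym right ⟩
      t * t * t * ⟦ v₀ ⟧ - s * s * s * ⟦ v₃ ⟧ ≡⟨ sym (cong₂ _-_ (conjugate t v₀) (conjugate s v₃)) ⟩
      φ (φ t * φ t * φ t * ⟦ v₀ ⟧) - φ (φ s * φ s * φ s * ⟦ v₃ ⟧) ≡⟨ sym (trans (φ-+ _ _) (cong (φ (φ t * φ t * φ t * ⟦ v₀ ⟧) +_) (φ-neg _))) ⟩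
      φ (φ t * φ t * φ t * ⟦ v₀ ⟧ - φ s * φ s * φ s * ⟦ v₃ ⟧) ≡⟨ cong φ left ⟩
      φ (a * (d * d * d))         ≡⟨ trans (φ-* a _) (trans (cong (φ a *_) φ-d³) (*-comm _ _)) ⟩
      - (d * d * d) * φ a         ∎))
    w² : w * w ≡ ⟦ x ⟧ * ⟦ x ⟧
    w² = begin
      w * w                   ≡⟨ sym KCh.disc-chord ⟩
      KCh.disc (a • ν s t ⊕ b • ν (φ s) (φ t)) ≡⟨ cong KCh.disc (sym e) ⟩
      KCh.disc (mapV ι v)     ≡⟨ map-disc v ⟩
      ⟦ FCh.disc v ⟧          ≡⟨ trans (cong ⟦_⟧ (sym x²)) (map-* x x) ⟩
      ⟦ x ⟧ * ⟦ x ⟧           ∎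
    φ-w : φ w ≡ - w
    φ-w = begin
      φ (a * b * (d * d * d)) ≡⟨ trans (φ-* _ _) (cong₂ _*_ (φ-* a b) φ-d³) ⟩
      φ a * φ b * - (d * d * d) ≡⟨ cong₂ (λ u v → u * v * - (d * d * d)) φa≡b (trans (cong φ (sym φa≡b)) (φ-involutive a)) ⟩
      b * a * - (d * d * d)   ≡⟨ solve 3 (λ a b d → b :* a :* :- d := :- (a :* b :* d)) refl a b (d * d * d) ⟩
      - w                     ∎
    fixed-w : φ w ≡ w
    fixed-w with w KF.≟ ⟦ x ⟧
    ... | yes w≡x = trans (cong φ w≡x) (trans (φ-map x) (sym w≡x))
    ... | no w≢x  = trans (cong φ w≡-x) (trans (φ-neg ⟦ x ⟧) (trans (cong -_ (φ-map x)) (sym w≡-x)))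
      where
      w≡-x : w ≡ - ⟦ x ⟧
      w≡-x = x-y≡0⇒x≡y (*≡0⇒≡0 (w≢x ∘ x-y≡0⇒x≡y)
        (trans (solve 2 (λ w x → (w :- x) :* (w :- :- x) := w :* w :- x :* x) refl w ⟦ x ⟧) (x≡y⇒x-y≡0 w²)))
    a≡0 : a ≡ 0#
    a≡0 with a KF.≟ 0#
    ... | yes e = e
    ... | no a≢0 = ⊥-elim (*-nonzero (*-nonzero a≢0 b≢0) d³≢0 (x≡-x⇒x≡0 (trans (sym fixed-w) φ-w)))
      where
      b≢0 : b ≢ 0#
      b≢0 b≡0 = pow-nonzero a≢0 q (trans φa≡b b≡0)
    b≡0 : b ≡ 0#
    b≡0 = trans (sym φa≡b) (trans (cong φ (trans a≡0 (sym map-0))) (trans (φ-map F.0#) map-0))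
    vanish : ∀ {v x y} → ⟦ v ⟧ ≡ a * x + b * y → v ≡ F.0#
    vanish {v} {x} {y} e = map-injective (trans e (trans (cong₂ (λ a b → a * x + b * y) a≡0 b≡0)
      (trans (solve 2 (λ x y → con 𝟎 :* x :+ con 𝟎 :* y := con 𝟎) refl x y) (sym map-0))))
    v≡0 : v ≡ FG.0v
    v≡0 = FCh.≡-V4 (vanish v₀≡) (vanish (cong (proj₁ ∘ proj₂) e)) (vanish (cong (proj₁ ∘ proj₂ ∘ proj₂) e)) (vanish v₃≡)

  -- The ends (hB ∓ ω : hA) of `chord-through` are conjugate because φ ω = -ω while hA and hB come
  -- from `F`. If hA were 0, the discriminant would be the square hB².
  nonsquare⇒inIC : ∀ v → ¬ FS.Square (FCh.disc v) → InIC F K ι q v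
  nonsquare⇒inIC v ¬s = B - ω , A
    , (λ e → *-nonzero ω≢0 A≢0 (trans (sym (KCh.chord-det A B ω))
        (trans (cong₂ (λ s t → (B - ω) * t - s * A) (sym φ-s) (sym φ-A)) e)))
    , subst₂ (λ s t → InSpan (ν (B - ω) A) (ν s t) (mapV ι v)) (sym φ-s) (sym φ-A)
        (KCh.chord-through (mapV ι v) ω (trans ω² (sym (map-disc v))) ω≢0 A≢0)
    where
    A B ω : Carrier
    A = KCh.hA (mapV ι v)
    B = KCh.hB (mapV ι v)
    ω = proj₁ (antiInvariantRoot (FCh.disc v) ¬s)
    ω² : ω * ω ≡ ⟦ FCh.disc v ⟧
    ω² = proj₁ (proj₂ (antiInvariantRoot (FCh.disc v) ¬s))
    φω : φ ω ≡ - ω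
    φω = proj₂ (proj₂ (antiInvariantRoot (FCh.disc v) ¬s))
    ω≢0 : ω ≢ 0#
    ω≢0 ω≡0 = ¬s (F.0# , map-injective (trans (map-0 ⟨*⟩ map-0) (trans (sym (cong₂ _*_ ω≡0 ω≡0)) ω²)))
    A≢0 : A ≢ 0#
    A≢0 A≡0 = ¬s (FCh.hB v , sym (trans (FCh.disc-hABC v) (trans (cong (λ A → FCh.hB v F.* FCh.hB v F.- A F.* FCh.hC v) A'≡0)
      (FC.solve 2 (λ B C → B FC.:* B FC.:- FC.con 𝟎 FC.:* C FC.:= B FC.:* B) refl (FCh.hB v) (FCh.hC v)))))
      where
      A'≡0 : FCh.hA v ≡ F.0#
      A'≡0 = map-injective (trans (sym (map-hA v)) (trans A≡0 (sym map-0)))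
    φ-A : φ A ≡ A
    φ-A = trans (cong φ (map-hA v)) (trans (φ-map _) (sym (map-hA v)))
    φ-s : φ (B - ω) ≡ B + ω
    φ-s = begin
      φ (B - ω)     ≡⟨ φ-+ B (- ω) ⟩
      φ B + φ (- ω) ≡⟨ cong₂ _+_ (trans (cong φ (map-hB v)) (trans (φ-map _) (sym (map-hB v)))) (trans (φ-neg ω) (cong -_ φω)) ⟩
      B - - ω       ≡⟨ cong (B +_) (-‿involutive ω) ⟩
      B + ω         ∎
      where open ≡-Reasoning

  -- For nonsquare z₄ a degenerate t makes z₄f the square of z₄v² - z₃v + t,
  -- whose discriminant z₄ becomes a square in K.
  conic-nondegenerate : ∀ z₀ z₁ z₃ z₄ → NoDoubleRoot (⟦ z₀ ⟧ , ⟦ z₁ ⟧ , 1# , ⟦ z₃ ⟧ , ⟦ z₄ ⟧) →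
    (z₄≢0 : z₄ ≢ F.0#) → ¬ FS.Square z₄ →
    ∀ t → ¬ QuarticCount.Conic.Degenerate F finF 3≡0 z₄ (F.- z₃) (z₄ F.* z₀) (z₄ F.* z₁) z₄ z₄≢0 t
  conic-nondegenerate z₀ z₁ z₃ z₄ nd z₄≢0 ¬s t (A0 , B0 , C0) = nd c τ (λ (c≡0 , _) → map-nonzero z₄≢0 c≡0) first second
    where
    open ≡-Reasoning
    ω c a₀ a₁ a₃ u τ : Carrier
    ω = proj₁ (antiInvariantRoot z₄ ¬s)
    c = ⟦ z₄ ⟧
    a₀ = ⟦ z₀ ⟧
    a₁ = ⟦ z₁ ⟧
    a₃ = ⟦ z₃ ⟧
    u = ⟦ t ⟧
    -- A t = 0 says z₃² - z₄t = z₄ = ω², so the quadratic formula gives τ/c as a root of z₄v² - z₃v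
    -- + t.
    τ = - a₃ - ω
    ω² : ω * ω ≡ c
    ω² = proj₁ (proj₂ (antiInvariantRoot z₄ ¬s))
    open FC using () renaming (solve to solveF; _:*_ to _⊡_; _:-_ to _⊟_; :-_ to ⊟_; _:=_ to _≐_)
    cu : c * u ≡ a₃ * a₃ - ω * ω
    cu = begin
      c * u                     ≡⟨ sym (map-* z₄ t) ⟩
      ⟦ z₄ F.* t ⟧              ≡⟨ cong ⟦_⟧ (sym (FC.x-y≡0⇒x≡y (trans (solveF 3 (λ a c t → a ⊡ a ⊟ c ⊟ c ⊡ t ≐ ⊟ a ⊡ ⊟ a ⊟ c ⊡ t ⊟ c) refl z₃ z₄ t) A0))) ⟩
      ⟦ z₃ F.* z₃ F.- z₄ ⟧      ≡⟨ (refl ⟨*⟩ refl) ⟨-⟩ sym ω² ⟩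
      a₃ * a₃ - ω * ω           ∎
    ca₁ : c * a₁ ≡ a₃ * u
    ca₁ = trans (sym (map-* z₄ z₁)) (trans (cong ⟦_⟧ (sym (FC.x-y≡0⇒x≡y
      (trans (solveF 4 (λ a c z t → a ⊡ t ⊟ c ⊡ z ≐ ⊟ (⊟ a ⊡ t) ⊟ c ⊡ z) refl z₃ z₄ z₁ t) B0)))) (map-* z₃ t))
    ca₀ : c * a₀ ≡ u * u
    ca₀ = trans (sym (map-* z₄ z₀)) (trans (cong ⟦_⟧ (sym (FC.x-y≡0⇒x≡y C0))) (map-* t t))
    first : a₀ * (c * c * c) - 1# * (c * τ * τ) + a₃ * (τ * τ * τ) ≡ 0#
    first = begin
      a₀ * (c * c * c) - 1# * (c * τ * τ) + a₃ * (τ * τ * τ)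
        ≡⟨ solve 4 (λ a₀ a₃ c τ → a₀ :* (c :* c :* c) :- con 𝟏 :* (c :* τ :* τ) :+ a₃ :* (τ :* τ :* τ) :=
                                  c :* c :* (c :* a₀) :- c :* (τ :* τ) :+ a₃ :* (τ :* τ :* τ)) refl a₀ a₃ c τ ⟩
      c * c * (c * a₀) - c * (τ * τ) + a₃ * (τ * τ * τ)
        ≡⟨ cong (λ x → c * c * x - c * (τ * τ) + a₃ * (τ * τ * τ)) ca₀ ⟩
      c * c * (u * u) - c * (τ * τ) + a₃ * (τ * τ * τ)
        ≡⟨ cong (λ x → x - c * (τ * τ) + a₃ * (τ * τ * τ)) (interchange c c u u) ⟩
      c * u * (c * u) - c * (τ * τ) + a₃ * (τ * τ * τ)
        ≡⟨ cong₂ (λ x c → x * x - c * (τ * τ) + a₃ * (τ * τ * τ)) cu (sym ω²) ⟩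
      (a₃ * a₃ - ω * ω) * (a₃ * a₃ - ω * ω) - ω * ω * (τ * τ) + a₃ * (τ * τ * τ)
        ≡⟨ solve 2 (λ a ω → let τ = :- a :- ω in
             (a :* a :- ω :* ω) :* (a :* a :- ω :* ω) :- ω :* ω :* (τ :* τ) :+ a :* (τ :* τ :* τ) := con 𝟎) refl a₃ ω ⟩
      0# ∎
    second : a₁ * (c * c * c) - 1# * (c * c * τ) + c * (τ * τ * τ) ≡ 0#
    second = begin
      a₁ * (c * c * c) - 1# * (c * c * τ) + c * (τ * τ * τ)
        ≡⟨ solve 3 (λ a₁ c τ → a₁ :* (c :* c :* c) :- con 𝟏 :* (c :* c :* τ) :+ c :* (τ :* τ :* τ) :=
                               c :* (c :* (c :* a₁) :- c :* τ :+ τ :* τ :* τ)) refl a₁ c τ ⟩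
      c * (c * (c * a₁) - c * τ + τ * τ * τ)
        ≡⟨ cong (λ x → c * (c * x - c * τ + τ * τ * τ)) ca₁ ⟩
      c * (c * (a₃ * u) - c * τ + τ * τ * τ)
        ≡⟨ solve 4 (λ a c u τ → c :* (c :* (a :* u) :- c :* τ :+ τ :* τ :* τ) := c :* (a :* (c :* u) :- c :* τ :+ τ :* τ :* τ)) refl a₃ c u τ ⟩
      c * (a₃ * (c * u) - c * τ + τ * τ * τ)
        ≡⟨ cong₂ (λ x y → c * (a₃ * x - y * τ + τ * τ * τ)) cu (sym ω²) ⟩
      c * (a₃ * (a₃ * a₃ - ω * ω) - ω * ω * τ + τ * τ * τ)
        ≡⟨ solve 3 (λ a c ω → let τ = :- a :- ω in
             c :* (a :* (a :* a :- ω :* ω) :- ω :* ω :* τ :+ τ :* τ :* τ) := con 𝟎) refl a₃ c ω ⟩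
      0# ∎

-- The line in coordinates

module Line (F : Field) (3≡0 : CharThree F) where
  open Field F
  open Geom F
  open Quartic F
  open Char₃ F 3≡0
  open Chords F 3≡0 using (≡-V4)

  -- z₂ is normalised to 1, which makes the line the set of points
  -- (u : z₁u + z₄w : z₀u + z₃w : w).
  OnLine : Quart → V4 → Set
  OnLine (z₀ , z₁ , _ , z₃ , z₄) (v₀ , v₁ , v₂ , v₃) = v₁ ≡ z₁ * v₀ + z₄ * v₃ × v₂ ≡ z₀ * v₀ + z₃ * v₃

  infixr 7 _•ₚ_
  _•ₚ_ : Carrier → Quart → Quart
  c •ₚ (z₀ , z₁ , z₂ , z₃ , z₄) = c * z₀ , c * z₁ , c * z₂ , c * z₃ , c * z₄

  module _ (x y : V4) (p : Carrier) (p≢0 : p ≢ 0#) (z₀ z₁ z₃ z₄ : Carrier)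
           (fL≡ : fL x y ≡ p •ₚ (z₀ , z₁ , 1# , z₃ , z₄)) where
    private
      x₀ = proj₁ x
      x₁ = proj₁ (proj₂ x)
      x₂ = proj₁ (proj₂ (proj₂ x))
      x₃ = proj₂ (proj₂ (proj₂ x))
      y₀ = proj₁ y
      y₁ = proj₁ (proj₂ y)
      y₂ = proj₁ (proj₂ (proj₂ y))
      y₃ = proj₂ (proj₂ (proj₂ y))

      p₀₃ : x₀ * y₃ - x₃ * y₀ ≡ p
      p₀₃ = trans (cong (proj₁ ∘ proj₂ ∘ proj₂) fL≡) (*-identityʳ p)

      combine : ∀ {c} (m n u w : Carrier) → p * c ≡ p * m * u + p * n * w → c ≡ m * u + n * w
      combine m n u w e = *-cancelˡ p≢0 (trans e
        (solve 5 (λ p m n u w → p :* m :* u :+ p :* n :* w := p :* (m :* u :+ n :* w)) refl p m n u w))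

    -- Two 3 × 3 minors of the rows x, y, v vanish: p₀₃v₁ = p₁₃v₀ + p₀₁v₃ and p₀₃v₂ = p₂₃v₀ + p₀₂v₃.
    -- Dividing by p₀₃ = p gives the equations.
    inSpan⇒onLine : ∀ {v} → InSpan x y v → OnLine (z₀ , z₁ , 1# , z₃ , z₄) v
    inSpan⇒onLine (a , b , refl) =
      combine z₁ z₄ _ _ (trans (cong (_* (a * x₁ + b * y₁)) (sym p₀₃))
        (trans (solve 8 (λ a b x₀ x₁ x₃ y₀ y₁ y₃ → (x₀ :* y₃ :- x₃ :* y₀) :* (a :* x₁ :+ b :* y₁) :=
            (x₁ :* y₃ :- x₃ :* y₁) :* (a :* x₀ :+ b :* y₀) :+ (x₀ :* y₁ :- x₁ :* y₀) :* (a :* x₃ :+ b :* y₃))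
            refl a b x₀ x₁ x₃ y₀ y₁ y₃)
          (cong₂ (λ m n → m * (a * x₀ + b * y₀) + n * (a * x₃ + b * y₃))
            (cong (proj₁ ∘ proj₂) fL≡) (cong (proj₂ ∘ proj₂ ∘ proj₂ ∘ proj₂) fL≡)))) ,
      combine z₀ z₃ _ _ (trans (cong (_* (a * x₂ + b * y₂)) (sym p₀₃))
        (trans (solve 8 (λ a b x₀ x₁ x₃ y₀ y₁ y₃ → (x₀ :* y₃ :- x₃ :* y₀) :* (a :* x₁ :+ b :* y₁) :=
            (x₁ :* y₃ :- x₃ :* y₁) :* (a :* x₀ :+ b :* y₀) :+ (x₀ :* y₁ :- x₁ :* y₀) :* (a :* x₃ :+ b :* y₃))
            refl a b x₀ x₂ x₃ y₀ y₂ y₃)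
          (cong₂ (λ m n → m * (a * x₀ + b * y₀) + n * (a * x₃ + b * y₃))
            (cong proj₁ fL≡) (cong (proj₁ ∘ proj₂ ∘ proj₂ ∘ proj₂) fL≡))))

    -- Cramer's rule in coordinates 0 and 3, whose determinant is p₀₃ = p.
    onLine⇒inSpan : ∀ {v} → OnLine (z₀ , z₁ , 1# , z₃ , z₄) v → InSpan x y v
    onLine⇒inSpan {v₀ , _ , _ , v₃} (refl , refl) = p ⁻¹ * (v₀ * y₃ - v₃ * y₀) , p ⁻¹ * (v₃ * x₀ - v₀ * x₃) , ≡-V4
      (through x₀ y₀ (trans (cong (_* v₀) (sym p₀₃)) (solve 6 (λ x₀ x₃ y₀ y₃ v₀ v₃ → (x₀ :* y₃ :- x₃ :* y₀) :* v₀ :=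
        (v₀ :* y₃ :- v₃ :* y₀) :* x₀ :+ (v₃ :* x₀ :- v₀ :* x₃) :* y₀) refl x₀ x₃ y₀ y₃ v₀ v₃)))
      (through x₁ y₁ (inner (cong (proj₁ ∘ proj₂) fL≡) (cong (proj₂ ∘ proj₂ ∘ proj₂ ∘ proj₂) fL≡)))
      (through x₂ y₂ (inner (cong proj₁ fL≡) (cong (proj₁ ∘ proj₂ ∘ proj₂ ∘ proj₂) fL≡)))
      (through x₃ y₃ (trans (cong (_* v₃) (sym p₀₃)) (solve 6 (λ x₀ x₃ y₀ y₃ v₀ v₃ → (x₀ :* y₃ :- x₃ :* y₀) :* v₃ :=
        (v₀ :* y₃ :- v₃ :* y₀) :* x₃ :+ (v₃ :* x₀ :- v₀ :* x₃) :* y₃) refl x₀ x₃ y₀ y₃ v₀ v₃)))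
      where
      α β : Carrier
      α = v₀ * y₃ - v₃ * y₀
      β = v₃ * x₀ - v₀ * x₃
      through : ∀ {c} xᵢ yᵢ → p * c ≡ α * xᵢ + β * yᵢ → c ≡ p ⁻¹ * α * xᵢ + p ⁻¹ * β * yᵢ
      through {c} xᵢ yᵢ e = *-cancelˡ p≢0 (trans e (sym (begin
        p * (p ⁻¹ * α * xᵢ + p ⁻¹ * β * yᵢ)
          ≡⟨ solve 6 (λ p i a b x y → p :* (i :* a :* x :+ i :* b :* y) := p :* i :* (a :* x :+ b :* y)) refl p (p ⁻¹) α β xᵢ yᵢ ⟩
        p * p ⁻¹ * (α * xᵢ + β * yᵢ) ≡⟨ cong (_* (α * xᵢ + β * yᵢ)) (⁻¹-inverse p p≢0) ⟩
        1# * (α * xᵢ + β * yᵢ)       ≡⟨ *-identityˡ _ ⟩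
        α * xᵢ + β * yᵢ              ∎)))
        where open ≡-Reasoning
      inner : ∀ {m n xᵢ yᵢ} → xᵢ * y₃ - x₃ * yᵢ ≡ p * m → x₀ * yᵢ - xᵢ * y₀ ≡ p * n →
              p * (m * v₀ + n * v₃) ≡ α * xᵢ + β * yᵢ
      inner {m} {n} {xᵢ} {yᵢ} e e' = begin
        p * (m * v₀ + n * v₃)     ≡⟨ solve 5 (λ p m n u w → p :* (m :* u :+ n :* w) := p :* m :* u :+ p :* n :* w) refl p m n v₀ v₃ ⟩
        p * m * v₀ + p * n * v₃   ≡⟨ cong₂ (λ a b → a * v₀ + b * v₃) (sym e) (sym e') ⟩
        (xᵢ * y₃ - x₃ * yᵢ) * v₀ + (x₀ * yᵢ - xᵢ * y₀) * v₃
          ≡⟨ solve 8 (λ x₀ x₃ y₀ y₃ x y v₀ v₃ → (x :* y₃ :- x₃ :* y) :* v₀ :+ (x₀ :* y :- x :* y₀) :* v₃ :=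
               (v₀ :* y₃ :- v₃ :* y₀) :* x :+ (v₃ :* x₀ :- v₀ :* x₃) :* y) refl x₀ x₃ y₀ y₃ xᵢ yᵢ v₀ v₃ ⟩
        α * xᵢ + β * yᵢ           ∎
        where open ≡-Reasoning

    -- A multiple root of f_L is the parameter of a point of C on the line.
    noDoubleRoot : (∀ s t → NonzeroPair s t → ¬ InSpan x y (ν s t)) → NoDoubleRoot (z₀ , z₁ , 1# , z₃ , z₄)
    noDoubleRoot ∉C s t st≢0 e₁ e₂ = ∉C s t st≢0 (onLine⇒inSpan (isolate e₂ , isolate e₁))
      where
      -- Solved for the term with coefficient 1, the vanishing derivatives in Y and X are the two
      -- equations of `OnLine` at `ν s t`.
      isolate : ∀ {a b c d e} → a * b - 1# * c + d * e ≡ 0# → c ≡ a * b + d * e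
      isolate {a} {b} {c} {d} {e} eq = sym (x-y≡0⇒x≡y (trans
        (solve 3 (λ u c v → u :+ v :- c := u :- con 𝟏 :* c :+ v) refl (a * b) c (d * e)) eq))

-- The q + 1 points of the line

module ProjectiveLine {q : ℕ} {A : Set} (fin : Finite A q) where
  private module E = Enumeration fin

  finite : Finite (Maybe A) (suc q)
  finite = nothing ∷ map just E.elements
    , Allₚ.map⁺ (All.tabulate λ _ ()) ∷ Uniqueₚ.map⁺ just-injective E.elements-unique
    , (λ { nothing → (λ _ → tt) , λ _ → here refl
         ; (just a) → (λ _ → tt) , λ _ → there (∈-map⁺ just (E.∈-elements a)) })
    , cong suc (trans (length-map just E.elements) E.length-elements)

  open Enumeration finite public

  ∑-split : (f : Maybe A → ℕ) → ∑ f ≡ f nothing ℕ.+ E.∑ (f ∘ just)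
  ∑-split f = cong (λ xs → f nothing ℕ.+ sum xs) (sym (map-∘ E.elements))

module _ {A : Set} (f : A → ℕ) (f≤2 : ∀ a → f a ℕ.≤ 2) where

  level : ℕ → List A → ℕ
  level k xs = length (filter (λ a → f a ℕ.≟ k) xs)

  -- For f = ρ the levels 0, 1, 2 are nonsquares, zeros and nonzero squares. This identity and the
  -- next recover the levels 2 and 0 from the number of zeros and the total.
  level-sum : ∀ xs → 2 ℕ.* level 2 xs ℕ.+ level 1 xs ≡ sum (map f xs)
  level-sum []       = refl
  level-sum (x ∷ xs) with f x | f≤2 x | level-sum xs
  ... | 0 | _ | ih = ih
  ... | 1 | _ | ih = trans (ℕₚ.+-suc _ _) (cong suc ih)
  ... | 2 | _ | ih = trans (cong (ℕ._+ level 1 xs) (ℕₚ.*-suc 2 (level 2 xs))) (cong (suc ∘ suc) ih)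
  ... | suc (suc (suc _)) | ℕ.s≤s (ℕ.s≤s ()) | _

  level-length : ∀ xs → level 0 xs ℕ.+ (level 2 xs ℕ.+ level 1 xs) ≡ length xs
  level-length []       = refl
  level-length (x ∷ xs) with f x | f≤2 x | level-length xs
  ... | 0 | _ | ih = cong suc ih
  ... | 1 | _ | ih = trans (cong (level 0 xs ℕ.+_) (ℕₚ.+-suc _ _)) (trans (ℕₚ.+-suc _ _) (cong suc ih))
  ... | 2 | _ | ih = trans (ℕₚ.+-suc _ _) (cong suc ih)
  ... | suc (suc (suc _)) | ℕ.s≤s (ℕ.s≤s ()) | _

-- The points of the line are indexed by Maybe Carrier; just v stands for the parameter (1 : v³)
-- because the chord discriminant there is the cube of f(1 , v).
module LinePoints (F : Field) {q : ℕ} (fin : IsFinite F q) (h : ℕ) (q≡3^h : q ≡ 3 ℕ.^ h) (3≡0 : CharThree F) where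
  open Field F
  open Geom F
  open Quartic F
  open Char₃ F 3≡0
  open Chords F 3≡0
  open Line F 3≡0
  open SquareRoots F fin 3≡0
  private
    module FF = FiniteField F fin
    open FF using (_≟_)

  cubes-injective : ∀ {x y} → x * x * x ≡ y * y * y → x ≡ y
  cubes-injective = cube-injective _≟_ (FF.cubeRoot h q≡3^h)

  module _ (z₀ z₁ z₃ z₄ : Carrier) where
    private
      z : Quart
      z = z₀ , z₁ , 1# , z₃ , z₄

    private
      v∞ : V4
      v∞ = 0# , z₄ , z₃ , 1#

      OnLineAt∞ : Carrier → Set
      OnLineAt∞ w = Normalized (0# , z₄ * w , z₃ * w , w)

      -- The line meets v₀ = 0 in (0 : z₄ : z₃ : 1), and the normalising factor depends on which
      -- coordinate is the first nonzero one. Its uniqueness makes this the only normalised point of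
      -- the line with v₀ = 0.
      scale∞ : ∃ λ κ → κ ≢ 0# × Normalized (κ • v∞) × (∀ w → OnLineAt∞ w → w ≡ κ)
      scale∞ = go (z₄ ≟ 0#) (z₃ ≟ 0#)
        where
        go : Dec (z₄ ≡ 0#) → Dec (z₃ ≡ 0#) → ∃ λ κ → κ ≢ 0# × Normalized (κ • v∞) × (∀ w → OnLineAt∞ w → w ≡ κ)
        go (no z₄≢0) _ = z₄ ⁻¹ , ⁻¹-nonzero z₄≢0 , inj₂ (inj₁ (zeroʳ _ , inverseˡ z₄≢0)) , unique
          where
          w≡0⇒⊥ : ∀ {w} → z₄ * w ≡ 0# → w ≢ 0# → ⊥
          w≡0⇒⊥ e w≢0 = *-nonzero z₄≢0 w≢0 e
          unique : ∀ w → OnLineAt∞ w → w ≡ z₄ ⁻¹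
          unique w (inj₁ e)                                 = ⊥-elim (0≢1 e)
          unique w (inj₂ (inj₁ (_ , e)))                    = ⁻¹-unique z₄≢0 e
          unique w (inj₂ (inj₂ (inj₁ (_ , e , e'))))        =
            ⊥-elim (w≡0⇒⊥ e (λ w≡0 → 0≢1 (trans (sym (zeroʳ z₃)) (trans (cong (z₃ *_) (sym w≡0)) e'))))
          unique w (inj₂ (inj₂ (inj₂ (_ , e , _ , w≡1))))   = ⊥-elim (w≡0⇒⊥ e (λ w≡0 → 0≢1 (trans (sym w≡0) w≡1)))
        go (yes z₄≡0) (no z₃≢0) = z₃ ⁻¹ , ⁻¹-nonzero z₃≢0
          , inj₂ (inj₂ (inj₁ (zeroʳ _ , trans (cong (z₃ ⁻¹ *_) z₄≡0) (zeroʳ _) , inverseˡ z₃≢0))) , unique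
          where
          unique : ∀ w → OnLineAt∞ w → w ≡ z₃ ⁻¹
          unique w (inj₁ e)                               = ⊥-elim (0≢1 e)
          unique w (inj₂ (inj₁ (_ , e)))                  = ⊥-elim (0≢1 (trans (sym (zeroˡ w)) (trans (cong (_* w) (sym z₄≡0)) e)))
          unique w (inj₂ (inj₂ (inj₁ (_ , _ , e))))       = ⁻¹-unique z₃≢0 e
          unique w (inj₂ (inj₂ (inj₂ (_ , _ , e , w≡1)))) = ⊥-elim (*-nonzero z₃≢0 (λ w≡0 → 0≢1 (trans (sym w≡0) w≡1)) e)
        go (yes z₄≡0) (yes z₃≡0) = 1# , 0≢1 ∘ sym
          , inj₂ (inj₂ (inj₂ (zeroʳ _ , trans (*-identityˡ _) z₄≡0 , trans (*-identityˡ _) z₃≡0 , *-identityˡ _))) , unique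
          where
          unique : ∀ w → OnLineAt∞ w → w ≡ 1#
          unique w (inj₁ e)                               = ⊥-elim (0≢1 e)
          unique w (inj₂ (inj₁ (_ , e)))                  = ⊥-elim (0≢1 (trans (sym (zeroˡ w)) (trans (cong (_* w) (sym z₄≡0)) e)))
          unique w (inj₂ (inj₂ (inj₁ (_ , _ , e))))       = ⊥-elim (0≢1 (trans (sym (zeroˡ w)) (trans (cong (_* w) (sym z₃≡0)) e)))
          unique w (inj₂ (inj₂ (inj₂ (_ , _ , _ , w≡1)))) = w≡1

      κ : Carrier
      κ = proj₁ scale∞

      κ≢0 : κ ≢ 0#
      κ≢0 = proj₁ (proj₂ scale∞)

    point : Maybe Carrier → V4
    point nothing  = κ • v∞
    point (just v) = 1# , z₁ + z₄ * (v * v * v) , z₀ + z₃ * (v * v * v) , v * v * v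

    point-normalized : ∀ P → Normalized (point P)
    point-normalized nothing  = proj₁ (proj₂ (proj₂ scale∞))
    point-normalized (just v) = inj₁ refl

    point-onLine : ∀ P → OnLine z (point P)
    point-onLine nothing  = at∞ z₁ z₄ , at∞ z₀ z₃
      where
      at∞ : ∀ a b → κ * b ≡ a * (κ * 0#) + b * (κ * 1#)
      at∞ a b = solve 3 (λ a b κ → κ :* b := a :* (κ :* con 𝟎) :+ b :* (κ :* con 𝟏)) refl a b κ
    point-onLine (just v) = cong (_+ z₄ * (v * v * v)) (sym (*-identityʳ z₁)) , cong (_+ z₃ * (v * v * v)) (sym (*-identityʳ z₀))

    point-complete : ∀ v → Normalized v → OnLine z v → ∃ λ P → v ≡ point P
    point-complete (v₀ , v₁ , v₂ , v₃) (inj₁ refl) (refl , refl) with FF.cubeRoot h q≡3^h v₃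
    ... | w , refl = just w , ≡-V4 refl (cong (_+ z₄ * (w * w * w)) (*-identityʳ z₁)) (cong (_+ z₃ * (w * w * w)) (*-identityʳ z₀)) refl
    point-complete (v₀ , v₁ , v₂ , v₃) (inj₂ n) (e₁ , e₂) = nothing , ≡-V4
      (trans (v₀≡0 n) (sym (zeroʳ κ))) (trans v₁≡ (outer z₄)) (trans v₂≡ (outer z₃)) (trans v₃≡κ (sym (*-identityʳ κ)))
      where
      v₀≡0 : (v₀ ≡ 0# × v₁ ≡ 1#) ⊎ (v₀ ≡ 0# × v₁ ≡ 0# × v₂ ≡ 1#) ⊎ (v₀ ≡ 0# × v₁ ≡ 0# × v₂ ≡ 0# × v₃ ≡ 1#) → v₀ ≡ 0#
      v₀≡0 (inj₁ (e , _))        = e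
      v₀≡0 (inj₂ (inj₁ (e , _))) = e
      v₀≡0 (inj₂ (inj₂ (e , _))) = e
      drop : ∀ a b → a * v₀ + b * v₃ ≡ b * v₃
      drop a b = trans (cong (λ u → a * u + b * v₃) (v₀≡0 n)) (solve 2 (λ a c → a :* con 𝟎 :+ c := c) refl a (b * v₃))
      v₁≡ : v₁ ≡ z₄ * v₃
      v₁≡ = trans e₁ (drop z₁ z₄)
      v₂≡ : v₂ ≡ z₃ * v₃
      v₂≡ = trans e₂ (drop z₀ z₃)
      v₃≡κ : v₃ ≡ κ
      v₃≡κ = proj₂ (proj₂ (proj₂ scale∞)) v₃ (subst Normalized (≡-V4 (v₀≡0 n) v₁≡ v₂≡ refl) (inj₂ n))
      outer : ∀ b → b * v₃ ≡ κ * b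
      outer b = trans (cong (b *_) v₃≡κ) (*-comm b κ)

    point-injective : ∀ {P Q} → point P ≡ point Q → P ≡ Q
    point-injective {nothing} {nothing} _ = refl
    point-injective {just v}  {just w}  e = cong just (cubes-injective (cong (proj₂ ∘ proj₂ ∘ proj₂) e))
    point-injective {nothing} {just w}  e = ⊥-elim (0≢1 (trans (sym (zeroʳ κ)) (cong proj₁ e)))
    point-injective {just v}  {nothing} e = ⊥-elim (0≢1 (trans (sym (zeroʳ κ)) (sym (cong proj₁ e))))

    point-∉AX : ∀ P → ¬ InAX (point P)
    point-∉AX nothing  (_ , e) = κ≢0 (trans (sym (*-identityʳ κ)) e)
    point-∉AX (just v) (e , _) = 0≢1 (sym e)

    point-nonzero : ∀ P → Nonzero (point P)
    point-nonzero P e = point-∉AX P (cong proj₁ e , cong (proj₂ ∘ proj₂ ∘ proj₂) e)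

    -- The discriminant is the cube f³ = f²·f of the value, times κ⁴ at (0 : 1); hence it has the
    -- square class of f.
    point-disc : ∀ P → ∃ λ g → (value z P ≢ 0# → g ≢ 0#) × disc (point P) ≡ g * g * value z P
    point-disc nothing = κ * κ * z₄ , *-nonzero (*-nonzero κ≢0 κ≢0) , trans (disc-• κ v∞)
      (solve 3 (λ κ z₃ z₄ → κ :* κ :* (κ :* κ) :* (con 𝟎 :* con 𝟎 :* (con 𝟏 :* con 𝟏) :+ z₄ :* z₄ :* z₄ :* con 𝟏 :+ con 𝟎 :* (z₃ :* z₃ :* z₃)) :=
        (κ :* κ :* z₄) :* (κ :* κ :* z₄) :* z₄) refl κ z₃ z₄)
    point-disc (just v) = eval z v , (λ e → e) , solve 5 (λ z₀ z₁ z₃ z₄ v →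
      let w = v :* v :* v
          y₁ = z₁ :+ z₄ :* w
          y₂ = z₀ :+ z₃ :* w
          e = z₀ :+ v :* (z₁ :+ v :* (con 𝟏 :+ v :* (z₃ :+ v :* z₄))) in
      con 𝟏 :* con 𝟏 :* (w :* w) :+ y₁ :* y₁ :* y₁ :* w :+ con 𝟏 :* (y₂ :* y₂ :* y₂) := e :* e :* e) refl z₀ z₁ z₃ z₄ v

    disc≡0⇒value≡0 : ∀ P → disc (point P) ≡ 0# → value z P ≡ 0#
    disc≡0⇒value≡0 P e = go (value z P ≟ 0#) (point-disc P)
      where
      go : Dec (value z P ≡ 0#) → (∃ λ g → (value z P ≢ 0# → g ≢ 0#) × disc (point P) ≡ g * g * value z P) → value z P ≡ 0#
      go (yes r) _              = r
      go (no ne) (g , g≢0 , d≡) = *≡0⇒≡0 (*-nonzero (g≢0 ne) (g≢0 ne)) (trans (sym d≡) e)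

    value≡0⇒disc≡0 : ∀ P → value z P ≡ 0# → disc (point P) ≡ 0#
    value≡0⇒disc≡0 P e = let (g , _ , d≡) = point-disc P in trans d≡ (trans (cong (g * g *_) e) (zeroʳ _))

    disc-square⇒value-square : ∀ P → Square (disc (point P)) → Square (value z P)
    disc-square⇒value-square P s = go (value z P ≟ 0#) (point-disc P)
      where
      go : Dec (value z P ≡ 0#) → (∃ λ g → (value z P ≢ 0# → g ≢ 0#) × disc (point P) ≡ g * g * value z P) → Square (value z P)
      go (yes r) _              = subst Square (sym r) square-0
      go (no ne) (g , g≢0 , d≡) = square-unscale (g≢0 ne) (subst Square d≡ s)

    value-square⇒disc-square : ∀ P → Square (value z P) → Square (disc (point P))
    value-square⇒disc-square P s = let (g , _ , d≡) = point-disc P in subst Square (sym d≡) (square-scale (value z P) s)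

    inT⇒value≡0 : ∀ P → InT (point P) → value z P ≡ 0#
    inT⇒value≡0 P (onT , _) = disc≡0⇒value≡0 P (disc-tangent onT)

    module _ (∉C : ∀ P → ¬ InC (point P)) where

      value≡0⇒inT : ∀ P → value z P ≡ 0# → InT (point P)
      value≡0⇒inT P e = tangent-through _≟_ (FF.cubeRoot h q≡3^h) (point P) (point-∉AX P) (value≡0⇒disc≡0 P e)
        , ∉C P , point-∉AX P

      -- The discriminant is the square of abd³. This is nonzero, since a = 0 or b = 0 would make
      -- the point an end of the chord, on C.
      inRC⇒square : ∀ P → InRC (point P) → value z P ≢ 0# × Square (value z P)
      inRC⇒square P (v∉C , s , t , s' , t' , d≢0 , a , b , e) =
        (λ r → *-nonzero (*-nonzero a≢0 b≢0) d³≢0 (w≡0 (trans (sym d²) (value≡0⇒disc≡0 P r)))) ,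
        disc-square⇒value-square P (_ , sym d²)
        where
        d w : Carrier
        d = s * t' - s' * t
        w = a * b * (d * d * d)
        d³≢0 : d * d * d ≢ 0#
        d³≢0 = *-nonzero (*-nonzero d≢0 d≢0) d≢0
        d² : disc (point P) ≡ w * w
        d² = trans (cong disc e) (disc-chord {a} {s} {t} {b} {s'} {t'})
        w≡0 : w * w ≡ 0# → w ≡ 0#
        w≡0 e with w ≟ 0#
        ... | yes r = r
        ... | no ne = ⊥-elim (*-nonzero ne ne e)
        0•ˡ : ∀ {a b} (v w : V4) → a ≡ 0# → a • v ⊕ b • w ≡ b • w
        0•ˡ (v₀ , v₁ , v₂ , v₃) (w₀ , w₁ , w₂ , w₃) refl = ≡-V4 (f v₀ w₀) (f v₁ w₁) (f v₂ w₂) (f v₃ w₃)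
          where
          f : ∀ {b} x y → 0# * x + b * y ≡ b * y
          f {b} x y = solve 3 (λ x b y → con 𝟎 :* x :+ b :* y := b :* y) refl x b y
        0•ʳ : ∀ {a b} (v w : V4) → b ≡ 0# → a • v ⊕ b • w ≡ a • v
        0•ʳ (v₀ , v₁ , v₂ , v₃) (w₀ , w₁ , w₂ , w₃) refl = ≡-V4 (f v₀ w₀) (f v₁ w₁) (f v₂ w₂) (f v₃ w₃)
          where
          f : ∀ {a} x y → a * x + 0# * y ≡ a * x
          f {a} x y = solve 3 (λ a x y → a :* x :+ con 𝟎 :* y := a :* x) refl a x y
        0•≡0 : ∀ {c} (v : V4) → c ≡ 0# → c • v ≡ 0v
        0•≡0 _ refl = ≡-V4 (zeroˡ _) (zeroˡ _) (zeroˡ _) (zeroˡ _)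
        st≢0 : NonzeroPair s t
        st≢0 (refl , refl) = d≢0 (solve 2 (λ x y → con 𝟎 :* x :- y :* con 𝟎 := con 𝟎) refl t' s')
        st'≢0 : NonzeroPair s' t'
        st'≢0 (refl , refl) = d≢0 (solve 2 (λ x y → x :* con 𝟎 :- con 𝟎 :* y := con 𝟎) refl s t)
        a≢0 : a ≢ 0#
        a≢0 a≡0 = v∉C (s' , t' , st'≢0 , b , b≢0' , v≡)
          where
          v≡ : point P ≡ b • ν s' t'
          v≡ = trans e (0•ˡ (ν s t) (ν s' t') a≡0)
          b≢0' : b ≢ 0#
          b≢0' b≡0 = point-nonzero P (trans v≡ (0•≡0 (ν s' t') b≡0))
        b≢0 : b ≢ 0#
        b≢0 b≡0 = v∉C (s , t , st≢0 , a , a≢0 , trans e (0•ʳ (ν s t) (ν s' t') b≡0))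

      square⇒inRC : ∀ P → value z P ≢ 0# → Square (value z P) → InRC (point P)
      square⇒inRC P ne s = ∉C P , chordAt (value-square⇒disc-square P s) (hA v ≟ 0#)
        where
        v : V4
        v = point P
        D≢0 : disc v ≢ 0#
        D≢0 = ne ∘ disc≡0⇒value≡0 P
        chordAt : Square (disc v) → Dec (hA v ≡ 0#) →
          ∃₂ λ s₁ t₁ → ∃₂ λ s₂ t₂ → (s₁ * t₂ - s₂ * t₁ ≢ 0#) × InSpan (ν s₁ t₁) (ν s₂ t₂) v
        chordAt (ω , ω²) (no A≢0) = hB v - ω , hA v , hB v + ω , hA v
          , (λ e → *-nonzero ω≢0 A≢0 (trans (sym (chord-det (hA v) (hB v) ω)) e)) , chord-through v ω ω² ω≢0 A≢0
          where
          ω≢0 : ω ≢ 0#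
          ω≢0 ω≡0 = D≢0 (trans (sym ω²) (trans (cong (_* ω) ω≡0) (zeroˡ ω)))
        chordAt _ (yes A≡0) = 1# , 0# , hC v , - hB v
          , (λ e → -‿nonzero (proj₁ (chord-through-0 v A≡0 D≢0)) (trans (solve 2 (λ b c → b := con 𝟏 :* b :- c :* con 𝟎) refl (- hB v) (hC v)) e)) , proj₂ (chord-through-0 v A≡0 D≢0)

-- Factorisation types and numbers of roots

module Factorisation (F : Field) (3≡0 : CharThree F) (_≟_ : DecidableEquality (Field.Carrier F)) where
  open Field F
  open Geom F
  open Quartic F
  open Char₃ F 3≡0

  linAt : Lin → Maybe Carrier → Carrier
  linAt (m , n) nothing  = n
  linAt (m , n) (just v) = m + v * n

  quadAt : Quad → Maybe Carrier → Carrier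
  quadAt (g₀ , g₁ , g₂) nothing  = g₂
  quadAt (g₀ , g₁ , g₂) (just v) = g₀ + v * (g₁ + v * g₂)

  cubAt : Cub → Maybe Carrier → Carrier
  cubAt (g₀ , g₁ , g₂ , g₃) nothing  = g₃
  cubAt (g₀ , g₁ , g₂ , g₃) (just v) = g₀ + v * (g₁ + v * (g₂ + v * g₃))

  quadAt-ll : ∀ l k P → quadAt (l ·ll k) P ≡ linAt l P * linAt k P
  quadAt-ll (m , n) (m' , n') nothing  = refl
  quadAt-ll (m , n) (m' , n') (just v) = solve 5 (λ m n m' n' v →
    m :* m' :+ v :* ((m :* n' :+ n :* m') :+ v :* (n :* n')) := (m :+ v :* n) :* (m' :+ v :* n')) refl m n m' n' v

  value-qq : ∀ g h P → value (g ·qq h) P ≡ quadAt g P * quadAt h P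
  value-qq (a₀ , a₁ , a₂) (b₀ , b₁ , b₂) nothing  = refl
  value-qq (a₀ , a₁ , a₂) (b₀ , b₁ , b₂) (just v) = solve 7 (λ a₀ a₁ a₂ b₀ b₁ b₂ v →
    a₀ :* b₀ :+ v :* ((a₀ :* b₁ :+ a₁ :* b₀) :+ v :* ((a₀ :* b₂ :+ a₁ :* b₁ :+ a₂ :* b₀) :+ v :* ((a₁ :* b₂ :+ a₂ :* b₁) :+ v :* (a₂ :* b₂))))
      := (a₀ :+ v :* (a₁ :+ v :* a₂)) :* (b₀ :+ v :* (b₁ :+ v :* b₂))) refl a₀ a₁ a₂ b₀ b₁ b₂ v

  value-lc : ∀ l c P → value (l ·lc c) P ≡ linAt l P * cubAt c P
  value-lc (m , n) (c₀ , c₁ , c₂ , c₃) nothing  = refl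
  value-lc (m , n) (c₀ , c₁ , c₂ , c₃) (just v) = solve 7 (λ m n c₀ c₁ c₂ c₃ v →
    m :* c₀ :+ v :* ((m :* c₁ :+ n :* c₀) :+ v :* ((m :* c₂ :+ n :* c₁) :+ v :* ((m :* c₃ :+ n :* c₂) :+ v :* (n :* c₃))))
      := (m :+ v :* n) :* (c₀ :+ v :* (c₁ :+ v :* (c₂ :+ v :* c₃)))) refl m n c₀ c₁ c₂ c₃ v

  private
    1*+0* : ∀ x y → x ≡ 1# * x + 0# * y
    1*+0* = solve 2 (λ x y → x := con 𝟏 :* x :+ con 𝟎 :* y) refl

    0*≡ : ∀ {x} y → x ≡ 0# → x ≡ 0# * y
    0*≡ y e = trans e (sym (zeroˡ y))

    horner : ∀ v x y → x ≡ - v * y + 1# * (x + v * y)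
    horner = solve 3 (λ v x y → x := :- v :* y :+ con 𝟏 :* (x :+ v :* y)) refl

    hornerₑ : ∀ v {x} y → x + v * y ≡ 0# → x ≡ - v * y
    hornerₑ v {x} y e = x-y≡0⇒x≡y (trans (solve 3 (λ v x y → x :- :- v :* y := x :+ v :* y) refl v x y) e)

  -- A root at (0 : 1) splits off X, a root at (1 : v) splits off Y - vX with the quotient given by
  -- Horner's scheme. Contrapositively, irreducible factors have no roots.
  quad-factor : ∀ g P → quadAt g P ≡ 0# → ∃₂ λ l k → g ≡ l ·ll k
  quad-factor (g₀ , g₁ , g₂) nothing e = (1# , 0#) , (g₀ , g₁) ,
    cong₂ _,_ (sym (*-identityˡ _)) (cong₂ _,_ (1*+0* g₁ g₀) (0*≡ g₁ e))
  quad-factor (g₀ , g₁ , g₂) (just v) e = (- v , 1#) , (g₁ + v * g₂ , g₂) ,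
    cong₂ _,_ (hornerₑ v _ e) (cong₂ _,_ (horner v g₁ g₂) (sym (*-identityˡ _)))

  cub-factor : ∀ g P → cubAt g P ≡ 0# → ∃₂ λ l k → g ≡ l ·lq k
  cub-factor (g₀ , g₁ , g₂ , g₃) nothing e = (1# , 0#) , (g₀ , g₁ , g₂) ,
    cong₂ _,_ (sym (*-identityˡ _)) (cong₂ _,_ (1*+0* g₁ g₀) (cong₂ _,_ (1*+0* g₂ g₁) (0*≡ g₂ e)))
  cub-factor (g₀ , g₁ , g₂ , g₃) (just v) e = (- v , 1#) , (g₁ + v * (g₂ + v * g₃) , g₂ + v * g₃ , g₃) ,
    cong₂ _,_ (hornerₑ v _ e) (cong₂ _,_ (horner v g₁ _) (cong₂ _,_ (horner v g₂ g₃) (sym (*-identityˡ _))))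

  quart-factor : ∀ g P → value g P ≡ 0# → ∃₂ λ l k → g ≡ l ·lc k
  quart-factor (g₀ , g₁ , g₂ , g₃ , g₄) nothing e = (1# , 0#) , (g₀ , g₁ , g₂ , g₃) ,
    cong₂ _,_ (sym (*-identityˡ _)) (cong₂ _,_ (1*+0* g₁ g₀) (cong₂ _,_ (1*+0* g₂ g₁) (cong₂ _,_ (1*+0* g₃ g₂) (0*≡ g₃ e))))
  quart-factor (g₀ , g₁ , g₂ , g₃ , g₄) (just v) e = (- v , 1#) ,
    (g₁ + v * (g₂ + v * (g₃ + v * g₄)) , g₂ + v * (g₃ + v * g₄) , g₃ + v * g₄ , g₄) ,
    cong₂ _,_ (hornerₑ v _ e) (cong₂ _,_ (horner v g₁ _) (cong₂ _,_ (horner v g₂ _) (cong₂ _,_ (horner v g₃ g₄) (sym (*-identityˡ _)))))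

  rootOf : Lin → Maybe Carrier
  rootOf (m , n) with n ≟ 0#
  ... | yes _ = nothing
  ... | no _  = just (- (m * n ⁻¹))

  rootOf-isRoot : ∀ l → linAt l (rootOf l) ≡ 0#
  rootOf-isRoot (m , n) with n ≟ 0#
  ... | yes n≡0 = n≡0
  ... | no n≢0  = begin
    m + - (m * n ⁻¹) * n ≡⟨ solve 3 (λ m n i → m :+ :- (m :* i) :* n := m :- m :* (n :* i)) refl m n (n ⁻¹) ⟩
    m - m * (n * n ⁻¹)   ≡⟨ cong (λ u → m - m * u) (⁻¹-inverse n n≢0) ⟩
    m - m * 1#           ≡⟨ solve 1 (λ m → m :- m :* con 𝟏 := con 𝟎) refl m ⟩
    0#                   ∎
    where open ≡-Reasoning

  rootOf-unique : ∀ l → NonzeroPair (proj₁ l) (proj₂ l) → ∀ P → linAt l P ≡ 0# → P ≡ rootOf l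
  rootOf-unique (m , n) l≢0 P e with n ≟ 0#
  rootOf-unique (m , n) l≢0 nothing  e | yes n≡0 = refl
  rootOf-unique (m , n) l≢0 (just v) e | yes n≡0 = ⊥-elim (l≢0 (trans (sym (trans (cong (λ n → m + v * n) n≡0)
    (solve 2 (λ m v → m :+ v :* con 𝟎 := m) refl m v))) e , n≡0))
  rootOf-unique (m , n) l≢0 nothing  e | no n≢0 = ⊥-elim (n≢0 e)
  rootOf-unique (m , n) l≢0 (just v) e | no n≢0 = cong just (*-cancelˡ n≢0 (begin
    n * v                ≡⟨ solve 3 (λ m n v → n :* v := (m :+ v :* n) :- m) refl m n v ⟩
    m + v * n - m        ≡⟨ cong (_- m) e ⟩
    0# - m               ≡⟨ solve 1 (λ m → con 𝟎 :- m := con 𝟏 :* :- m) refl m ⟩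
    1# * - m             ≡⟨ cong (_* - m) (sym (⁻¹-inverse n n≢0)) ⟩
    n * n ⁻¹ * - m       ≡⟨ solve 3 (λ n i m → n :* i :* :- m := n :* :- (m :* i)) refl n (n ⁻¹) m ⟩
    n * - (m * n ⁻¹)     ∎))
    where open ≡-Reasoning

  private
    homogeneous : Maybe Carrier → Carrier × Carrier
    homogeneous nothing  = 0# , 1#
    homogeneous (just v) = 1# , v

    homogeneous-nonzero : ∀ P → NonzeroPair (proj₁ (homogeneous P)) (proj₂ (homogeneous P))
    homogeneous-nonzero nothing  (_ , e) = 0≢1 (sym e)
    homogeneous-nonzero (just v) (e , _) = 0≢1 (sym e)

    linAt-homogeneous : ∀ l P → proj₁ l * proj₁ (homogeneous P) + proj₂ l * proj₂ (homogeneous P) ≡ linAt l P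
    linAt-homogeneous (m , n) nothing  = solve 2 (λ m n → m :* con 𝟎 :+ n :* con 𝟏 := n) refl m n
    linAt-homogeneous (m , n) (just v) = solve 3 (λ m n v → m :* con 𝟏 :+ n :* v := m :+ v :* n) refl m n v

  -- By the product rule both derivatives of LL'G lie in the ideal (L, L'), so a common root of L
  -- and L' is a double root.
  noCommonRoot : ∀ l k g → NoDoubleRoot ((l ·ll k) ·qq g) → ∀ P → linAt l P ≡ 0# → linAt k P ≡ 0# → ⊥
  noCommonRoot (m , n) (m' , n') (g₀ , g₁ , g₂) nd P e e' = nd s t (homogeneous-nonzero P)
    (trans (solve 9 (λ m n m' n' g₀ g₁ g₂ s t → let
        L = m :* s :+ n :* t
        L' = m' :* s :+ n' :* t
        G = g₀ :* (s :* s) :+ g₁ :* (s :* t) :+ g₂ :* (t :* t)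
        a₀ = m :* m'
        a₁ = m :* n' :+ n :* m'
        a₂ = n :* n' in
        a₀ :* g₀ :* (s :* s :* s) :- (a₀ :* g₂ :+ a₁ :* g₁ :+ a₂ :* g₀) :* (s :* t :* t) :+ (a₁ :* g₂ :+ a₂ :* g₁) :* (t :* t :* t)
        := L :* (m' :* G :+ L' :* (g₁ :* t :- g₀ :* s)) :+ L' :* (m :* G)) refl m n m' n' g₀ g₁ g₂ s t)
      (vanish _ _))
    (trans (solve 9 (λ m n m' n' g₀ g₁ g₂ s t → let
        L = m :* s :+ n :* t
        L' = m' :* s :+ n' :* t
        G = g₀ :* (s :* s) :+ g₁ :* (s :* t) :+ g₂ :* (t :* t)
        a₀ = m :* m'
        a₁ = m :* n' :+ n :* m'
        a₂ = n :* n' in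
        (a₀ :* g₁ :+ a₁ :* g₀) :* (s :* s :* s) :- (a₀ :* g₂ :+ a₁ :* g₁ :+ a₂ :* g₀) :* (s :* s :* t) :+ a₂ :* g₂ :* (t :* t :* t)
        := L :* (n' :* G :+ L' :* (g₁ :* s :- g₂ :* t)) :+ L' :* (n :* G)) refl m n m' n' g₀ g₁ g₂ s t)
      (vanish _ _))
    where
    s t : Carrier
    s = proj₁ (homogeneous P)
    t = proj₂ (homogeneous P)
    vanish : ∀ x y → (m * s + n * t) * x + (m' * s + n' * t) * y ≡ 0#
    vanish x y = trans (cong₂ (λ a b → a * x + b * y) (trans (linAt-homogeneous (m , n) P) e) (trans (linAt-homogeneous (m' , n') P) e'))
      (solve 2 (λ x y → con 𝟎 :* x :+ con 𝟎 :* y := con 𝟎) refl x y)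

  private
    zero-factor : ∀ {x y} → x * y ≡ 0# → x ≡ 0# ⊎ y ≡ 0#
    zero-factor {x} e with x ≟ 0#
    ... | yes x≡0 = inj₁ x≡0
    ... | no x≢0  = inj₂ (*≡0⇒≡0 x≢0 e)

    *-zeroˡ : ∀ {x} y → x ≡ 0# → x * y ≡ 0#
    *-zeroˡ y refl = zeroˡ y

    *-zeroʳ : ∀ x {y} → y ≡ 0# → x * y ≡ 0#
    *-zeroʳ x refl = zeroʳ x

    linAt-0 : ∀ l → proj₁ l ≡ 0# × proj₂ l ≡ 0# → ∀ P → linAt l P ≡ 0#
    linAt-0 _ (refl , refl) nothing  = refl
    linAt-0 _ (refl , refl) (just v) = solve 1 (λ v → con 𝟎 :+ v :* con 𝟎 := con 𝟎) refl v

    ll-comm : ∀ l k → l ·ll k ≡ k ·ll l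
    ll-comm (a , b) (c , d) = cong₂ _,_ (*-comm a c) (cong₂ _,_
      (solve 4 (λ a b c d → a :* d :+ b :* c := c :* b :+ d :* a) refl a b c d) (*-comm b d))

    qq-comm : ∀ g h → g ·qq h ≡ h ·qq g
    qq-comm (a₀ , a₁ , a₂) (b₀ , b₁ , b₂) = cong₂ _,_ (*-comm _ _) (cong₂ _,_
      (solve 4 (λ a b c d → a :* d :+ b :* c := c :* b :+ d :* a) refl a₀ a₁ b₀ b₁) (cong₂ _,_
      (solve 6 (λ a b c d e f → a :* f :+ b :* e :+ c :* d := d :* c :+ e :* b :+ f :* a) refl a₀ a₁ a₂ b₀ b₁ b₂) (cong₂ _,_
      (solve 4 (λ a b c d → a :* d :+ b :* c := c :* b :+ d :* a) refl a₁ a₂ b₁ b₂) (*-comm _ _))))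

    ll-exchange : ∀ l₁ l₂ l₃ l₄ → (l₁ ·ll l₂) ·qq (l₃ ·ll l₄) ≡ (l₁ ·ll l₃) ·qq (l₂ ·ll l₄)
    ll-exchange (a , b) (c , d) (e , f) (g , h) = cong₂ _,_
      (solve 8 (exchanged λ a b c d e f g h → a₀ a b c d :* a₀ e f g h) refl a b c d e f g h) (cong₂ _,_
      (solve 8 (exchanged λ a b c d e f g h → a₀ a b c d :* a₁ e f g h :+ a₁ a b c d :* a₀ e f g h) refl a b c d e f g h) (cong₂ _,_
      (solve 8 (exchanged λ a b c d e f g h → a₀ a b c d :* a₂ e f g h :+ a₁ a b c d :* a₁ e f g h :+ a₂ a b c d :* a₀ e f g h)
        refl a b c d e f g h) (cong₂ _,_
      (solve 8 (exchanged λ a b c d e f g h → a₁ a b c d :* a₂ e f g h :+ a₂ a b c d :* a₁ e f g h) refl a b c d e f g h)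
      (solve 8 (exchanged λ a b c d e f g h → a₂ a b c d :* a₂ e f g h) refl a b c d e f g h))))
      where
      a₀ a₁ a₂ : ∀ {n} (a b c d : Polynomial n) → Polynomial n
      a₀ a b c d = a :* c
      a₁ a b c d = a :* d :+ b :* c
      a₂ a b c d = b :* d
      exchanged : ∀ {n} → ((a b c d e f g h : Polynomial n) → Polynomial n) →
                  (a b c d e f g h : Polynomial n) → Polynomial n × Polynomial n
      exchanged X a b c d e f g h = X a b c d e f g h := X a b e f c d g h

  NoCommonRoot : Lin → Lin → Set
  NoCommonRoot l k = ∀ P → linAt l P ≡ 0# → linAt k P ≡ 0# → ⊥

  NonzeroLin : Lin → Set
  NonzeroLin (m , n) = NonzeroPair m n

  -- The zero form vanishes everywhere, in particular at the root of the other form.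
  nonzeroˡ : ∀ {l k} → NoCommonRoot l k → NonzeroLin l
  nonzeroˡ {l} {k} nc l≡0 = nc (rootOf k) (linAt-0 l l≡0 (rootOf k)) (rootOf-isRoot k)

  nonzeroʳ : ∀ {l k} → NoCommonRoot l k → NonzeroLin k
  nonzeroʳ {l} {k} nc k≡0 = nc (rootOf l) (rootOf-isRoot l) (linAt-0 k k≡0 (rootOf l))

  linearRootCount : ∀ ls → All NonzeroLin ls → AllPairs NoCommonRoot ls →
    HasCount (λ P → Any (λ l → linAt l P ≡ 0#) ls) (length ls)
  linearRootCount ls nz nc = map rootOf ls
    , AllPairsₚ.map⁺ (AllPairs.map (λ {l} {k} nc e → nc (rootOf l) (rootOf-isRoot l)
        (subst (λ P → linAt k P ≡ 0#) (sym e) (rootOf-isRoot k))) nc)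
    , (λ P → to , from) , length-map rootOf ls
    where
    to : ∀ {P} → P ∈ map rootOf ls → Any (λ l → linAt l P ≡ 0#) ls
    to P∈ with ∈-map⁻ rootOf P∈
    ... | l , l∈ , refl = lose l∈ (rootOf-isRoot l)
    from : ∀ {P} → Any (λ l → linAt l P ≡ 0#) ls → P ∈ map rootOf ls
    from {P} a with find a
    ... | l , l∈ , e = subst (_∈ map rootOf ls) (sym (rootOf-unique l (All.lookup nz l∈) P e)) (∈-map⁺ rootOf l∈)

  -- The roots come from the linear factors only, and these have distinct roots because a shared one
  -- would be double.
  rootCount : ∀ i f → NoDoubleRoot f → TypeF i f → HasCount (λ P → value f P ≡ 0#) i
  rootCount 1 f nd (l , g , irr , refl) = HasCount-cong
    (λ { {P} (here e) → trans (value-lc l g P) (*-zeroˡ _ e) ; (there ()) })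
    (λ {P} e → [ here , (λ e → ⊥-elim (irr (cub-factor g P e))) ]′ (zero-factor (trans (sym (value-lc l g P)) e)))
    (linearRootCount (l ∷ []) (l≢0 nd ∷ []) ([] ∷ []))
    where
    l≢0 : ∀ {l} → NoDoubleRoot (l ·lc g) → NonzeroLin l
    l≢0 nd (refl , refl) = nd 1# 0# (λ (e , _) → 0≢1 (sym e))
      (solve 4 (λ g₀ g₁ g₂ g₃ → con 𝟎 :* g₀ :* (con 𝟏 :* con 𝟏 :* con 𝟏) :- (con 𝟎 :* g₂ :+ con 𝟎 :* g₁) :* (con 𝟏 :* con 𝟎 :* con 𝟎)
        :+ (con 𝟎 :* g₃ :+ con 𝟎 :* g₂) :* (con 𝟎 :* con 𝟎 :* con 𝟎) := con 𝟎) refl _ _ _ _)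
      (solve 4 (λ g₀ g₁ g₂ g₃ → (con 𝟎 :* g₁ :+ con 𝟎 :* g₀) :* (con 𝟏 :* con 𝟏 :* con 𝟏) :- (con 𝟎 :* g₂ :+ con 𝟎 :* g₁) :* (con 𝟏 :* con 𝟏 :* con 𝟎)
        :+ con 𝟎 :* g₃ :* (con 𝟎 :* con 𝟎 :* con 𝟎) := con 𝟎) refl _ _ _ _)
  rootCount 2 f nd (l , k , g , irr , refl) = HasCount-cong
    (λ { {P} (here e)         → trans (product P) (*-zeroˡ _ (*-zeroˡ _ e))
       ; {P} (there (here e)) → trans (product P) (*-zeroˡ _ (*-zeroʳ _ e))
       ; (there (there ())) })
    (λ {P} e → [ [ here , there ∘ here ]′ ∘ zero-factor , (λ e → ⊥-elim (irr (quad-factor g P e))) ]′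
                 (zero-factor (trans (sym (product P)) e)))
    (linearRootCount (l ∷ k ∷ []) (nonzeroˡ nc ∷ nonzeroʳ nc ∷ []) ((nc ∷ []) ∷ [] ∷ []))
    where
    nc : NoCommonRoot l k
    nc = noCommonRoot l k g nd
    product : ∀ P → value ((l ·ll k) ·qq g) P ≡ linAt l P * linAt k P * quadAt g P
    product P = trans (value-qq (l ·ll k) g P) (cong (_* quadAt g P) (quadAt-ll l k P))
  rootCount 4 f nd (l₁ , l₂ , l₃ , l₄ , refl) = HasCount-cong
    (λ { {P} (here e)                         → trans (product P) (*-zeroˡ _ (*-zeroˡ _ e))
       ; {P} (there (here e))                 → trans (product P) (*-zeroˡ _ (*-zeroʳ _ e))
       ; {P} (there (there (here e)))         → trans (product P) (*-zeroʳ _ (*-zeroˡ _ e))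
       ; {P} (there (there (there (here e)))) → trans (product P) (*-zeroʳ _ (*-zeroʳ _ e))
       ; (there (there (there (there ())))) })
    (λ {P} e → [ [ here , there ∘ here ]′ ∘ zero-factor
               , [ there ∘ there ∘ here , there ∘ there ∘ there ∘ here ]′ ∘ zero-factor ]′
                 (zero-factor (trans (sym (product P)) e)))
    (linearRootCount (l₁ ∷ l₂ ∷ l₃ ∷ l₄ ∷ [])
      (nonzeroˡ nc₁₂ ∷ nonzeroʳ nc₁₂ ∷ nonzeroˡ nc₃₄ ∷ nonzeroʳ nc₃₄ ∷ [])
      ((nc₁₂ ∷ nc₁₃ ∷ nc₁₄ ∷ []) ∷ (nc₂₃ ∷ nc₂₄ ∷ []) ∷ (nc₃₄ ∷ []) ∷ [] ∷ []))
    where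
    product : ∀ P → value ((l₁ ·ll l₂) ·qq (l₃ ·ll l₄)) P ≡ linAt l₁ P * linAt l₂ P * (linAt l₃ P * linAt l₄ P)
    product P = trans (value-qq (l₁ ·ll l₂) (l₃ ·ll l₄) P) (cong₂ _*_ (quadAt-ll l₁ l₂ P) (quadAt-ll l₃ l₄ P))
    -- `noCommonRoot` compares the two leading linear factors, so the product is rearranged to bring
    -- each pair to the front.
    nd₁₃ : NoDoubleRoot ((l₁ ·ll l₃) ·qq (l₂ ·ll l₄))
    nd₁₃ = subst NoDoubleRoot (ll-exchange l₁ l₂ l₃ l₄) nd
    nd₁₄ : NoDoubleRoot ((l₁ ·ll l₄) ·qq (l₂ ·ll l₃))
    nd₁₄ = subst NoDoubleRoot (trans (cong ((l₁ ·ll l₂) ·qq_) (ll-comm l₃ l₄)) (ll-exchange l₁ l₂ l₄ l₃)) nd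
    nc₁₂ : NoCommonRoot l₁ l₂
    nc₁₂ = noCommonRoot l₁ l₂ _ nd
    nc₁₃ : NoCommonRoot l₁ l₃
    nc₁₃ = noCommonRoot l₁ l₃ _ nd₁₃
    nc₁₄ : NoCommonRoot l₁ l₄
    nc₁₄ = noCommonRoot l₁ l₄ _ nd₁₄
    nc₂₃ : NoCommonRoot l₂ l₃
    nc₂₃ = noCommonRoot l₂ l₃ _ (subst NoDoubleRoot (qq-comm (l₁ ·ll l₄) (l₂ ·ll l₃)) nd₁₄)
    nc₂₄ : NoCommonRoot l₂ l₄
    nc₂₄ = noCommonRoot l₂ l₄ _ (subst NoDoubleRoot (qq-comm (l₁ ·ll l₃) (l₂ ·ll l₄)) nd₁₃)
    nc₃₄ : NoCommonRoot l₃ l₄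
    nc₃₄ = noCommonRoot l₃ l₄ _ (subst NoDoubleRoot (qq-comm (l₁ ·ll l₂) (l₃ ·ll l₄)) nd)

  noRoots : ∀ f → 𝓕₂' f ⊎ 𝓕₄' f → HasCount (λ P → value f P ≡ 0#) 0
  noRoots f (inj₁ (irr , _)) = HasCount-none λ P e → irr (quart-factor f P e)
  noRoots f (inj₂ (g , h , irr-g , irr-h , refl)) = HasCount-none λ P e →
    [ (λ e → irr-g (quad-factor g P e)) , (λ e → irr-h (quad-factor h P e)) ]′ (zero-factor (trans (sym (value-qq g h P)) e))

open import Data.Nat using (_^_; _*_)

-- The count on a generic line

module GenericLine (F : Field) {q : ℕ} (h : ℕ) (fin : IsFinite F q) (q≡3^h : q ≡ 3 ^ h)
  (K : Field) (ι : RingHom F K) (finK : IsFinite K (q * q))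
  (x y : Geom.V4 F) (generic : Generic F x y) where

  open Field F renaming (_*_ to _·_)
  open Geom F
  open Quartic F
  private
    3≡0 : CharThree F
    3≡0 = FiniteField.charThree F fin h q≡3^h
    module FF = FiniteField F fin
    module KF = Field K
    open FF using (_≟_)
    open RingHom ι
    open Hom ι
  open Char₃ F 3≡0
  open SquareRoots F fin 3≡0
  open QuarticCount F fin 3≡0
  open Line F 3≡0
  open Factorisation F 3≡0 _≟_
  open LinePoints F fin h q≡3^h 3≡0
  open QuadraticExtension F K ι h q≡3^h fin finK 3≡0 using (inIC⇒nonsquare; nonsquare⇒inIC; conic-nondegenerate)
  module PL = ProjectiveLine fin

  p : Carrier
  p = proj₁ (proj₂ (proj₂ (fL x y)))

  -- If p₀₃ = 0, then (x₀, x₃) and (y₀, y₃) are proportional, and a plane through the axis contains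
  -- both points; cube roots of its coefficients present it as an osculating plane. If both pairs
  -- are zero, the line lies in the axis and any such plane will do.
  p≢0 : p ≢ 0#
  p≢0 p≡0 = go (proj₁ x ≟ 0#) (proj₂ (proj₂ (proj₂ x)) ≟ 0#) (proj₁ y ≟ 0#) (proj₂ (proj₂ (proj₂ y)) ≟ 0#)
    where
    x₀ x₃ y₀ y₃ : Carrier
    x₀ = proj₁ x
    x₃ = proj₂ (proj₂ (proj₂ x))
    y₀ = proj₁ y
    y₃ = proj₂ (proj₂ (proj₂ y))
    self : ∀ a b → b · a - a · b ≡ 0#
    self = solve 2 (λ a b → b :* a :- a :* b := con 𝟎) refl
    0³ : 0# · 0# · 0# ≡ 0#
    0³ = zeroʳ _
    osculating : ∀ a d → ¬ (a ≡ 0# × d ≡ 0#) → d · x₀ - a · x₃ ≡ 0# → d · y₀ - a · y₃ ≡ 0# → ⊥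
    osculating a d ad≢0 e e' = through (FF.cubeRoot h q≡3^h a) (FF.cubeRoot h q≡3^h d)
      where
      through : (∃ λ s → s · s · s ≡ a) → (∃ λ t → t · t · t ≡ d) → ⊥
      through (s , refl) (t , refl) = proj₂ generic (s , t , (λ { (refl , refl) → ad≢0 (0³ , 0³) }) , e , e')
    throughX : ¬ (x₀ ≡ 0# × x₃ ≡ 0#) → ⊥
    throughX ne = osculating x₀ x₃ ne (self x₀ x₃)
      (trans (solve 4 (λ x₀ x₃ y₀ y₃ → x₃ :* y₀ :- x₀ :* y₃ := :- (x₀ :* y₃ :- x₃ :* y₀)) refl x₀ x₃ y₀ y₃)
        (trans (cong -_ p≡0) -0#≈0#))
    throughY : ¬ (y₀ ≡ 0# × y₃ ≡ 0#) → ⊥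
    throughY ne = osculating y₀ y₃ ne
      (trans (solve 4 (λ x₀ x₃ y₀ y₃ → y₃ :* x₀ :- y₀ :* x₃ := x₀ :* y₃ :- x₃ :* y₀) refl x₀ x₃ y₀ y₃) p≡0) (self y₀ y₃)
    go : Dec (x₀ ≡ 0#) → Dec (x₃ ≡ 0#) → Dec (y₀ ≡ 0#) → Dec (y₃ ≡ 0#) → ⊥
    go (no x₀≢0) _ _ _ = throughX (x₀≢0 ∘ proj₁)
    go (yes _) (no x₃≢0) _ _ = throughX (x₃≢0 ∘ proj₂)
    go _ _ (no y₀≢0) _ = throughY (y₀≢0 ∘ proj₁)
    go _ _ (yes _) (no y₃≢0) = throughY (y₃≢0 ∘ proj₂)
    go (yes x₀≡0) (yes x₃≡0) (yes y₀≡0) (yes y₃≡0) =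
      osculating 1# 0# (λ (e , _) → 0≢1 (sym e)) (0-1 x₀ x₃ x₃≡0) (0-1 y₀ y₃ y₃≡0)
      where
      0-1 : ∀ a b → b ≡ 0# → 0# · a - 1# · b ≡ 0#
      0-1 a _ refl = solve 1 (λ a → con 𝟎 :* a :- con 𝟏 :* con 𝟎 := con 𝟎) refl a

  z₀ z₁ z₃ z₄ : Carrier
  z₀ = p ⁻¹ · proj₁ (fL x y)
  z₁ = p ⁻¹ · proj₁ (proj₂ (fL x y))
  z₃ = p ⁻¹ · proj₁ (proj₂ (proj₂ (proj₂ (fL x y))))
  z₄ = p ⁻¹ · proj₂ (proj₂ (proj₂ (proj₂ (fL x y))))

  z : Quart
  z = z₀ , z₁ , 1# , z₃ , z₄

  fL≡ : fL x y ≡ p •ₚ z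
  fL≡ = cong₂ _,_ (cancel _) (cong₂ _,_ (cancel _) (cong₂ _,_ (sym (*-identityʳ p)) (cong₂ _,_ (cancel _) (cancel _))))
    where
    cancel : ∀ a → a ≡ p · (p ⁻¹ · a)
    cancel a = sym (trans (sym (*-assoc _ _ _)) (trans (cong (_· a) (⁻¹-inverse p p≢0)) (*-identityˡ a)))

  ν∉line : ∀ s t → NonzeroPair s t → ¬ InSpan x y (ν s t)
  ν∉line s t st≢0 sp = proj₁ generic F (idHom F) (s , t , st≢0 , sp)

  z-noDoubleRoot : NoDoubleRoot z
  z-noDoubleRoot = noDoubleRoot x y p p≢0 z₀ z₁ z₃ z₄ fL≡ ν∉line

  -- Genericity over the quadratic extension rules out pairs of conjugate double roots, as required
  -- by `conic-nondegenerate`.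
  z-noDoubleRoot-K : Quartic.NoDoubleRoot K (⟦ z₀ ⟧ , ⟦ z₁ ⟧ , KF.1# , ⟦ z₃ ⟧ , ⟦ z₄ ⟧)
  z-noDoubleRoot-K = KL.noDoubleRoot (mapV ι x) (mapV ι y) ⟦ p ⟧ (map-nonzero p≢0) ⟦ z₀ ⟧ ⟦ z₁ ⟧ ⟦ z₃ ⟧ ⟦ z₄ ⟧
    (cong₂ _,_ (plücker (cong proj₁ fL≡)) (cong₂ _,_ (plücker (cong (proj₁ ∘ proj₂) fL≡))
      (cong₂ _,_ (trans (plücker (cong (proj₁ ∘ proj₂ ∘ proj₂) fL≡)) (cong (⟦ p ⟧ KF.*_) map-1))
      (cong₂ _,_ (plücker (cong (proj₁ ∘ proj₂ ∘ proj₂ ∘ proj₂) fL≡)) (plücker (cong (proj₂ ∘ proj₂ ∘ proj₂ ∘ proj₂) fL≡))))))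
    (λ s t st≢0 sp → proj₁ generic K ι (s , t , st≢0 , sp))
    where
    module KL = Line K (map-charThree 3≡0)
    plücker : ∀ {a b c d m} → a · b - c · d ≡ p · m → ⟦ a ⟧ KF.* ⟦ b ⟧ KF.- ⟦ c ⟧ KF.* ⟦ d ⟧ ≡ ⟦ p ⟧ KF.* ⟦ m ⟧
    plücker {m = m} e = trans (sym (refl ⟨*⟩ refl ⟨-⟩ refl ⟨*⟩ refl)) (trans (cong ⟦_⟧ e) (map-* p m))

  pointTotal : points z ≡ suc (curvePoints (Δ z))
  pointTotal = pointCount z₀ z₁ z₃ z₄ z-noDoubleRoot (conic-nondegenerate z₀ z₁ z₃ z₄ z-noDoubleRoot-K)

  pt : Maybe Carrier → V4
  pt = point z₀ z₁ z₃ z₄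

  pt∉C : ∀ P → ¬ InC (pt P)
  pt∉C P (s , t , st≢0 , c , c≢0 , e) = ν∉line s t st≢0 (onLine⇒inSpan x y p p≢0 z₀ z₁ z₃ z₄ fL≡
    (unscale z₁ z₄ (proj₁ on) , unscale z₀ z₃ (proj₂ on)))
    where
    on : OnLine z (c • ν s t)
    on = subst (OnLine z) e (point-onLine z₀ z₁ z₃ z₄ P)
    unscale : ∀ a b {u v w} → c · u ≡ a · (c · v) + b · (c · w) → u ≡ a · v + b · w
    unscale a b {u} {v} {w} e = *-cancelˡ c≢0 (trans e
      (solve 5 (λ a b c v w → a :* (c :* v) :+ b :* (c :* w) := c :* (a :* v :+ b :* w)) refl a b c v w))

  -- `pt` lists every normalised point of the line exactly once, so counts on the line become counts
  -- of values of f on PG(1,q).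
  countOnLine : {S : V4 → Set} {T : Maybe Carrier → Set} → (∀ P → T P → S (pt P)) → (∀ P → S (pt P) → T P) →
                ∀ {n} → HasCount T n → CountOnLine x y S n
  countOnLine {S} {T} T⇒S S⇒T = HasCount-map pt (point-injective z₀ z₁ z₃ z₄)
    (λ {P} tP → point-normalized z₀ z₁ z₃ z₄ P
              , onLine⇒inSpan x y p p≢0 z₀ z₁ z₃ z₄ fL≡ (point-onLine z₀ z₁ z₃ z₄ P) , T⇒S P tP)
    (λ {v} (nv , sp , sv) → let (P , v≡) = point-complete z₀ z₁ z₃ z₄ v nv (inSpan⇒onLine x y p p≢0 z₀ z₁ z₃ z₄ fL≡ sp)
                            in P , S⇒T P (subst S v≡ sv) , v≡)

  noneOnLine : {S : V4 → Set} → (∀ P → ¬ S (pt P)) → CountOnLine x y S 0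
  noneOnLine ¬S = countOnLine {T = λ _ → ⊥} (λ _ ()) ¬S (HasCount-none λ _ ())

  ρ-at : Maybe Carrier → ℕ
  ρ-at P = ρ (value z P)

  ρ-at≤2 : ∀ P → ρ-at P ℕ.≤ 2
  ρ-at≤2 P = ρ≤2 (value z P)

  #_ : ℕ → ℕ
  # k = level ρ-at ρ-at≤2 k PL.elements

  #-count : ∀ k → HasCount (λ P → ρ-at P ≡ k) (# k)
  #-count k = PL.HasCount-filter (λ P → ρ-at P ℕ.≟ k)

  conclusion : ∀ i → HasCount (λ P → value z P ≡ 0#) i → Concl F K ι q x y (curvePoints (Δ z)) i
  conclusion i roots =
      noneOnLine pt∉C
    , noneOnLine (point-∉AX z₀ z₁ z₃ z₄)
    , countOnLine (value≡0⇒inT z₀ z₁ z₃ z₄ pt∉C) (inT⇒value≡0 z₀ z₁ z₃ z₄) roots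
    , (# 2 , countOnLine (λ P e → let (ne , s) = ρ≡2⇒square e in square⇒inRC z₀ z₁ z₃ z₄ pt∉C P ne s)
                         (λ P rc → let (ne , s) = inRC⇒square z₀ z₁ z₃ z₄ pt∉C P rc in ρ-square ne s) (#-count 2)
           , weighted)
    , (# 0 , countOnLine (λ P e → nonsquare⇒inIC (pt P) (ρ≡0⇒nonsquare e ∘ disc-square⇒value-square z₀ z₁ z₃ z₄ P))
                         (λ P ic → ρ-nonsquare (inIC⇒nonsquare (pt P) (point-nonzero z₀ z₁ z₃ z₄ P) ic
                                                ∘ value-square⇒disc-square z₀ z₁ z₃ z₄ P)) (#-count 0)
           , complement)
    where
    open ≡-Reasoning
    #1≡i : # 1 ≡ i
    #1≡i = HasCount-unique (#-count 1) (HasCount-cong ρ-zero ρ≡1⇒zero roots)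
    weighted : 2 * # 2 ℕ.+ i ≡ suc (curvePoints (Δ z))
    weighted = begin
      2 * # 2 ℕ.+ i          ≡⟨ cong (2 * # 2 ℕ.+_) (sym #1≡i) ⟩
      2 * # 2 ℕ.+ # 1        ≡⟨ level-sum ρ-at ρ-at≤2 PL.elements ⟩
      PL.∑ ρ-at              ≡⟨ PL.∑-split ρ-at ⟩
      points z               ≡⟨ pointTotal ⟩
      suc (curvePoints (Δ z)) ∎
    total : # 0 ℕ.+ (# 2 ℕ.+ i) ≡ q ℕ.+ 1
    total = begin
      # 0 ℕ.+ (# 2 ℕ.+ i)    ≡⟨ cong (λ n → # 0 ℕ.+ (# 2 ℕ.+ n)) (sym #1≡i) ⟩
      # 0 ℕ.+ (# 2 ℕ.+ # 1)  ≡⟨ level-length ρ-at ρ-at≤2 PL.elements ⟩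
      _                      ≡⟨ PL.length-elements ⟩
      suc q                  ≡⟨ ℕₚ.+-comm 1 q ⟩
      q ℕ.+ 1                ∎
    complement : 2 * # 0 ℕ.+ (suc (curvePoints (Δ z)) ℕ.+ i) ≡ 2 * (q ℕ.+ 1)
    complement = begin
      2 * # 0 ℕ.+ (suc (curvePoints (Δ z)) ℕ.+ i) ≡⟨ cong (λ n → 2 * # 0 ℕ.+ (n ℕ.+ i)) (sym weighted) ⟩
      2 * # 0 ℕ.+ (2 * # 2 ℕ.+ i ℕ.+ i)
        ≡⟨ +-*-Solver.solve 3 (λ m n i → N2 :*ₙ m :+ₙ (N2 :*ₙ n :+ₙ i :+ₙ i) =ₙ N2 :*ₙ (m :+ₙ (n :+ₙ i))) refl (# 0) (# 2) i ⟩
      2 * (# 0 ℕ.+ (# 2 ℕ.+ i)) ≡⟨ cong (2 *_) total ⟩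
      2 * (q ℕ.+ 1)          ∎
      where
      open +-*-Solver using () renaming (_:*_ to _:*ₙ_; _:+_ to _:+ₙ_; _:=_ to _=ₙ_; con to conₙ)
      N2 : ∀ {n} → +-*-Solver.Polynomial n
      N2 = conₙ 2

  -- Δ is homogeneous of degree 6, like z₂⁶, so the factor p cancels. The convention 0⁻¹ = 0 makes
  -- the formula hold for Δ z = 0 too.
  jinv⁻¹ : jinv (fL x y) ⁻¹ ≡ Δ z
  jinv⁻¹ = trans (cong (λ f → jinv f ⁻¹) fL≡) (begin
    (pow (p · 1#) 6 · Δ (p •ₚ z) ⁻¹) ⁻¹ ≡⟨ cong₂ (λ a b → (a · b ⁻¹) ⁻¹) (cong (λ a → pow a 6) (*-identityʳ p)) Δ-scale ⟩
    (pow p 6 · (pow p 6 · Δ z) ⁻¹) ⁻¹   ≡⟨ cancel (Δ z ≟ 0#) ⟩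
    Δ z                                 ∎)
    where
    open ≡-Reasoning
    P : Carrier
    P = pow p 6
    Δ-scale : Δ (p •ₚ z) ≡ pow p 6 · Δ z
    Δ-scale = solve 5 (λ z₀ z₁ z₃ z₄ p → let
        a₀ = p :* z₀
        a₁ = p :* z₁
        a₂ = p :* con 𝟏
        a₃ = p :* z₃
        a₄ = p :* z₄
        I = a₀ :* a₄ :- a₁ :* a₃ in
      :pow³ I :+ :pow² I :* :pow² a₂ :- :pow³ a₂ :* (a₀ :* :pow² a₃ :+ a₄ :* :pow² a₁ :- a₀ :* a₂ :* a₄)
      := p :* (p :* (p :* :pow³ p)) :* :Δ z₀ z₁ z₃ z₄) refl z₀ z₁ z₃ z₄ p
    P≢0 : P ≢ 0#
    P≢0 = pow-nonzero p≢0 6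
    cancel : ∀ {d} → Dec (d ≡ 0#) → (P · (P · d) ⁻¹) ⁻¹ ≡ d
    cancel (yes refl) = trans (cong (λ a → (P · a) ⁻¹) (trans (cong _⁻¹ (zeroʳ P)) 0⁻¹≡0))
      (trans (cong _⁻¹ (zeroʳ P)) 0⁻¹≡0)
    cancel {d} (no d≢0) = trans (cong _⁻¹ (⁻¹-unique d≢0 (begin
      d · (P · (P · d) ⁻¹) ≡⟨ solve 3 (λ d P i → d :* (P :* i) := P :* d :* i) refl d P ((P · d) ⁻¹) ⟩
      P · d · (P · d) ⁻¹   ≡⟨ ⁻¹-inverse _ (*-nonzero P≢0 d≢0) ⟩
      1#                   ∎))) (⁻¹-involutive d)

  affineCount : HasCount (AffE (jinv (fL x y))) (curvePoints (Δ z))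
  affineCount = HasCount-cong
    (λ {(a , b)} e → trans (pow2 a) (trans e (cong (λ r → pow b 3 + pow b 2 - r) (sym jinv⁻¹))))
    (λ {(a , b)} e → trans (sym (pow2 a)) (trans e (cong (λ r → pow b 3 + pow b 2 - r) jinv⁻¹)))
    (FF.HasCount-fibres {R = λ a b → a · a ≡ pow b 3 + pow b 2 - Δ z} (λ b → ρ-counts _))
    where
    pow2 : ∀ a → pow a 2 ≡ a · a
    pow2 a = cong (a ·_) (*-identityʳ a)

  fL-noDoubleRoot : NoDoubleRoot (fL x y)
  fL-noDoubleRoot = subst NoDoubleRoot (sym fL≡) λ s t st≢0 e₁ e₂ →
    z-noDoubleRoot s t st≢0 (unscale z₀ z₃ e₁) (unscale z₁ z₄ e₂)
    where
    unscale : ∀ a b {u v w} → p · a · u - p · 1# · v + p · b · w ≡ 0# → a · u - 1# · v + b · w ≡ 0#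
    unscale a b {u} {v} {w} e = *≡0⇒≡0 p≢0 (trans
      (solve 6 (λ p a b u v w → p :* (a :* u :- con 𝟏 :* v :+ b :* w) := p :* a :* u :- p :* con 𝟏 :* v :+ p :* b :* w) refl p a b u v w) e)

  value-fL : ∀ P → value (fL x y) P ≡ p · value z P
  value-fL P = trans (cong (λ f → value f P) fL≡) (scaled P)
    where
    scaled : ∀ P → value (p •ₚ z) P ≡ p · value z P
    scaled nothing  = refl
    scaled (just v) = solve 6 (λ z₀ z₁ z₃ z₄ p v →
      :eval (p :* z₀) (p :* z₁) (p :* con 𝟏) (p :* z₃) (p :* z₄) v := p :* :eval z₀ z₁ (con 𝟏) z₃ z₄ v) refl z₀ z₁ z₃ z₄ p v

  normalisedRoots : ∀ {i} → HasCount (λ P → value (fL x y) P ≡ 0#) i → HasCount (λ P → value z P ≡ 0#) i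
  normalisedRoots = HasCount-cong (λ {P} e → *≡0⇒≡0 p≢0 (trans (sym (value-fL P)) e))
    (λ {P} e → trans (value-fL P) (trans (cong (p ·_) e) (zeroʳ p)))

theorem1p8 : (F : Field) (q h : ℕ) → IsFinite F q → q ≡ 3 ^ h
    → (K : Field) (ι : RingHom F K) → IsFinite K (q * q)
    → (x y : Geom.V4 F) → Geom.Nonzero F x → Geom.Nonzero F y → ¬ Geom.Proportional F x y
    → Generic F x y
    → ∃ λ e → HasCount (Geom.AffE F (Geom.jinv F (Geom.fL F x y))) e
    × ((i : ℕ) → Geom.TypeF F i (Geom.fL F x y) → Concl F K ι q x y e i)
    × (Geom.𝓕₂' F (Geom.fL F x y) ⊎ Geom.𝓕₄' F (Geom.fL F x y) → Concl F K ι q x y e 0)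
theorem1p8 F q h fin q≡3^h K ι finK x y _ _ _ generic =
  curvePoints (Geom.Δ F z) , affineCount
  , (λ i type → conclusion i (normalisedRoots (rootCount i (Geom.fL F x y) fL-noDoubleRoot type)))
  , (λ type → conclusion 0 (normalisedRoots (noRoots (Geom.fL F x y) type)))
  where
  open GenericLine F h fin q≡3^h K ι finK x y generic
  open QuarticCount F fin (FiniteField.charThree F fin h q≡3^h)
  open Factorisation F (FiniteField.charThree F fin h q≡3^h) (FiniteField._≟_ F fin)
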